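{- Let $m,n$ be nonnegative integers. Then: \begin{enumerate} \item $L_{m,n,1}=\dfrac{m^3}{36}+\dfrac{7m^2}{24}+\dfrac{11m}{12}+1-\dfrac{(m \bmod 2)}{8}-\dfrac{(m \bmod 3)}{9}$. \item For $(m,n)=(2,0),(1,2),(2,1),(1,3),(2,2),(1,4),(3,0)$ respectively, the numbers $L_{m,n,2m+n-2}$ (MDS codes with code distance $d=3$) are $2,1,2,1,0,0,0$, and the numbers $L_{m,n,2m+n-3}$ (MDS codes with code distance $d=4$) are $4,2,2,1,1,0,0$. \item If $2m+n=6$, then $L_{m,n,2}=0$. \item If $2m+n>6$ and $d$ is an integer with $2<d<2m+n$, then $L_{m,n,k}=0$ where $k=2m+n-d+1$; that is, $D(m,n)$ contains no MDS code with code distance $d$. \end{enumerate}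
   Context: The Shrikhande graph $\mathrm{Sh}$ is the Cayley graph on the group $\mathbb{Z}_4^2$ (elements written as two-digit strings $ab$, $a,b\in\mathbb{Z}_4$) with connection set $\{01,03,10,30,11,33\}$: two vertices are adjacent iff their difference lies in this set. $K$ denotes the complete graph $K_4$ on vertex set $\mathbb{Z}_4$. For nonnegative integers $m,n$, $D(m,n)$ is the Cartesian product of $m$ copies of $\mathrm{Sh}$ and $n$ copies of $K$ (for $m>0$ it is a Doob graph; $D(0,n)$ is the Hamming graph $H(n,4)$). Its vertices are $(s_1,\dots,s_m;h_1,\dots,h_n)$ with $s_i\in\mathbb{Z}_4^2$, $h_j\in\mathbb{Z}_4$, and the graph distance is $d(c,c')=\sum_i d_{\mathrm{Sh}}(s_i,s_i')+\sum_j d_K(h_j,h_j')$. A code is a subset of the vertex set; its code distance is the minimum distance between distinct codewords. For an integer $k\ge 1$, an MDS code with parameters $(m+n,4^k,d)$ is a code $C$ in $D(m,n)$ with $|C|=4^k$ and code distance $d=2m+n-k+1$. Codes $C,C'$ in $D(m,n)$ are equivalent if there are automorphisms $\theta_1,\dots,\theta_m$ of $\mathrm{Sh}$, permutations $\sigma_1,\dots,\sigma_n$ of $\mathbb{Z}_4$, and permutations $\pi\in S_m$, $\rho\in S_n$ such that $C'=\{(\theta_1(s_{\pi(1)}),\dots,\theta_m(s_{\pi(m)});\sigma_1(h_{\rho(1)}),\dots,\sigma_n(h_{\rho(n)})):(s_1,\dots,s_m;h_1,\dots,h_n)\in C\}$. $L_{m,n,k}$ denotes the number of equivalence classes of MDS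 codes in $D(m,n)$ with $4^k$ codewords (i.e. with code distance $2m+n-k+1$).
   Formalization: Item 1 is stated for m+n ≥ 1: for m=n=0 the graph D(0,0) has a single vertex, so it has no code with 4 codewords and L_{0,0,1}=0, whereas the formula gives 1. -}

module Defs where

open import Data.Bool using (Bool; true; false; _∧_; _∨_; if_then_else_)
open import Data.Nat using (ℕ; zero; suc; _+_; _*_; _∸_; _^_; _≤_; _<_; _%_)
open import Data.Nat.ListAction using (sum)
open import Data.Fin using (Fin; toℕ)
open import Data.Fin.Permutation using (Permutation′; _⟨$⟩ʳ_)
open import Data.Product using (_×_; _,_; Σ; Σ-syntax; ∃; ∃-syntax)
open import Data.Bool.ListAction using (any)
open import Data.List using (List; []; _∷_; length; map; allFin; cartesianProduct)
open import Data.List.Membership.Propositional using (_∈_)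
open import Data.List.Relation.Unary.Unique.Propositional using (Unique)
open import Data.Vec using (Vec; lookup; tabulate; toList; zipWith)
open import Relation.Binary.PropositionalEquality using (_≡_; _≢_)
open import Relation.Nullary using (¬_; does)
open import Function.Bundles using (_⇔_)
import Data.Fin as F
import Data.Nat as N

-- Generic graph distance on a finite graph given by a Boolean adjacency
-- relation, a Boolean equality and the list of all vertices.
-- reach t x y = "there is a walk of length ≤ t from x to y";
-- graphDist = least such t (searched for t < |V|, which suffices for a
-- connected graph; all graphs used below are connected).

module GraphDist {V : Set} (eqB : V → V → Bool) (adj : V → V → Bool)
                 (allV : List V) where
  reach : ℕ → V → V → Bool
  reach zero x y = eqB x y
  reach (suc t) x y = reach t x y ∨ any (λ z → adj x z ∧ reach t z y) allV

  leastFrom : ℕ → ℕ → (ℕ → Bool) → ℕ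
  leastFrom zero s p = s
  leastFrom (suc f) s p = if p s then s else leastFrom f (suc s) p

  graphDist : V → V → ℕ
  graphDist x y = leastFrom (length allV) 0 (λ t → reach t x y)

Z4 : Set
Z4 = Fin 4

eqZ4 : Z4 → Z4 → Bool
eqZ4 a b = does (a F.≟ b)

sub4 : Z4 → Z4 → ℕ
sub4 a b = (toℕ a + 4 ∸ toℕ b) % 4

ShV : Set
ShV = Z4 × Z4

eqSh : ShV → ShV → Bool
eqSh (a , b) (c , d) = eqZ4 a c ∧ eqZ4 b d

eqℕ : ℕ → ℕ → Bool
eqℕ x y = does (x N.≟ y)

inConn : ℕ → ℕ → Bool
inConn x y = any (λ p → eqℕ x (Data.Product.proj₁ p) ∧ eqℕ y (Data.Product.proj₂ p))
  ((0 , 1) ∷ (0 , 3) ∷ (1 , 0) ∷ (3 , 0) ∷ (1 , 1) ∷ (3 , 3) ∷ [])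

adjSh : ShV → ShV → Bool
adjSh (a , b) (c , d) = inConn (sub4 a c) (sub4 b d)

allSh : List ShV
allSh = cartesianProduct (allFin 4) (allFin 4)

dSh : ShV → ShV → ℕ
dSh = GraphDist.graphDist eqSh adjSh allSh

adjK : Z4 → Z4 → Bool
adjK a b = if eqZ4 a b then false else true

dK : Z4 → Z4 → ℕ
dK = GraphDist.graphDist eqZ4 adjK (allFin 4)

-- The graph D(m,n) = Sh^m □ K^n

Vertex : ℕ → ℕ → Set
Vertex m n = Vec ShV m × Vec Z4 n

dist : ∀ {m n} → Vertex m n → Vertex m n → ℕ
dist (s , h) (s′ , h′) =
  sum (toList (zipWith dSh s s′)) + sum (toList (zipWith dK h h′))

-- A code: a finite set of vertices, represented as a duplicate-free list.
Code : ℕ → ℕ → Set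
Code m n = List (Vertex m n)

HasCodeDistance : ∀ {m n} → Code m n → ℕ → Set
HasCodeDistance C d =
  (∀ {x y} → x ∈ C → y ∈ C → x ≢ y → d ≤ dist x y)
  × (∃[ x ] ∃[ y ] (x ∈ C × y ∈ C × x ≢ y × dist x y ≡ d))

-- MDS code with 4^k codewords in D(m,n) (k ≥ 1), code distance 2m+n-k+1.
-- (If k > 2m+n+1 no code has code distance 2m+n-k+1 ≤ 0; with truncated
-- subtraction the distance parameter becomes 0 which is also impossible.)
IsMDS : (m n k : ℕ) → Code m n → Set
IsMDS m n k C =
  1 ≤ k × Unique C × length C ≡ 4 ^ k × HasCodeDistance C (2 * m + n + 1 ∸ k)

record ShAut : Set where
  field
    fun : ShV → ShV
    inv : ShV → ShV
    inv-fun : ∀ x → inv (fun x) ≡ x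
    fun-inv : ∀ x → fun (inv x) ≡ x
    preserves : ∀ x y → adjSh (fun x) (fun y) ≡ adjSh x y

record Transform (m n : ℕ) : Set where
  field
    θ : Fin m → ShAut
    σ : Fin n → Permutation′ 4
    π : Permutation′ m
    ρ : Permutation′ n

apply : ∀ {m n} → Transform m n → Vertex m n → Vertex m n
apply T (s , h) =
  tabulate (λ i → ShAut.fun (θ i) (lookup s (π ⟨$⟩ʳ i)))
  , tabulate (λ j → σ j ⟨$⟩ʳ lookup h (ρ ⟨$⟩ʳ j))
  where open Transform T

Equivalent : ∀ {m n} → Code m n → Code m n → Set
Equivalent C C′ = ∃[ T ] (∀ x → (x ∈ C′) ⇔ (x ∈ map (apply T) C))

-- L m n k = N : the number of equivalence classes of MDS codes in D(m,n)
-- with 4^k codewords is N, i.e. there is a system of N representatives: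
-- N MDS codes, pairwise non-equivalent, such that every MDS code is
-- equivalent to one of them.

NumClasses : (m n k N : ℕ) → Set
NumClasses m n k N =
  Σ[ R ∈ Vec (Code m n) N ]
    ( (∀ i → IsMDS m n k (lookup R i))
    × (∀ i j → i ≢ j → ¬ Equivalent (lookup R i) (lookup R j))
    × (∀ C → IsMDS m n k C → ∃[ i ] Equivalent C (lookup R i)) )

{-# OPTIONS --safe #-}

-- For d = 2m+n the four codewords restrict to a 4-coclique in every Shrikhande coordinate.
-- Up to automorphism a labelled 4-coclique is of one of four types: either all differences
-- have order 2, or those of order 2 form one of the three perfect matchings of the labels.
-- Relabelling permutes the last three types, so classes are multisets of types modulo S₃.
--
-- A code with 16 words and d = 3 in D(2,0) or D(1,2) is the graph of a function on the
-- first coordinate, and a short search finds them all. A code with one more K₄ coordinate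
-- is a 4-colouring of a set of vertices that is known up to equivalence, in which close
-- vertices get different colours; such a colouring is forced, or does not exist. In D(3,0)
-- with d = 4 the words over a vertex and over four of its neighbours cannot be chosen.
--
-- All other nonexistence results come from shortening and puncturing, the Plotkin bound
-- (3N - 4 dist is a positive semidefinite kernel, N = 2m+n) and the sphere-packing bound.
module Submission where

open import Defs
open import Algebra.Bundles using (CommutativeSemiring)
open import Data.Bool using (Bool; true; false; _∧_; _∨_; not; if_then_else_; T)
open import Data.Bool.ListAction using (any; all)
open import Data.Bool.Properties using (T-∧; T-∨; T-≡; T?)
open import Data.Empty using (⊥; ⊥-elim)
open import Data.Fin using (Fin; zero; suc)
open import Data.Fin.Patterns using (0F; 1F; 2F; 3F)
open import Data.Fin.Permutation using (Permutation′; _⟨$⟩ʳ_; _⟨$⟩ˡ_; _∘ₚ_; lift₀)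
open import Data.Integer using (ℤ)
open import Data.List using (List; []; _∷_; _++_; length; map; filter; concatMap; take; allFin; cartesianProduct; upTo)
open import Data.List.Membership.Propositional using (_∈_; find; lose)
open import Data.List.Membership.Propositional.Properties using (∈-map⁺; ∈-map⁻; ∈-∃++; ∈-++⁺ˡ; ∈-++⁺ʳ; ∈-++⁻; ∈-filter⁻; ∈-concat⁺′; ∈-cartesianProduct⁺; ∈-allFin; ∈-lookup)
open import Data.List.Properties using (length-map; length-++; length-take)
open import Data.List.Relation.Unary.All using (All; []; _∷_)
open import Data.List.Relation.Unary.All.Properties using (all⁺; all⁻; ¬Any⇒All¬)
open import Data.List.Relation.Unary.AllPairs using ([]; _∷_)
open import Data.List.Relation.Unary.Any using (Any; here; there; any?)
open import Data.List.Relation.Unary.Any.Properties using (any⁺; any⁻)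
open import Data.List.Relation.Unary.Unique.Propositional using (Unique)
open import Data.Nat using (ℕ; zero; suc; _+_; _*_; _∸_; _^_; _≤_; _<_; _%_; z≤n; s≤s; _≡ᵇ_; _≤ᵇ_; _≤?_; _<?_)
open import Data.Nat.ListAction using (sum)
open import Data.Nat.Properties
open import Data.Nat.Solver using (module +-*-Solver)
open import Data.Product using (_×_; _,_; proj₁; proj₂; Σ-syntax; ∃-syntax)
open import Data.Sum using (_⊎_; inj₁; inj₂)
open import Data.Unit using (⊤; tt)
open import Data.Vec using (Vec; []; _∷_; lookup; tabulate; toList; zipWith; head; tail)
open import Data.Vec.Properties using (lookup∘tabulate; tabulate∘lookup; tabulate-cong)
open import Function using (_∘_; id)
open import Function.Bundles using (mk⇔; Equivalence)
open import Relation.Binary using (DecidableEquality)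
open import Relation.Binary.PropositionalEquality using (_≡_; _≢_; refl; sym; trans; cong; cong₂; subst; module ≡-Reasoning)
open import Relation.Nullary using (¬_; Dec; yes; no; contradiction)
open import Relation.Nullary.Decidable using (from-no)
import Algebra.Properties.CommutativeMonoid.Sum as MonoidSum
import Data.Fin as F
import Data.Fin.Permutation as Perm
import Data.Integer as ℤ
import Data.Integer.Properties as ℤP
import Data.Integer.Solver as ℤSolver
import Data.List as L
import Data.List.Relation.Unary.All as All
import Data.List.Relation.Unary.Any as Any
import Data.List.Relation.Unary.Any.Properties as AnyP
import Data.List.Relation.Unary.Unique.Propositional.Properties as UP
import Data.Nat as N
import Data.Product.Properties as ΠP
import Data.Rational as Q
import Data.Rational.Properties as QP
import Data.Rational.Unnormalised as ℚᵘ
import Data.Rational.Unnormalised.Properties as ℚᵘP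
import Data.Vec as V
import Data.Vec.Properties as VP
import Relation.Binary.Reasoning.Setoid as SetoidReasoning

-- The Shrikhande graph has the parameters of the product of two copies of K₄: 16 vertices, valency
-- 6, two common neighbours for any two distinct vertices. Ball sizes and the Plotkin kernel
-- therefore depend on N = 2m+n only, and these counting bounds cannot tell D(m,n) from the Hamming
-- graph H(N,4). For 2 < d < N they leave open the cases with N ≤ 5 and the case N = 6, d = 4, where
-- H(6,4) contains the hexacode; there the finer structure must decide, and it does so differently:
-- D(2,2) has a code, D(1,4) and D(3,0) have none.
--
-- These cases are settled by searches that the type checker evaluates. They stay small because
-- symmetries are used up before a search starts and because longer codes are obtained from the few
-- classes of shorter ones.
--
-- Inequivalence rests on the fact that the Shrikhande graph is not distance-transitive: the pairs
-- at distance 2 form two orbits. Counting the coordinates in which a pair of words lies in the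
-- smaller orbit gives the invariant that separates all representatives.

variable
  m n k : ℕ
  A B : Set

-- Finite statements proved by evaluation

∈-allSh : ∀ v → v ∈ allSh
∈-allSh (a , b) = ∈-cartesianProduct⁺ (∈-allFin a) (∈-allFin b)

all-T : (p : A → Bool) (xs : List A) → T (all p xs) → ∀ {x} → x ∈ xs → T (p x)
all-T p xs t = All.lookup (all⁺ p xs t)

any-T : (p : A → Bool) (xs : List A) → T (any p xs) → ∃[ x ] (x ∈ xs × T (p x))
any-T p xs t = find (any⁻ p xs t)

∀Sh : (p : ShV → Bool) → T (all p allSh) → ∀ v → T (p v)
∀Sh p t v = all-T p allSh t (∈-allSh v)

∀Sh² : (p : ShV → ShV → Bool) → T (all (λ x → all (p x) allSh) allSh) → ∀ x y → T (p x y)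
∀Sh² p t x = ∀Sh (p x) (∀Sh (λ x → all (p x) allSh) t x)

∀Sh³ : (p : ShV → ShV → ShV → Bool) →
       T (all (λ x → all (λ y → all (p x y) allSh) allSh) allSh) → ∀ x y z → T (p x y z)
∀Sh³ p t x = ∀Sh² (p x) (∀Sh (λ x → all (λ y → all (p x y) allSh) allSh) t x)

∀Z4 : (p : Z4 → Bool) → T (all p (allFin 4)) → ∀ a → T (p a)
∀Z4 p t a = all-T p (allFin 4) t (∈-allFin a)

∀Z4² : (p : Z4 → Z4 → Bool) → T (all (λ x → all (p x) (allFin 4)) (allFin 4)) → ∀ x y → T (p x y)
∀Z4² p t x = ∀Z4 (p x) (∀Z4 (λ x → all (p x) (allFin 4)) t x)

implies : Bool → Bool → Bool
implies a b = if a then b else true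

modus : ∀ {a b} → T (implies a b) → T a → T b
modus {true} p _ = p

_≟S_ : DecidableEquality ShV
_≟S_ = ΠP.≡-dec F._≟_ F._≟_

_≟V_ : DecidableEquality (Vertex m n)
_≟V_ = ΠP.≡-dec (VP.≡-dec _≟S_) (VP.≡-dec F._≟_)

-- Closed forms of the two graph distances; unlike the breadth-first search of
-- Defs they are cheap to evaluate.

_⊖_ : Z4 → Z4 → Z4
a  ⊖ 0F = a
0F ⊖ 1F = 3F
1F ⊖ 1F = 0F
2F ⊖ 1F = 1F
3F ⊖ 1F = 2F
0F ⊖ 2F = 2F
1F ⊖ 2F = 3F
2F ⊖ 2F = 0F
3F ⊖ 2F = 1F
0F ⊖ 3F = 1F
1F ⊖ 3F = 2F
2F ⊖ 3F = 3F
3F ⊖ 3F = 0F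

‖_,_‖ : Z4 → Z4 → ℕ
‖ 0F , 0F ‖ = 0
‖ 0F , 1F ‖ = 1
‖ 0F , 3F ‖ = 1
‖ 1F , 0F ‖ = 1
‖ 3F , 0F ‖ = 1
‖ 1F , 1F ‖ = 1
‖ 3F , 3F ‖ = 1
‖ _ , _ ‖ = 2

shD : ShV → ShV → ℕ
shD (a , b) (c , d) = ‖ a ⊖ c , b ⊖ d ‖

kD : Z4 → Z4 → ℕ
kD a b = if eqZ4 a b then 0 else 1

-- The breadth-first search is evaluated only here and in `dK≡kD`; all later computations go through
-- `shD` and `kD`.
dSh≡shD : ∀ x y → dSh x y ≡ shD x y
dSh≡shD x y = ≡ᵇ⇒≡ _ _ (∀Sh² (λ x y → dSh x y ≡ᵇ shD x y) tt x y)

dK≡kD : ∀ x y → dK x y ≡ kD x y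
dK≡kD x y = ≡ᵇ⇒≡ _ _ (∀Z4² (λ x y → dK x y ≡ᵇ kD x y) tt x y)

shD-sym : ∀ x y → shD x y ≡ shD y x
shD-sym x y = ≡ᵇ⇒≡ _ _ (∀Sh² (λ x y → shD x y ≡ᵇ shD y x) tt x y)

kD-sym : ∀ x y → kD x y ≡ kD y x
kD-sym x y = ≡ᵇ⇒≡ _ _ (∀Z4² (λ x y → kD x y ≡ᵇ kD y x) tt x y)

shD-tri : ∀ x y z → shD x z ≤ shD x y + shD y z
shD-tri x y z = ≤ᵇ⇒≤ _ _ (∀Sh³ (λ x y z → shD x z ≤ᵇ shD x y + shD y z) tt x y z)

kD-tri : ∀ x y z → kD x z ≤ kD x y + kD y z
kD-tri x y z with x F.≟ z | x F.≟ y | y F.≟ z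
... | yes _ | _ | _ = z≤n
... | no _ | no _ | _ = s≤s z≤n
... | no _ | yes _ | no _ = s≤s z≤n
... | no x≢z | yes refl | yes refl = contradiction refl x≢z

shD-refl : ∀ x → shD x x ≡ 0
shD-refl x = ≡ᵇ⇒≡ _ _ (∀Sh (λ x → shD x x ≡ᵇ 0) tt x)

kD-refl : ∀ x → kD x x ≡ 0
kD-refl x = ≡ᵇ⇒≡ _ _ (∀Z4 (λ x → kD x x ≡ᵇ 0) tt x)

shD≤2 : ∀ x y → shD x y ≤ 2
shD≤2 x y = ≤ᵇ⇒≤ _ _ (∀Sh² (λ x y → shD x y ≤ᵇ 2) tt x y)

kD≤1 : ∀ x y → kD x y ≤ 1
kD≤1 x y = ≤ᵇ⇒≤ _ _ (∀Z4² (λ x y → kD x y ≤ᵇ 1) tt x y)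

eqSh⇒≡ : ∀ x y → T (eqSh x y) → x ≡ y
eqSh⇒≡ (a , b) (c , d) t with a F.≟ c | b F.≟ d
... | yes refl | yes refl = refl

shD-zero : ∀ x y → shD x y ≡ 0 → x ≡ y
shD-zero x y e = eqSh⇒≡ x y (modus (∀Sh² (λ x y → implies (shD x y ≡ᵇ 0) (eqSh x y)) tt x y)
                                   (subst (λ z → T (z ≡ᵇ 0)) (sym e) tt))

kD-zero : ∀ x y → kD x y ≡ 0 → x ≡ y
kD-zero x y e with x F.≟ y
... | yes p = p

kD-≢ : ∀ x y → x ≢ y → kD x y ≡ 1
kD-≢ x y x≢y with x F.≟ y
... | yes p = contradiction p x≢y
... | no _ = refl

-- Distances in products

vD : (A → A → ℕ) → Vec A n → Vec A n → ℕ
vD d [] [] = 0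
vD d (x ∷ xs) (y ∷ ys) = d x y + vD d xs ys

module _ (d : A → A → ℕ) where

  vD-sym : (∀ x y → d x y ≡ d y x) → (xs ys : Vec A n) → vD d xs ys ≡ vD d ys xs
  vD-sym s [] [] = refl
  vD-sym s (x ∷ xs) (y ∷ ys) = cong₂ _+_ (s x y) (vD-sym s xs ys)

  vD-refl : (∀ x → d x x ≡ 0) → (xs : Vec A n) → vD d xs xs ≡ 0
  vD-refl s [] = refl
  vD-refl s (x ∷ xs) = cong₂ _+_ (s x) (vD-refl s xs)

  vD-zero : (∀ x y → d x y ≡ 0 → x ≡ y) → (xs ys : Vec A n) → vD d xs ys ≡ 0 → xs ≡ ys
  vD-zero s [] [] e = refl
  vD-zero s (x ∷ xs) (y ∷ ys) e =
    cong₂ _∷_ (s x y (m+n≡0⇒m≡0 _ e)) (vD-zero s xs ys (m+n≡0⇒n≡0 (d x y) e))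

  vD-≤ : ∀ w → (∀ x y → d x y ≤ w) → (xs ys : Vec A n) → vD d xs ys ≤ n * w
  vD-≤ w s [] [] = z≤n
  vD-≤ w s (x ∷ xs) (y ∷ ys) = +-mono-≤ (s x y) (vD-≤ w s xs ys)

+-interchange : ∀ a b c d → (a + b) + (c + d) ≡ (a + c) + (b + d)
+-interchange a b c d = begin
  (a + b) + (c + d) ≡⟨ +-assoc a b (c + d) ⟩
  a + (b + (c + d)) ≡⟨ cong (a +_) (trans (sym (+-assoc b c d)) (trans (cong (_+ d) (+-comm b c)) (+-assoc c b d))) ⟩
  a + (c + (b + d)) ≡⟨ +-assoc a c (b + d) ⟨
  (a + c) + (b + d) ∎
  where open ≡-Reasoning

vD-tri : (d : A → A → ℕ) → (∀ x y z → d x z ≤ d x y + d y z) →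
         (xs ys zs : Vec A n) → vD d xs zs ≤ vD d xs ys + vD d ys zs
vD-tri d s [] [] [] = z≤n
vD-tri d s (x ∷ xs) (y ∷ ys) (z ∷ zs) =
  ≤-trans (+-mono-≤ (s x y z) (vD-tri d s xs ys zs)) (≤-reflexive (+-interchange (d x y) (d y z) _ _))

δ : Vertex m n → Vertex m n → ℕ
δ (s , h) (s′ , h′) = vD shD s s′ + vD kD h h′

sum-zipWith : (d d′ : A → A → ℕ) → (∀ x y → d x y ≡ d′ x y) →
              (xs ys : Vec A n) → sum (toList (zipWith d xs ys)) ≡ vD d′ xs ys
sum-zipWith d d′ e [] [] = refl
sum-zipWith d d′ e (x ∷ xs) (y ∷ ys) = cong₂ _+_ (e x y) (sum-zipWith d d′ e xs ys)

dist≡δ : (x y : Vertex m n) → dist x y ≡ δ x y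
dist≡δ (s , h) (s′ , h′) = cong₂ _+_ (sum-zipWith dSh shD dSh≡shD s s′) (sum-zipWith dK kD dK≡kD h h′)

δ-sym : (x y : Vertex m n) → δ x y ≡ δ y x
δ-sym (s , h) (s′ , h′) = cong₂ _+_ (vD-sym shD shD-sym s s′) (vD-sym kD kD-sym h h′)

δ-refl : (x : Vertex m n) → δ x x ≡ 0
δ-refl (s , h) = cong₂ _+_ (vD-refl shD shD-refl s) (vD-refl kD kD-refl h)

δ-zero : (x y : Vertex m n) → δ x y ≡ 0 → x ≡ y
δ-zero (s , h) (s′ , h′) e =
  cong₂ _,_ (vD-zero shD shD-zero s s′ (m+n≡0⇒m≡0 _ e))
            (vD-zero kD kD-zero h h′ (m+n≡0⇒n≡0 (vD shD s s′) e))

δ-tri : (x y z : Vertex m n) → δ x z ≤ δ x y + δ y z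
δ-tri (s , h) (s′ , h′) (s″ , h″) =
  ≤-trans (+-mono-≤ (vD-tri shD shD-tri s s′ s″) (vD-tri kD kD-tri h h′ h″))
          (≤-reflexive (+-interchange (vD shD s s′) (vD shD s′ s″) _ _))

δ-≤ : (x y : Vertex m n) → δ x y ≤ 2 * m + n
δ-≤ {m} {n} (s , h) (s′ , h′) =
  +-mono-≤ (≤-trans (vD-≤ shD 2 shD≤2 s s′) (≤-reflexive (*-comm m 2)))
           (≤-trans (vD-≤ kD 1 kD≤1 h h′) (≤-reflexive (*-identityʳ n)))

-- Finite sums and duplicate-free lists

module Sum {c ℓ} (R : CommutativeSemiring c ℓ) where
  private module R = CommutativeSemiring R
  open R using (Carrier; _≈_; 0#; setoid)
    renaming (_+_ to _⊕_; _*_ to _⊗_; refl to ≈-refl; sym to ≈-sym; trans to ≈-trans)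

  -- Over any commutative semiring, because counting takes place in ℕ while the Gram sums of the
  -- Plotkin bound have negative terms and live in ℤ.
  ∑ : {A : Set} → List A → (A → Carrier) → Carrier
  ∑ [] f = 0#
  ∑ (x ∷ xs) f = f x ⊕ ∑ xs f

  ∑-cong : (xs : List A) {f g : A → Carrier} → (∀ x → f x ≈ g x) → ∑ xs f ≈ ∑ xs g
  ∑-cong [] e = ≈-refl
  ∑-cong (x ∷ xs) e = R.+-cong (e x) (∑-cong xs e)

  ∑-0 : (xs : List A) → ∑ xs (λ _ → 0#) ≈ 0#
  ∑-0 [] = ≈-refl
  ∑-0 (x ∷ xs) = ≈-trans (R.+-identityˡ _) (∑-0 xs)

  ∑-⊕ : (xs : List A) (f g : A → Carrier) → ∑ xs (λ x → f x ⊕ g x) ≈ ∑ xs f ⊕ ∑ xs g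
  ∑-⊕ [] f g = ≈-sym (R.+-identityˡ 0#)
  ∑-⊕ (x ∷ xs) f g = begin
    (f x ⊕ g x) ⊕ ∑ xs (λ x → f x ⊕ g x) ≈⟨ R.+-congˡ (∑-⊕ xs f g) ⟩
    (f x ⊕ g x) ⊕ (∑ xs f ⊕ ∑ xs g)     ≈⟨ R.+-assoc _ _ _ ⟩
    f x ⊕ (g x ⊕ (∑ xs f ⊕ ∑ xs g))     ≈⟨ R.+-congˡ (≈-trans (≈-sym (R.+-assoc _ _ _)) (≈-trans (R.+-cong (R.+-comm _ _) ≈-refl) (R.+-assoc _ _ _))) ⟩
    f x ⊕ (∑ xs f ⊕ (g x ⊕ ∑ xs g))     ≈⟨ R.+-assoc _ _ _ ⟨
    (f x ⊕ ∑ xs f) ⊕ (g x ⊕ ∑ xs g)     ∎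
    where open SetoidReasoning setoid

  ∑-⊗ˡ : (xs : List A) (a : Carrier) (f : A → Carrier) → ∑ xs (λ x → a ⊗ f x) ≈ a ⊗ ∑ xs f
  ∑-⊗ˡ [] a f = ≈-sym (R.zeroʳ a)
  ∑-⊗ˡ (x ∷ xs) a f = ≈-trans (R.+-congˡ (∑-⊗ˡ xs a f)) (≈-sym (R.distribˡ a _ _))

  ∑-⊗ʳ : (xs : List A) (a : Carrier) (f : A → Carrier) → ∑ xs (λ x → f x ⊗ a) ≈ ∑ xs f ⊗ a
  ∑-⊗ʳ xs a f = ≈-trans (∑-cong xs (λ x → R.*-comm (f x) a)) (≈-trans (∑-⊗ˡ xs a f) (R.*-comm a _))

  ∑-swap : (xs : List A) (ys : List B) (f : A → B → Carrier) →
           ∑ xs (λ x → ∑ ys (f x)) ≈ ∑ ys (λ y → ∑ xs (λ x → f x y))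
  ∑-swap [] ys f = ≈-sym (∑-0 ys)
  ∑-swap (x ∷ xs) ys f = ≈-trans (R.+-congˡ (∑-swap xs ys f)) (≈-sym (∑-⊕ ys (f x) _))

  ∑-product : (xs : List A) (ys : List B) (f : A → Carrier) (g : B → Carrier) →
              ∑ xs (λ x → ∑ ys (λ y → f x ⊗ g y)) ≈ ∑ xs f ⊗ ∑ ys g
  ∑-product xs ys f g = ≈-trans (∑-cong xs (λ x → ∑-⊗ˡ ys (f x) g)) (∑-⊗ʳ xs (∑ ys g) f)

  ∑-++ : (xs ys : List A) (f : A → Carrier) → ∑ (xs ++ ys) f ≈ ∑ xs f ⊕ ∑ ys f
  ∑-++ [] ys f = ≈-sym (R.+-identityˡ _)
  ∑-++ (x ∷ xs) ys f = ≈-trans (R.+-congˡ (∑-++ xs ys f)) (≈-sym (R.+-assoc _ _ _))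

  ∑-map : (g : A → B) (xs : List A) (f : B → Carrier) → ∑ (map g xs) f ≈ ∑ xs (f ∘ g)
  ∑-map g [] f = ≈-refl
  ∑-map g (x ∷ xs) f = R.+-congˡ (∑-map g xs f)

  ∑-concatMap : (h : A → List B) (xs : List A) (f : B → Carrier) → ∑ (concatMap h xs) f ≈ ∑ xs (λ x → ∑ (h x) f)
  ∑-concatMap h [] f = ≈-refl
  ∑-concatMap h (x ∷ xs) f = ≈-trans (∑-++ (h x) _ f) (R.+-congˡ (∑-concatMap h xs f))

open Sum +-*-commutativeSemiring

∑-mono : (xs : List A) {f g : A → ℕ} → (∀ {x} → x ∈ xs → f x ≤ g x) → ∑ xs f ≤ ∑ xs g
∑-mono [] le = z≤n
∑-mono (x ∷ xs) le = +-mono-≤ (le (here refl)) (∑-mono xs (le ∘ there))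

∑-const : (xs : List A) (a : ℕ) → ∑ xs (λ _ → a) ≡ length xs * a
∑-const [] a = refl
∑-const (x ∷ xs) a = cong (a +_) (∑-const xs a)

∑-1 : (xs : List A) → ∑ xs (λ _ → 1) ≡ length xs
∑-1 xs = trans (∑-const xs 1) (*-identityʳ _)

without : {x : A} {xs : List A} (ys : List A) {zs : List A} → All (x ≢_) xs → (∀ {y} → y ∈ xs → y ∈ ys ++ x ∷ zs) →
          ∀ {y} → y ∈ xs → y ∈ ys ++ zs
without ys x∉ s y∈ with ∈-++⁻ ys (s y∈)
... | inj₁ p = ∈-++⁺ˡ p
... | inj₂ (here refl) = contradiction refl (All.lookup x∉ y∈)
... | inj₂ (there p) = ∈-++⁺ʳ ys p

-- Each entry of `xs` is cut out of `ys` once it is matched; uniqueness of `xs` guarantees that the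
-- later entries are still found in what remains.
∑-⊆ : (f : A → ℕ) {xs ys : List A} → Unique xs → (∀ {x} → x ∈ xs → x ∈ ys) → ∑ xs f ≤ ∑ ys f
∑-⊆ f {[]} u s = z≤n
∑-⊆ f {x ∷ xs} (x∉ ∷ u) s with ∈-∃++ (s (here refl))
... | ys , zs , refl = ≤-trans (+-monoʳ-≤ (f x) (∑-⊆ f u (without ys x∉ (s ∘ there)))) (≤-reflexive (begin
    f x + ∑ (ys ++ zs) f      ≡⟨ cong (f x +_) (∑-++ ys zs f) ⟩
    f x + (∑ ys f + ∑ zs f)   ≡⟨ +-assoc (f x) _ _ ⟨
    (f x + ∑ ys f) + ∑ zs f   ≡⟨ cong (_+ ∑ zs f) (+-comm (f x) _) ⟩
    (∑ ys f + f x) + ∑ zs f   ≡⟨ +-assoc (∑ ys f) _ _ ⟩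
    ∑ ys f + ∑ (x ∷ zs) f     ≡⟨ ∑-++ ys (x ∷ zs) f ⟨
    ∑ (ys ++ x ∷ zs) f        ∎))
  where open ≡-Reasoning

unique-⊆-length : {xs ys : List A} → Unique xs → (∀ {x} → x ∈ xs → x ∈ ys) → length xs ≤ length ys
unique-⊆-length {xs = xs} {ys} u s = ≤-trans (≤-reflexive (sym (∑-1 xs))) (≤-trans (∑-⊆ (λ _ → 1) u s) (≤-reflexive (∑-1 ys)))

-- A missing `y` could be prepended to `xs`, giving a duplicate-free list inside `ys` that is longer
-- than `ys`.
unique-covers : {xs ys : List A} → DecidableEquality A → Unique xs → (∀ {x} → x ∈ xs → x ∈ ys) →
                length ys ≤ length xs → ∀ {y} → y ∈ ys → y ∈ xs
unique-covers {xs = xs} _≟_ u s l {y} y∈ys with any? (y ≟_) xs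
... | yes p = p
... | no y∉xs = contradiction (unique-⊆-length (¬Any⇒All¬ xs y∉xs ∷ u) λ { (here refl) → y∈ys ; (there p) → s p })
                              (<⇒≱ (s≤s l))

unique-map : {f : A → B} (xs : List A) → (∀ {x y} → x ∈ xs → y ∈ xs → f x ≡ f y → x ≡ y) →
             Unique xs → Unique (map f xs)
unique-map [] inj [] = []
unique-map {f = f} (x ∷ xs) inj (x∉xs ∷ u) =
  All.tabulate fresh ∷ unique-map xs (λ p q → inj (there p) (there q)) u
  where
  fresh : ∀ {y} → y ∈ map f xs → f x ≢ y
  fresh p e with ∈-map⁻ f p
  ... | z , z∈xs , refl = All.lookup x∉xs z∈xs (inj (here refl) (there z∈xs) e)

-- Separated codes and averaging

Sep : ℕ → Code m n → Set
Sep d C = ∀ {x y} → x ∈ C → y ∈ C → x ≢ y → d ≤ δ x y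

-- The size is only bounded from below because shortening by averaging yields a fibre of at least
-- the required size.
Packing : (m n d M : ℕ) → Set
Packing m n d M = Σ[ C ∈ Code m n ] (Unique C × Sep d C × M ≤ length C)

sep-injective : {C : Code m n} {x y : Vertex m n} {d : ℕ} → Sep d C → x ∈ C → y ∈ C → δ x y < d → x ≡ y
sep-injective {x = x} {y} s x∈ y∈ lt with x ≟V y
... | yes p = p
... | no p = contradiction (s x∈ y∈ p) (<⇒≱ lt)

sep-⊆ : ∀ {C C′ : Code m n} {d} → (∀ {x} → x ∈ C′ → x ∈ C) → Sep d C → Sep d C′
sep-⊆ i s x∈ y∈ = s (i x∈) (i y∈)

-- Covers shortening with `e = 0`, and puncturing and the restriction to a triangle with `e = 1`:
-- `g` loses at most `e` of a distance that exceeds `e`, so no two words collapse.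
contract : ∀ {m′ n′} (g : Vertex m n → Vertex m′ n′) (C : Code m n) (e d : ℕ) →
           (∀ {x y} → x ∈ C → y ∈ C → δ x y ≤ e + δ (g x) (g y)) →
           Unique C → Sep (e + suc d) C → Unique (map g C) × Sep (suc d) (map g C)
contract g C e d le u s = unique-map C inj u , sep
  where
  inj : ∀ {x y} → x ∈ C → y ∈ C → g x ≡ g y → x ≡ y
  inj {x} {y} x∈ y∈ eq = sep-injective s x∈ y∈
    (≤-<-trans (le x∈ y∈) (+-monoʳ-< e (subst (_< suc d) (sym (trans (cong (δ (g x)) (sym eq)) (δ-refl (g x)))) (s≤s z≤n))))
  sep : Sep (suc d) (map g C)
  sep p q ne with ∈-map⁻ g p | ∈-map⁻ g q
  ... | x , x∈ , refl | y , y∈ , refl = +-cancelˡ-≤ e _ _ (≤-trans (s x∈ y∈ λ { refl → ne refl }) (le x∈ y∈))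

bit : Bool → ℕ
bit b = if b then 1 else 0

∑-filter : (p : A → Bool) (xs : List A) → ∑ xs (bit ∘ p) ≡ length (filter (T? ∘ p) xs)
∑-filter p [] = refl
∑-filter p (x ∷ xs) with p x
... | true = cong suc (∑-filter p xs)
... | false = ∑-filter p xs

pigeonhole : (ks : List A) (f : A → ℕ) (a : ℕ) → length ks * a < ∑ ks f → ∃[ x ] (x ∈ ks × a < f x)
pigeonhole (x ∷ ks) f a lt with a <? f x
... | yes a<fx = x , here refl , a<fx
... | no a≮fx with pigeonhole ks f a (+-cancelˡ-< a _ _ (<-≤-trans lt (+-monoˡ-≤ _ (≮⇒≥ a≮fx))))
... | y , y∈ , a<fy = y , there y∈ , a<fy

-- Double counting of the pairs with `p a b`. For the values of a coordinate `t = 1`; for triangles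
-- `t = 3`.
fair-share : (ks : List A) (p : A → B → Bool) (t : ℕ) → (∀ b → t ≤ ∑ ks (λ a → bit (p a b))) →
             (C : List B) (M : ℕ) → length ks * M < length C * t →
             ∃[ a ] (M < length (filter (T? ∘ p a) C))
fair-share ks p t ht C M lt with pigeonhole ks (λ a → ∑ C (bit ∘ p a)) M (<-≤-trans lt (begin
    length C * t                          ≡⟨ ∑-const C t ⟨
    ∑ C (λ _ → t)                         ≤⟨ ∑-mono C (λ {b} _ → ht b) ⟩
    ∑ C (λ b → ∑ ks (λ a → bit (p a b)))  ≡⟨ ∑-swap C ks (λ b a → bit (p a b)) ⟩
    ∑ ks (λ a → ∑ C (bit ∘ p a))          ∎))
  where open ≤-Reasoning
... | a , _ , lt′ = a , subst (M <_) (∑-filter (p a) C) lt′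

-- Invariants of automorphisms

open MonoidSum +-0-commutativeMonoid using (sum-permute; sum-cong-≗) renaming (sum to sumF)

vD-sumF : (d : A → A → ℕ) (xs ys : Vec A n) → vD d xs ys ≡ sumF (λ i → d (lookup xs i) (lookup ys i))
vD-sumF d [] [] = refl
vD-sumF d (x ∷ xs) (y ∷ ys) = cong (d x y +_) (vD-sumF d xs ys)

vD-rearrange : (d : A → A → ℕ) (f : Fin n → A → A) (π : Permutation′ n) →
               (∀ i x y → d (f i x) (f i y) ≡ d x y) → (xs ys : Vec A n) →
               vD d (tabulate (λ i → f i (lookup xs (π ⟨$⟩ʳ i)))) (tabulate (λ i → f i (lookup ys (π ⟨$⟩ʳ i)))) ≡ vD d xs ys
vD-rearrange d f π inv xs ys = begin
  vD d (tabulate (g xs)) (tabulate (g ys))                                ≡⟨ vD-sumF d (tabulate (g xs)) (tabulate (g ys)) ⟩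
  sumF (λ i → d (lookup (tabulate (g xs)) i) (lookup (tabulate (g ys)) i)) ≡⟨ sum-cong-≗ (λ i → trans (cong₂ d (lookup∘tabulate (g xs) i) (lookup∘tabulate (g ys) i)) (inv i _ _)) ⟩
  sumF (λ i → d (lookup xs (π ⟨$⟩ʳ i)) (lookup ys (π ⟨$⟩ʳ i)))            ≡⟨ sum-permute (λ i → d (lookup xs i) (lookup ys i)) π ⟨
  sumF (λ i → d (lookup xs i) (lookup ys i))                              ≡⟨ vD-sumF d xs ys ⟨
  vD d xs ys ∎
  where
  open ≡-Reasoning
  g = λ zs i → f i (lookup zs (π ⟨$⟩ʳ i))

perm-injective : (p : Permutation′ n) {x y : Fin n} → p ⟨$⟩ʳ x ≡ p ⟨$⟩ʳ y → x ≡ y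
perm-injective p e = trans (sym (Perm.inverseˡ p)) (trans (cong (p ⟨$⟩ˡ_) e) (Perm.inverseˡ p))

kD-perm : (p : Permutation′ 4) (x y : Z4) → kD (p ⟨$⟩ʳ x) (p ⟨$⟩ʳ y) ≡ kD x y
kD-perm p x y with x F.≟ y
... | yes refl = kD-refl (p ⟨$⟩ʳ x)
... | no x≢y = kD-≢ _ _ (x≢y ∘ perm-injective p)

eqSh-refl : ∀ x → T (eqSh x x)
eqSh-refl = ∀Sh (λ x → eqSh x x) tt

aut-injective : (θ : ShAut) {x y : ShV} → ShAut.fun θ x ≡ ShAut.fun θ y → x ≡ y
aut-injective θ {x} {y} e = trans (sym (inv-fun x)) (trans (cong inv e) (inv-fun y))
  where open ShAut θ

T-ext : ∀ {a b} → (T a → T b) → (T b → T a) → a ≡ b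
T-ext {false} {false} f g = refl
T-ext {false} {true} f g = ⊥-elim (g tt)
T-ext {true} {false} f g = ⊥-elim (f tt)
T-ext {true} {true} f g = refl

-- Since the diameter is 2, the distance is a function of equality and adjacency, and automorphisms
-- preserve both.
shD-adj : ∀ x y → shD x y ≡ (if eqSh x y then 0 else if adjSh x y then 1 else 2)
shD-adj x y = ≡ᵇ⇒≡ _ _ (∀Sh² (λ x y → shD x y ≡ᵇ (if eqSh x y then 0 else if adjSh x y then 1 else 2)) tt x y)

shD-aut : (θ : ShAut) (x y : ShV) → shD (ShAut.fun θ x) (ShAut.fun θ y) ≡ shD x y
shD-aut θ x y = begin
  shD (fun x) (fun y)                                                     ≡⟨ shD-adj (fun x) (fun y) ⟩
  (if eqSh (fun x) (fun y) then 0 else if adjSh (fun x) (fun y) then 1 else 2) ≡⟨ cong₂ (λ a b → if a then 0 else if b then 1 else 2) eq (preserves x y) ⟩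
  (if eqSh x y then 0 else if adjSh x y then 1 else 2)                    ≡⟨ shD-adj x y ⟨
  shD x y ∎
  where
  open ≡-Reasoning
  open ShAut θ
  eq : eqSh (fun x) (fun y) ≡ eqSh x y
  eq = T-ext (λ t → subst (λ z → T (eqSh x z)) (aut-injective θ (eqSh⇒≡ _ _ t)) (eqSh-refl x))
             (λ t → subst (λ z → T (eqSh (fun x) (fun z))) (eqSh⇒≡ _ _ t) (eqSh-refl (fun x)))

-- The automorphism group is not transitive on pairs at distance 2: the two
-- common neighbours are non-adjacent exactly when the difference has order 2.

special : ShV → ShV → ℕ
special (a , b) (c , d) = table (a ⊖ c) (b ⊖ d)
  where
  table : Z4 → Z4 → ℕ
  table 0F 2F = 1
  table 2F 0F = 1
  table 2F 2F = 1
  table _ _ = 0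

adjacent : ShV → ShV → Bool
adjacent x y = shD x y ≡ᵇ 1

diamond : ShV → ShV → ShV → ShV → Bool
diamond x y z w = (adjacent z x ∧ adjacent z y) ∧ ((adjacent w x ∧ adjacent w y) ∧ adjacent z w)

rhombic : ShV → ShV → Bool
rhombic x y = any (λ z → any (diamond x y z) allSh) allSh

-- Expresses `special` through distances alone; its definition by group elements gives no hint that
-- automorphisms preserve it.
special-rhombic : ∀ x y → special x y ≡ (if shD x y ≡ᵇ 2 then (if rhombic x y then 0 else 1) else 0)
special-rhombic x y = ≡ᵇ⇒≡ _ _
  (∀Sh² (λ x y → special x y ≡ᵇ (if shD x y ≡ᵇ 2 then (if rhombic x y then 0 else 1) else 0)) tt x y)

any-allSh : (p : ShV → Bool) (z : ShV) → T (p z) → T (any p allSh)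
any-allSh p z t = any⁺ p (lose (∈-allSh z) t)

rhombic-image : (f : ShV → ShV) → (∀ x y → shD (f x) (f y) ≡ shD x y) → ∀ x y → T (rhombic x y) → T (rhombic (f x) (f y))
rhombic-image f iso x y t with any-T (λ z → any (diamond x y z) allSh) allSh t
... | z , _ , t′ with any-T (diamond x y z) allSh t′
... | w , _ , t″ = any-allSh (λ z → any (diamond (f x) (f y) z) allSh) (f z)
                     (any-allSh (diamond (f x) (f y) (f z)) (f w) (subst T (sym eq) t″))
  where
  adj : ∀ a b → adjacent (f a) (f b) ≡ adjacent a b
  adj a b = cong (_≡ᵇ 1) (iso a b)
  eq : diamond (f x) (f y) (f z) (f w) ≡ diamond x y z w
  eq = cong₂ _∧_ (cong₂ _∧_ (adj z x) (adj z y)) (cong₂ _∧_ (cong₂ _∧_ (adj w x) (adj w y)) (adj z w))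

special-aut : (θ : ShAut) (x y : ShV) → special (ShAut.fun θ x) (ShAut.fun θ y) ≡ special x y
special-aut θ x y = begin
  special (fun x) (fun y)                                             ≡⟨ special-rhombic (fun x) (fun y) ⟩
  (if shD (fun x) (fun y) ≡ᵇ 2 then (if rhombic (fun x) (fun y) then 0 else 1) else 0) ≡⟨ cong₂ (λ a b → if a ≡ᵇ 2 then (if b then 0 else 1) else 0) (shD-aut θ x y) eq ⟩
  (if shD x y ≡ᵇ 2 then (if rhombic x y then 0 else 1) else 0)        ≡⟨ special-rhombic x y ⟨
  special x y ∎
  where
  open ≡-Reasoning
  open ShAut θ
  iso⁻¹ : ∀ x y → shD (inv x) (inv y) ≡ shD x y
  iso⁻¹ x y = trans (sym (shD-aut θ _ _)) (cong₂ shD (fun-inv x) (fun-inv y))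
  eq : rhombic (fun x) (fun y) ≡ rhombic x y
  eq = T-ext (λ t → subst T (cong₂ rhombic (inv-fun x) (inv-fun y)) (rhombic-image inv iso⁻¹ (fun x) (fun y) t))
             (rhombic-image fun (shD-aut θ) x y)

-- Counts the Shrikhande coordinates in which the two words differ by an element of order 2.
-- Together with `δ` it is the only information about pairs that distinguishes classes here.
β : Vertex m n → Vertex m n → ℕ
β (s , _) (s′ , _) = vD special s s′

module _ (t : Transform m n) where
  open Transform t

  δ-apply : ∀ x y → δ (apply t x) (apply t y) ≡ δ x y
  δ-apply (s , h) (s′ , h′) = cong₂ _+_ (vD-rearrange shD (λ i → ShAut.fun (θ i)) π (λ i → shD-aut (θ i)) s s′)
                                        (vD-rearrange kD (λ j → σ j ⟨$⟩ʳ_) ρ (λ j → kD-perm (σ j)) h h′)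

  β-apply : ∀ x y → β (apply t x) (apply t y) ≡ β x y
  β-apply (s , h) (s′ , h′) = vD-rearrange special (λ i → ShAut.fun (θ i)) π (λ i → special-aut (θ i)) s s′

  apply-injective : ∀ {x y} → apply t x ≡ apply t y → x ≡ y
  apply-injective {x} {y} e = δ-zero x y (trans (sym (δ-apply x y)) (trans (cong (δ (apply t x)) (sym e)) (δ-refl (apply t x))))

-- Transforms and equivalence

autId : ShAut
autId = record { fun = id ; inv = id ; inv-fun = λ _ → refl ; fun-inv = λ _ → refl ; preserves = λ _ _ → refl }

_∘A_ : ShAut → ShAut → ShAut
f ∘A g = record
  { fun = A₁.fun ∘ A₂.fun
  ; inv = A₂.inv ∘ A₁.inv
  ; inv-fun = λ x → trans (cong A₂.inv (A₁.inv-fun _)) (A₂.inv-fun x)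
  ; fun-inv = λ x → trans (cong A₁.fun (A₂.fun-inv _)) (A₁.fun-inv x)
  ; preserves = λ x y → trans (A₁.preserves _ _) (A₂.preserves x y)
  }
  where
  module A₁ = ShAut f
  module A₂ = ShAut g

idT : Transform m n
idT = record { θ = λ _ → autId ; σ = λ _ → Perm.id ; π = Perm.id ; ρ = Perm.id }

apply-idT : (x : Vertex m n) → apply idT x ≡ x
apply-idT (s , h) = cong₂ _,_ (tabulate∘lookup s) (tabulate∘lookup h)

_⊙_ : Transform m n → Transform m n → Transform m n
t₂ ⊙ t₁ = record
  -- Coordinate `i` of the result is read from coordinate `T₂.π i` of the intermediate word, where
  -- `t₁` has already acted.
  { θ = λ i → T₂.θ i ∘A T₁.θ (T₂.π ⟨$⟩ʳ i)
  ; σ = λ j → T₁.σ (T₂.ρ ⟨$⟩ʳ j) ∘ₚ T₂.σ j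
  ; π = T₂.π ∘ₚ T₁.π
  ; ρ = T₂.ρ ∘ₚ T₁.ρ
  }
  where
  module T₁ = Transform t₁
  module T₂ = Transform t₂

apply-⊙ : (t₂ t₁ : Transform m n) (x : Vertex m n) → apply (t₂ ⊙ t₁) x ≡ apply t₂ (apply t₁ x)
apply-⊙ t₂ t₁ (s , h) = cong₂ _,_
  (tabulate-cong λ i → cong (ShAut.fun (T₂.θ i)) (sym (lookup∘tabulate _ (T₂.π ⟨$⟩ʳ i))))
  (tabulate-cong λ j → cong (T₂.σ j ⟨$⟩ʳ_) (sym (lookup∘tabulate _ (T₂.ρ ⟨$⟩ʳ j))))
  where
  module T₂ = Transform t₂

-- One-sided, so that it composes freely; for a duplicate-free source at least as large as the
-- target it upgrades to `Equivalent`.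
_⟶_ : Code m n → Code m n → Set
_⟶_ {m} {n} C C′ = Σ[ t ∈ Transform m n ] (∀ {x} → x ∈ C → apply t x ∈ C′)

⟶-trans : {C C′ C″ : Code m n} → C ⟶ C′ → C′ ⟶ C″ → C ⟶ C″
⟶-trans {C″ = C″} (t , f) (u , g) = u ⊙ t , λ {x} x∈ → subst (_∈ C″) (sym (apply-⊙ u t x)) (g (f x∈))

unique-image : (t : Transform m n) {C : Code m n} → Unique C → Unique (map (apply t) C)
unique-image t = UP.map⁺ (apply-injective t)

sep-image : (t : Transform m n) {C : Code m n} {d : ℕ} → Sep d C → Sep d (map (apply t) C)
sep-image t {d = d} s p q ne with ∈-map⁻ (apply t) p | ∈-map⁻ (apply t) q
... | x , x∈ , refl | y , y∈ , refl = subst (d ≤_) (sym (δ-apply t x y)) (s x∈ y∈ λ { refl → ne refl })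

⟶⇒Equivalent : {C R : Code m n} → Unique C → length R ≤ length C → C ⟶ R → Equivalent C R
⟶⇒Equivalent {C = C} {R} u l (t , f) = t , λ x → mk⇔ to from
  where
  from : ∀ {x} → x ∈ map (apply t) C → x ∈ R
  from p with ∈-map⁻ (apply t) p
  ... | y , y∈ , refl = f y∈
  to : ∀ {x} → x ∈ R → x ∈ map (apply t) C
  to = unique-covers _≟V_ (unique-image t u) from (≤-trans l (≤-reflexive (sym (length-map (apply t) C))))

liftK : Permutation′ 4 → Transform m n → Transform m (suc n)
liftK p t = record { θ = T₁.θ ; σ = σ′ ; π = T₁.π ; ρ = lift₀ T₁.ρ }
  where
  module T₁ = Transform t
  σ′ : Fin _ → Permutation′ 4
  σ′ zero = p
  σ′ (suc j) = T₁.σ j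

liftSh : ShAut → Transform m n → Transform (suc m) n
liftSh g t = record { θ = θ′ ; σ = T₁.σ ; π = lift₀ T₁.π ; ρ = T₁.ρ }
  where
  module T₁ = Transform t
  θ′ : Fin _ → ShAut
  θ′ zero = g
  θ′ (suc j) = T₁.θ j

consK : Z4 → Vertex m n → Vertex m (suc n)
consK a (s , h) = s , a ∷ h

consSh : ShV → Vertex m n → Vertex (suc m) n
consSh v (s , h) = v ∷ s , h

headK : Vertex m (suc n) → Z4
headK (_ , a ∷ _) = a

tailK : Vertex m (suc n) → Vertex m n
tailK (s , _ ∷ h) = s , h

headSh : Vertex (suc m) n → ShV
headSh (v ∷ _ , _) = v

tailSh : Vertex (suc m) n → Vertex m n
tailSh (_ ∷ s , h) = s , h

apply-liftK : (p : Permutation′ 4) (t : Transform m n) (a : Z4) (x : Vertex m n) →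
              apply (liftK p t) (consK a x) ≡ consK (p ⟨$⟩ʳ a) (apply t x)
apply-liftK p t a (s , h) = refl

δ-consK : (a b : Z4) (x y : Vertex m n) → δ (consK a x) (consK b y) ≡ kD a b + δ x y
δ-consK a b (s , h) (s′ , h′) = begin
  p + (q + r) ≡⟨ +-assoc p q r ⟨
  (p + q) + r ≡⟨ cong (_+ r) (+-comm p q) ⟩
  (q + p) + r ≡⟨ +-assoc q p r ⟩
  q + (p + r) ∎
  where
  open ≡-Reasoning
  p = vD shD s s′
  q = kD a b
  r = vD kD h h′

δ-consSh : (v w : ShV) (x y : Vertex m n) → δ (consSh v x) (consSh w y) ≡ shD v w + δ x y
δ-consSh v w (s , h) (s′ , h′) = +-assoc (shD v w) _ _

δ-splitK : (x y : Vertex m (suc n)) → δ x y ≡ kD (headK x) (headK y) + δ (tailK x) (tailK y)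
δ-splitK (s , a ∷ h) (s′ , b ∷ h′) = δ-consK a b (s , h) (s′ , h′)

δ-splitSh : (x y : Vertex (suc m) n) → δ x y ≡ shD (headSh x) (headSh y) + δ (tailSh x) (tailSh y)
δ-splitSh (v ∷ s , h) (w ∷ s′ , h′) = δ-consSh v w (s , h) (s′ , h′)

-- The invariant that tells classes apart.
profile : (ℕ → ℕ) → Code m n → ℕ
profile g C = ∑ C (λ x → ∑ C (λ y → g (β x y)))

profile-equivalent : (g : ℕ → ℕ) {C C′ : Code m n} → Unique C → Unique C′ → Equivalent C C′ → profile g C ≡ profile g C′
profile-equivalent g {C} {C′} u u′ (t , h) = begin
  ∑ C (λ x → ∑ C (λ y → g (β x y)))                                 ≡⟨ ∑-cong C (λ x → ∑-cong C (λ y → cong g (β-apply t x y))) ⟨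
  ∑ C (λ x → ∑ C (λ y → g (β (apply t x) (apply t y))))             ≡⟨ ∑-cong C (λ x → ∑-map (apply t) C (λ y → g (β (apply t x) y))) ⟨
  ∑ C (λ x → ∑ D (λ y → g (β (apply t x) y)))                       ≡⟨ ∑-map (apply t) C (λ x → ∑ D (λ y → g (β x y))) ⟨
  ∑ D (λ x → ∑ D (λ y → g (β x y)))                                 ≡⟨ ∑-≈ (λ x → ∑ D (λ y → g (β x y))) ⟩
  ∑ C′ (λ x → ∑ D (λ y → g (β x y)))                                ≡⟨ ∑-cong C′ (λ x → ∑-≈ (λ y → g (β x y))) ⟩
  ∑ C′ (λ x → ∑ C′ (λ y → g (β x y)))                               ∎
  where
  open ≡-Reasoning
  D = map (apply t) C
  ∑-≈ : (f : Vertex _ _ → ℕ) → ∑ D f ≡ ∑ C′ f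
  ∑-≈ f = ≤-antisym (∑-⊆ f (unique-image t u) (Equivalence.from (h _))) (∑-⊆ f u′ (Equivalence.to (h _)))

-- Vertex lists and exhaustive search

words : List A → (n : ℕ) → List (Vec A n)
words xs zero = [] ∷ []
words xs (suc n) = concatMap (λ x → map (x ∷_) (words xs n)) xs

∈-words : (xs : List A) → (∀ x → x ∈ xs) → (v : Vec A n) → v ∈ words xs n
∈-words xs c [] = here refl
∈-words xs c (x ∷ v) = ∈-concat⁺′ (∈-map⁺ (x ∷_) (∈-words xs c v)) (∈-map⁺ _ (c x))

vertices : (m n : ℕ) → List (Vertex m n)
vertices m n = cartesianProduct (words allSh m) (words (allFin 4) n)

∈-vertices : (x : Vertex m n) → x ∈ vertices m n
∈-vertices (s , h) = ∈-cartesianProduct⁺ (∈-words allSh ∈-allSh s) (∈-words (allFin 4) ∈-allFin h)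

_∈ᵇ_ : Vertex m n → Code m n → Bool
x ∈ᵇ C = any (λ y → δ x y ≡ᵇ 0) C

∈ᵇ⇒∈ : (x : Vertex m n) (C : Code m n) → T (x ∈ᵇ C) → x ∈ C
∈ᵇ⇒∈ x C t with any-T (λ y → δ x y ≡ᵇ 0) C t
... | y , y∈ , e = subst (_∈ C) (sym (δ-zero x y (≡ᵇ⇒≡ _ _ e))) y∈

∈⇒∈ᵇ : {x : Vertex m n} {C : Code m n} → x ∈ C → T (x ∈ᵇ C)
∈⇒∈ᵇ {x = x} x∈ = any⁺ (λ y → δ x y ≡ᵇ 0) (lose x∈ (≡⇒≡ᵇ (δ x x) 0 (δ-refl x)))

separated : ℕ → Code m n → Bool
separated d [] = true
separated d (x ∷ C) = all (λ y → d ≤ᵇ δ x y) C ∧ separated d C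

separated⇒sep : (d : ℕ) (C : Code m n) → T (separated (suc d) C) → Unique C × Sep (suc d) C
separated⇒sep d [] t = [] , λ ()
separated⇒sep {m} {n} d (x ∷ C) t with Equivalence.to T-∧ t
... | t₁ , t₂ with separated⇒sep d C t₂
... | u , s = All.tabulate fresh ∷ u , sep
  where
  far : ∀ {y} → y ∈ C → suc d ≤ δ x y
  far y∈ = ≤ᵇ⇒≤ _ _ (all-T (λ y → suc d ≤ᵇ δ x y) C t₁ y∈)
  fresh : ∀ {y} → y ∈ C → x ≢ y
  fresh y∈ refl = contradiction (far y∈) (<⇒≱ (subst (_< suc d) (sym (δ-refl x)) (s≤s z≤n)))
  sep : Sep (suc d) (x ∷ C)
  sep (here refl) (here refl) ne = contradiction refl ne
  sep (here refl) (there q) ne = far q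
  sep {y} (there p) (here refl) ne = subst (suc d ≤_) (δ-sym x y) (far p)
  sep (there p) (there q) ne = s p q ne

-- Distance 0 passes: the word of a code found in a row may already have been chosen, and
-- completeness must keep that branch.
compatible : ℕ → Vertex m n → Vertex m n → Bool
compatible d x y = ok (δ x y)
  where
  ok : ℕ → Bool
  ok zero = true
  ok t = d ≤ᵇ t

compatible-intro : ∀ {d} (x y : Vertex m n) → (x ≢ y → d ≤ δ x y) → T (compatible d x y)
compatible-intro x y far with x ≟V y
... | yes refl rewrite δ-refl x = tt
... | no x≢y with δ x y | far x≢y
...   | zero | _ = tt
...   | suc t | d≤ = ≤⇒≤ᵇ d≤

backtrack : ℕ → List (Code m n) → Code m n → List (Code m n)
backtrack d [] acc = acc ∷ []
backtrack d (row ∷ rows) acc = concatMap (λ w → if all (compatible d w) acc then backtrack d rows (w ∷ acc) else []) row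

Meets : Code m n → Code m n → Set
Meets C row = ∃[ w ] (w ∈ row × w ∈ C)

-- The branch that picks a word of `C` in every row survives all tests, because words of `C` are
-- pairwise compatible.
backtrack-complete : ∀ {d} {C : Code m n} → Sep d C → (rows : List (Code m n)) → (∀ {row} → row ∈ rows → Meets C row) →
                 (acc : Code m n) → (∀ {x} → x ∈ acc → x ∈ C) →
                 ∃[ sol ] (sol ∈ backtrack d rows acc × (∀ {x} → x ∈ sol → x ∈ C))
backtrack-complete s [] meets acc acc⊆ = acc , here refl , acc⊆
backtrack-complete {d = d} {C} s (row ∷ rows) meets acc acc⊆ with meets (here refl)
... | w , w∈row , w∈C with backtrack-complete s rows (meets ∘ there) (w ∷ acc) (λ { (here refl) → w∈C ; (there p) → acc⊆ p })
... | sol , sol∈ , sol⊆ = sol , ∈-concat⁺′ (subst (λ b → sol ∈ (if b then backtrack d rows (w ∷ acc) else [])) (sym fits) sol∈)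
                                          (∈-map⁺ _ w∈row) , sol⊆
  where
  fits : all (compatible d w) acc ≡ true
  fits = Equivalence.to T-≡ (all⁻ (compatible d w) (All.tabulate λ {x} x∈ → compatible-intro w x (s w∈C (acc⊆ x∈))))

carries : Transform m n → Code m n → Code m n → Bool
carries t R C = all (λ w → apply t w ∈ᵇ R) C

module _ {I : Set} (code : I → Code m n) (transform : I → Transform m n) (targets : List I) where

  hits : Code m n → I → Bool
  hits sol i = carries (transform i) (code i) sol

  covered : ℕ → ℕ → Code m n → Bool
  covered d M sol = (separated d sol ∧ (M ≤ᵇ length sol)) ∧ any (hits sol) targets

  -- A solution contained in `C` with `M` different words is all of `C`, so the transform checked on
  -- the solution carries `C`.
  backtrack⇒⟶ : ∀ {d M} {C : Code m n} → Sep (suc d) C → length C ≤ M →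
            (rows : List (Code m n)) → (∀ {row} → row ∈ rows → Meets C row) →
            (acc : Code m n) → (∀ {x} → x ∈ acc → x ∈ C) →
            T (all (covered (suc d) M) (backtrack (suc d) rows acc)) → ∃[ i ] (C ⟶ code i)
  backtrack⇒⟶ {d} {M} {C} s l rows meets acc acc⊆ t with backtrack-complete s rows meets acc acc⊆
  ... | sol , sol∈ , sol⊆ with Equivalence.to T-∧ (all-T (covered (suc d) M) (backtrack (suc d) rows acc) t sol∈)
  ... | t₁ , t₂ with Equivalence.to (T-∧ {separated (suc d) sol}) t₁ | any-T (hits sol) targets t₂
  ... | t₃ , t₄ | i , _ , t₅ = i , transform i , λ {x} x∈ →
    ∈ᵇ⇒∈ _ (code i) (all-T (λ w → apply (transform i) w ∈ᵇ code i) sol t₅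
      (unique-covers _≟V_ (proj₁ (separated⇒sep d sol t₃)) sol⊆ (≤-trans l (≤ᵇ⇒≤ M (length sol) t₄)) x∈))

-- Automorphisms of the Shrikhande graph and permutations of colours

adjSh≡ : ∀ x y → adjSh x y ≡ adjacent x y
adjSh≡ x y = T-ext (modus (∀Sh² (λ x y → implies (adjSh x y) (adjacent x y)) tt x y))
                   (modus (∀Sh² (λ x y → implies (adjacent x y) (adjSh x y)) tt x y))

mkAut : (f g : ShV → ShV) → (∀ x → T (eqSh (g (f x)) x)) → (∀ x → T (eqSh (f (g x)) x)) →
        (∀ x y → T (shD (f x) (f y) ≡ᵇ shD x y)) → ShAut
mkAut f g gf fg iso = record
  { fun = f ; inv = g ; inv-fun = λ x → eqSh⇒≡ _ _ (gf x) ; fun-inv = λ x → eqSh⇒≡ _ _ (fg x)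
  ; preserves = λ x y → trans (adjSh≡ (f x) (f y)) (trans (cong (_≡ᵇ 1) (≡ᵇ⇒≡ (shD (f x) (f y)) (shD x y) (iso x y))) (sym (adjSh≡ x y))) }

minus plus : ShV → ShV → ShV
minus (c , d) (a , b) = a ⊖ c , b ⊖ d
plus (c , d) (a , b) = a ⊖ (0F ⊖ c) , b ⊖ (0F ⊖ d)

-- The shift by the negative of `v`: it carries `v` to the origin.
translation : ShV → ShAut
translation v = mkAut (minus v) (plus v)
  (∀Sh² (λ v x → eqSh (plus v (minus v x)) x) tt v)
  (∀Sh² (λ v x → eqSh (minus v (plus v x)) x) tt v)
  (∀Sh³ (λ v x y → shD (minus v x) (minus v y) ≡ᵇ shD x y) tt v)

-- The rotation runs through the connection set in the cyclic order 01, 11, 10, 03, 33, 30. With the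
-- reflection it generates the dihedral group of order 12 that fixes the origin.
rotation reflection : ShAut
rotation = mkAut f g (∀Sh (λ x → eqSh (g (f x)) x) tt) (∀Sh (λ x → eqSh (f (g x)) x) tt)
                 (∀Sh² (λ x y → shD (f x) (f y) ≡ᵇ shD x y) tt)
  where
  f g : ShV → ShV
  f (a , b) = b , b ⊖ a
  g (a , b) = a ⊖ b , a
reflection = mkAut f f (∀Sh (λ x → eqSh (f (f x)) x) tt) (∀Sh (λ x → eqSh (f (f x)) x) tt)
                   (∀Sh² (λ x y → shD (f x) (f y) ≡ᵇ shD x y) tt)
  where
  f : ShV → ShV
  f (a , b) = b , a

rotations : ℕ → ShAut
rotations zero = autId
rotations (suc i) = rotation ∘A rotations i

stabilizer : List ShAut
stabilizer = map rotations (upTo 6) ++ map (λ i → rotations i ∘A reflection) (upTo 6)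

eqZ4⇒≡ : ∀ {x y : Z4} → T (eqZ4 x y) → x ≡ y
eqZ4⇒≡ {x} {y} t with x F.≟ y
... | yes e = e

_&_ : ∀ {a b} → T a → T b → T (a ∧ b)
_&_ {true} _ y = y

swaps : Z4 → Z4 → Z4 → Permutation′ 4
swaps a b c = p₂ ∘ₚ Perm.transpose (p₂ ⟨$⟩ʳ c) 2F
  where
  p₁ = Perm.transpose a 0F
  p₂ = p₁ ∘ₚ Perm.transpose (p₁ ⟨$⟩ʳ b) 1F

swaps-spec : ∀ a b c → a ≢ b → a ≢ c → b ≢ c →
             swaps a b c ⟨$⟩ʳ a ≡ 0F × swaps a b c ⟨$⟩ʳ b ≡ 1F × swaps a b c ⟨$⟩ʳ c ≡ 2F
swaps-spec a b c a≢b a≢c b≢c =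
  eqZ4⇒≡ (proj₁ bits) , eqZ4⇒≡ (proj₁ (Equivalence.to (T-∧ {eqZ4 (p ⟨$⟩ʳ b) 1F}) (proj₂ bits)))
                      , eqZ4⇒≡ (proj₂ (Equivalence.to (T-∧ {eqZ4 (p ⟨$⟩ʳ b) 1F}) (proj₂ bits)))
  where
  p = swaps a b c
  sorted : Z4 → Z4 → Z4 → Bool
  sorted a b c = eqZ4 (q ⟨$⟩ʳ a) 0F ∧ (eqZ4 (q ⟨$⟩ʳ b) 1F ∧ eqZ4 (q ⟨$⟩ʳ c) 2F)
    where q = swaps a b c
  distinct : Z4 → Z4 → Z4 → Bool
  distinct a b c = (adjK a b ∧ adjK a c) ∧ adjK b c
  adjK-≢ : ∀ {x y} → x ≢ y → T (adjK x y)
  adjK-≢ {x} {y} ne with x F.≟ y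
  ... | yes e = ne e
  ... | no _ = tt
  check : ∀ a b c → T (implies (distinct a b c) (sorted a b c))
  check a = ∀Z4² (λ b c → implies (distinct a b c) (sorted a b c))
              (∀Z4 (λ a → all (λ b → all (λ c → implies (distinct a b c) (sorted a b c)) (allFin 4)) (allFin 4)) tt a)
  bits = Equivalence.to (T-∧ {eqZ4 (p ⟨$⟩ʳ a) 0F})
    (modus (check a b c) (Equivalence.from T-∧ (Equivalence.from T-∧ (adjK-≢ a≢b , adjK-≢ a≢c) , adjK-≢ b≢c)))

abstract
  ordering : ∀ {a b c} → a ≢ b → a ≢ c → b ≢ c →
             Σ[ p ∈ Permutation′ 4 ] (p ⟨$⟩ʳ a ≡ 0F × p ⟨$⟩ʳ b ≡ 1F × p ⟨$⟩ʳ c ≡ 2F)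
  ordering {a} {b} {c} a≢b a≢c b≢c = swaps a b c , swaps-spec a b c a≢b a≢c b≢c

fourth : ∀ (d : Z4) → d ≢ 0F → d ≢ 1F → d ≢ 2F → d ≡ 3F
fourth 0F p _ _ = contradiction refl p
fourth 1F _ p _ = contradiction refl p
fourth 2F _ _ p = contradiction refl p
fourth 3F _ _ _ = refl

-- Codes as graphs of functions

key-total : (ks : List B) → DecidableEquality B → (g : A → B) (C : List A) → Unique C →
            (∀ {x y} → x ∈ C → y ∈ C → g x ≡ g y → x ≡ y) → (∀ {x} → x ∈ C → g x ∈ ks) → length ks ≤ length C →
            ∀ {b} → b ∈ ks → ∃[ x ] (x ∈ C × g x ≡ b)
key-total ks _≟_ g C u inj g∈ l b∈ with ∈-map⁻ g (unique-covers _≟_ (unique-map C inj u) sub (≤-trans l (≤-reflexive (sym (length-map g C)))) b∈)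
  where
  sub : ∀ {y} → y ∈ map g C → y ∈ ks
  sub p with ∈-map⁻ g p
  ... | x , x∈ , refl = g∈ x∈
... | x , x∈ , refl = x , x∈ , refl

Full : ℕ → ℕ → Code m n → Set
Full d M C = Unique C × Sep d C × length C ≡ M

full-image : ∀ {d M} {C : Code m n} (t : Transform m n) → Full d M C → Full d M (map (apply t) C)
full-image {d = d} {C = C} t (u , s , l) = unique-image t u , sep-image t {d = d} s , trans (length-map (apply t) C) l

⟶-image : {C : Code m n} (t : Transform m n) → C ⟶ map (apply t) C
⟶-image t = t , ∈-map⁺ (apply t)

onto : ∀ {d M} {C R : Code m n} (t : Transform m n) → Full d M C → length R ≤ M → (∀ {x} → x ∈ C → apply t x ∈ R) →
       ∀ {y} → y ∈ R → ∃[ x ] (x ∈ C × y ≡ apply t x)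
onto {C = C} t (u , s , l) r f y∈ = ∈-map⁻ (apply t)
  (unique-covers _≟V_ (unique-image t u) into (≤-trans r (≤-reflexive (sym (trans (length-map (apply t) C) l)))) y∈)
  where
  into : ∀ {y} → y ∈ map (apply t) C → y ∈ _
  into p with ∈-map⁻ (apply t) p
  ... | x , x∈ , refl = f x∈

-- Words with equal first coordinate differ only in the rest, whose diameter `2 * m + n` is below
-- `d`.
head-injective : ∀ {d} {C : Code (suc m) n} → Sep d C → 2 * m + n < d →
                 ∀ {x y} → x ∈ C → y ∈ C → headSh x ≡ headSh y → x ≡ y
head-injective s lt {x} {y} x∈ y∈ e = sep-injective s x∈ y∈ (≤-<-trans (≤-reflexive δ-tails) (≤-<-trans (δ-≤ (tailSh x) (tailSh y)) lt))
  where
  δ-tails : δ x y ≡ δ (tailSh x) (tailSh y)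
  δ-tails = trans (δ-splitSh x y) (cong (_+ δ (tailSh x) (tailSh y)) (trans (cong (shD (headSh x)) (sym e)) (shD-refl (headSh x))))

systematic : ∀ {d M} {C : Code (suc m) n} → Full d M C → 2 * m + n < d → 16 ≤ M → ∀ v → ∃[ x ] (x ∈ C × headSh x ≡ v)
systematic (u , s , refl) lt l v =
  key-total allSh _≟S_ headSh _ u (head-injective s lt) (λ {x} _ → ∈-allSh (headSh x)) l (∈-allSh v)

column : ShV → Code (suc m) n
column {m} {n} v = map (consSh v) (vertices m n)

meets-columns : ∀ {C : Code (suc m) n} → (∀ v → ∃[ x ] (x ∈ C × headSh x ≡ v)) →
                (vs : List ShV) → ∀ {row} → row ∈ map column vs → Meets C row
meets-columns sys vs p with ∈-map⁻ column p
... | v , _ , refl with sys v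
... | x@(_ ∷ _ , _) , x∈ , refl = x , ∈-map⁺ (consSh v) (∈-vertices (tailSh x)) , x∈

-- Appending a coordinate.  The words of the base are to receive the first
-- coordinate as a colour, words at distance < d receiving different colours;
-- q₀, …, q₃ are pairwise that close and F is known to be coloured like q₀.

record Base (m n : ℕ) : Set where
  constructor base
  field
    q₀ q₁ q₂ q₃ : Vertex m n
    F G : Code m n

  code : Code m n
  code = (q₀ ∷ q₁ ∷ q₂ ∷ q₃ ∷ F) ++ G

  start : Code m (suc n)
  start = consK 0F q₀ ∷ consK 1F q₁ ∷ consK 2F q₂ ∷ consK 3F q₃ ∷ map (consK 0F) F

  palette : Vertex m n → Code m (suc n)
  palette u = map (λ c → consK c u) (allFin 4)

  rows : List (Code m (suc n))
  rows = map palette G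

  clique : ℕ → Bool
  clique d = ((close q₀ q₁ ∧ close q₀ q₂) ∧ close q₀ q₃) ∧ ((close q₁ q₂ ∧ close q₁ q₃) ∧ close q₂ q₃)
    where
    close : Vertex m n → Vertex m n → Bool
    close x y = (1 ≤ᵇ δ x y) ∧ (suc (δ x y) ≤ᵇ d)

headOr : A → List A → A
headOr a [] = a
headOr a (x ∷ _) = x

-- The representative is read off the first solution of the search. The default `[]` for an empty
-- search gives a code that is too short and would fail the later size checks.
extend : ℕ → Base m n → Base m (suc n)
extend d b = base (consK 0F q₀) (consK 1F q₁) (consK 2F q₂) (consK 3F q₃) []
                  -- The search prepends its choices to `start`, so the coloured words of `G` form
                  -- the initial segment, in reverse order.
                  (map (consK 0F) F ++ L.reverse (L.take (length G) (headOr [] (backtrack d rows start))))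
  where open Base b

-- Codes in D(2,0) with 16 words and distance 3

pairT : ShAut → ShAut → Transform 2 0
pairT g h = record { θ = lookup (g ∷ h ∷ []) ; σ = λ _ → Perm.id ; π = Perm.id ; ρ = Perm.id }

pairs : List ShV → List ShV → Code 2 0
pairs = L.zipWith (λ s t → s ∷ t ∷ [] , [])

-- The twelve vertices other than 00, 01, 10, 11, over which the words `q₀`, ..., `q₃` of `baseA`
-- lie.
coset : List ShV
coset = L.drop 2 (L.take 4 allSh) ++ L.drop 6 allSh

baseA : Fin 2 → Base 2 0
baseA 0F = base ((0F , 0F) ∷ (0F , 0F) ∷ [] , []) ((0F , 1F) ∷ (0F , 2F) ∷ [] , [])
                ((1F , 0F) ∷ (1F , 3F) ∷ [] , []) ((1F , 1F) ∷ (2F , 1F) ∷ [] , []) [] (pairs coset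
  ((2F , 0F) ∷ (2F , 2F) ∷ (3F , 3F) ∷ (0F , 1F) ∷ (3F , 2F) ∷ (3F , 0F) ∷ (1F , 2F) ∷ (1F , 0F)
  ∷ (2F , 3F) ∷ (1F , 1F) ∷ (0F , 3F) ∷ (3F , 1F) ∷ []))
baseA 1F = base ((0F , 0F) ∷ (0F , 0F) ∷ [] , []) ((0F , 1F) ∷ (1F , 2F) ∷ [] , [])
                ((1F , 0F) ∷ (1F , 3F) ∷ [] , []) ((1F , 1F) ∷ (2F , 1F) ∷ [] , []) [] (pairs coset
  ((2F , 0F) ∷ (3F , 2F) ∷ (3F , 3F) ∷ (0F , 1F) ∷ (2F , 2F) ∷ (3F , 0F) ∷ (0F , 2F) ∷ (1F , 0F)
  ∷ (3F , 1F) ∷ (0F , 3F) ∷ (1F , 1F) ∷ (2F , 3F) ∷ []))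

codeA : Fin 2 → Code 2 0
codeA r = Base.code (baseA r)

aut : ℕ → ℕ → ShV → ShAut
aut i j v = rotations i ∘A ((if j ≡ᵇ 0 then autId else reflection) ∘A translation v)

-- Witnesses found by computer: they carry the solutions of the search to the representatives.
targetsA : List (Fin 2 × ShAut × ShAut)
targetsA =
    (0F , aut 3 0 (2F , 2F) , aut 2 1 (1F , 2F))
  ∷ (0F , aut 4 1 (2F , 0F) , aut 3 0 (1F , 2F))
  ∷ (0F , aut 0 0 (0F , 0F) , aut 1 1 (0F , 0F))
  ∷ (0F , aut 4 1 (0F , 2F) , aut 1 1 (2F , 2F))
  ∷ (0F , aut 5 0 (2F , 1F) , aut 2 0 (3F , 3F))
  ∷ (0F , aut 3 1 (0F , 1F) , aut 5 0 (1F , 2F))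
  ∷ (1F , aut 4 1 (0F , 2F) , aut 5 1 (2F , 0F))
  ∷ (0F , aut 4 1 (3F , 2F) , aut 2 1 (0F , 1F))
  ∷ (0F , aut 1 1 (1F , 0F) , aut 5 1 (2F , 3F))
  ∷ (1F , aut 5 0 (0F , 2F) , aut 4 1 (2F , 0F))
  ∷ (0F , aut 3 1 (0F , 2F) , aut 0 1 (2F , 1F))
  ∷ (0F , aut 5 1 (2F , 2F) , aut 0 1 (0F , 2F))
  ∷ (0F , aut 4 0 (2F , 0F) , aut 4 1 (2F , 2F))
  ∷ (0F , aut 2 1 (3F , 3F) , aut 1 0 (0F , 2F))
  ∷ (0F , aut 3 1 (2F , 1F) , aut 4 1 (3F , 0F))
  ∷ (0F , aut 5 1 (0F , 3F) , aut 4 1 (2F , 1F))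
  ∷ []

codeOf : Fin 2 × ShAut × ShAut → Code 2 0
codeOf (r , _) = codeA r

transformOf : Fin 2 × ShAut × ShAut → Transform 2 0
transformOf (_ , g , h) = pairT g h

startA : ShV → Code 2 0
startA y = ((0F , 1F) ∷ y ∷ [] , []) ∷ ((0F , 0F) ∷ (0F , 0F) ∷ [] , []) ∷ []

-- The vertices at distance 2 from 00 form two orbits under `stabilizer`, one of size 3 containing
-- 02 and one of size 6 containing 12.
normalises : ShV → ShV → ShAut → Bool
normalises t₀ t₁ g = eqSh (f t₀) (0F , 0F) ∧ (eqSh (f t₁) (0F , 2F) ∨ eqSh (f t₁) (1F , 2F))
  where f = ShAut.fun (g ∘A translation t₀)

-- Abstract, so that the result of the search is never unfolded again.
abstract
  normalise : ∀ t₀ t₁ → 2 ≤ shD t₀ t₁ →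
              ∃[ g ] (ShAut.fun g t₀ ≡ (0F , 0F) × (ShAut.fun g t₁ ≡ (0F , 2F) ⊎ ShAut.fun g t₁ ≡ (1F , 2F)))
  normalise t₀ t₁ far = g , eqSh⇒≡ _ _ (proj₁ both) , split (Equivalence.to T-∨ (proj₂ both))
    where
    found : ∃[ g ] (g ∈ stabilizer × T (normalises t₀ t₁ g))
    found = any-T (normalises t₀ t₁) stabilizer
              (modus (∀Sh² (λ t₀ t₁ → implies (2 ≤ᵇ shD t₀ t₁) (any (normalises t₀ t₁) stabilizer)) tt t₀ t₁) (≤⇒≤ᵇ far))
    g : ShAut
    g = proj₁ found ∘A translation t₀
    both : T (eqSh (ShAut.fun g t₀) (0F , 0F)) × T (eqSh (ShAut.fun g t₁) (0F , 2F) ∨ eqSh (ShAut.fun g t₁) (1F , 2F))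
    both = Equivalence.to (T-∧ {eqSh (ShAut.fun g t₀) (0F , 0F)}) (proj₂ (proj₂ found))
    split : T (eqSh (ShAut.fun g t₁) (0F , 2F)) ⊎ T (eqSh (ShAut.fun g t₁) (1F , 2F)) →
            ShAut.fun g t₁ ≡ (0F , 2F) ⊎ ShAut.fun g t₁ ≡ (1F , 2F)
    split (inj₁ e) = inj₁ (eqSh⇒≡ _ _ e)
    split (inj₂ e) = inj₂ (eqSh⇒≡ _ _ e)

  finishA : ∀ {y} → y ≡ (0F , 2F) ⊎ y ≡ (1F , 2F) → {C : Code 2 0} → Full 3 16 C →
            (∀ {x} → x ∈ startA y → x ∈ C) → ∃[ i ] (C ⟶ codeOf i)
  finishA (inj₁ refl) full@(u , s , l) start =
    backtrack⇒⟶ codeOf transformOf targetsA {M = 16} s (≤-reflexive l) (map column (L.drop 2 allSh))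
      (meets-columns (systematic full ≤-refl ≤-refl) (L.drop 2 allSh)) (startA (0F , 2F)) start tt
  finishA (inj₂ refl) full@(u , s , l) start =
    backtrack⇒⟶ codeOf transformOf targetsA {M = 16} s (≤-reflexive l) (map column (L.drop 2 allSh))
      (meets-columns (systematic full ≤-refl ≤-refl) (L.drop 2 allSh)) (startA (1F , 2F)) start tt

classifyA : {C : Code 2 0} → Full 3 16 C → ∃[ r ] (C ⟶ codeA r)
classifyA {C} full@(u , s , l) with systematic full ≤-refl ≤-refl (0F , 0F) | systematic full ≤-refl ≤-refl (0F , 1F)
... | (_ ∷ t₀ ∷ [] , []) , w₀∈ , refl | (_ ∷ t₁ ∷ [] , []) , w₁∈ , refl with normalise t₀ t₁ far
  where
  -- The first coordinates 00 and 01 are adjacent, so the second ones must supply 2 of the distance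
  -- 3.
  far : 2 ≤ shD t₀ t₁
  far = +-cancelˡ-≤ 1 2 _ (≤-trans (s w₀∈ w₁∈ (λ ())) (≤-reflexive (cong suc (trans (+-identityʳ _) (+-identityʳ _)))))
... | g , e₀ , e₁ = proj₁ (proj₁ found) , ⟶-trans (⟶-image t) (proj₂ found)
  where
  t = pairT autId g
  start : ∀ {x} → x ∈ startA (ShAut.fun g t₁) → x ∈ map (apply t) C
  start (here refl) = ∈-map⁺ (apply t) w₁∈
  start (there (here refl)) = subst (λ z → ((0F , 0F) ∷ z ∷ [] , []) ∈ map (apply t) C) e₀ (∈-map⁺ (apply t) w₀∈)
  found = finishA e₁ (full-image t full) start

-- Codes in D(1,2) with 16 words and distance 3

quads : List ShV → List (Z4 × Z4) → Code 1 2
quads = L.zipWith (λ s (a , b) → s ∷ [] , a ∷ b ∷ [])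

baseB : Base 1 2
baseB = base ((0F , 0F) ∷ [] , 0F ∷ 0F ∷ []) ((0F , 1F) ∷ [] , 1F ∷ 1F ∷ [])
             ((0F , 2F) ∷ [] , 0F ∷ 2F ∷ []) ((0F , 3F) ∷ [] , 1F ∷ 3F ∷ []) [] (quads (L.drop 4 allSh)
  ((3F , 1F) ∷ (2F , 2F) ∷ (3F , 3F) ∷ (2F , 0F)
  ∷ (1F , 2F) ∷ (0F , 3F) ∷ (1F , 0F) ∷ (0F , 1F) ∷ (2F , 3F) ∷ (3F , 0F) ∷ (2F , 1F) ∷ (3F , 2F) ∷ []))

codeB : Code 1 2
codeB = Base.code baseB

singleT : ShAut → Permutation′ 4 → Permutation′ 4 → Transform 1 2
singleT g p q = record { θ = λ _ → g ; σ = lookup (p ∷ q ∷ []) ; π = Perm.id ; ρ = Perm.id }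

targetsB : List (Transform 1 2)
targetsB =
    singleT (aut 0 0 (0F , 2F)) (swaps 0F 1F 2F) (swaps 2F 3F 0F)
  ∷ singleT (aut 4 1 (0F , 0F)) (swaps 0F 1F 2F) (swaps 0F 1F 3F)
  ∷ singleT (aut 5 1 (1F , 0F)) (swaps 1F 3F 2F) (swaps 3F 0F 2F)
  ∷ singleT (aut 5 0 (2F , 2F)) (swaps 0F 2F 1F) (swaps 3F 1F 0F)
  ∷ singleT (aut 4 0 (3F , 0F)) (swaps 3F 0F 1F) (swaps 2F 0F 3F)
  ∷ singleT (aut 0 1 (0F , 1F)) (swaps 1F 2F 0F) (swaps 1F 2F 3F)
  ∷ []

offTriangle : List ShV
offTriangle = L.drop 2 (L.take 5 allSh) ++ L.drop 6 allSh

-- 00, 01, 11 are pairwise adjacent, so the words over them differ pairwise in both K₄ coordinates,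
-- and permuting values turns these into 0, 1, 2.
startB : Code 1 2
startB = quads ((0F , 0F) ∷ (0F , 1F) ∷ (1F , 1F) ∷ []) ((0F , 0F) ∷ (1F , 1F) ∷ (2F , 2F) ∷ [])

abstract
  finishB : {C : Code 1 2} → Full 3 16 C → (∀ {x} → x ∈ startB → x ∈ C) → C ⟶ codeB
  finishB full@(u , s , l) start =
    proj₂ (backtrack⇒⟶ (λ _ → codeB) id targetsB {M = 16} s (≤-reflexive l) (map column offTriangle)
      (meets-columns (systematic full ≤-refl ≤-refl) offTriangle) startB start tt)

two-differences : ∀ a b a′ b′ → 2 ≤ kD a b + (kD a′ b′ + 0) → a ≢ b × a′ ≢ b′
two-differences a b a′ b′ le with a F.≟ b | a′ F.≟ b′
... | no p | no q = p , q
... | no p | yes q = contradiction le (<⇒≱ ≤-refl)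
... | yes p | no q = contradiction le (<⇒≱ ≤-refl)
... | yes p | yes q = contradiction le (<⇒≱ (s≤s z≤n))

classifyB : {C : Code 1 2} → Full 3 16 C → C ⟶ codeB
classifyB {C} full@(u , s , l)
  with systematic full ≤-refl ≤-refl (0F , 0F) | systematic full ≤-refl ≤-refl (0F , 1F) | systematic full ≤-refl ≤-refl (1F , 1F)
... | (_ ∷ [] , f₀ ∷ g₀ ∷ []) , w₀∈ , refl | (_ ∷ [] , f₁ ∷ g₁ ∷ []) , w₁∈ , refl | (_ ∷ [] , f₂ ∷ g₂ ∷ []) , w₂∈ , refl
  with two-differences f₀ f₁ g₀ g₁ (+-cancelˡ-≤ 1 2 _ (s w₀∈ w₁∈ (λ ())))
     | two-differences f₀ f₂ g₀ g₂ (+-cancelˡ-≤ 1 2 _ (s w₀∈ w₂∈ (λ ())))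
     | two-differences f₁ f₂ g₁ g₂ (+-cancelˡ-≤ 1 2 _ (s w₁∈ w₂∈ (λ ())))
... | f₀₁ , g₀₁ | f₀₂ , g₀₂ | f₁₂ , g₁₂ with ordering f₀₁ f₀₂ f₁₂ | ordering g₀₁ g₀₂ g₁₂
... | p , p₀ , p₁ , p₂ | q , q₀ , q₁ , q₂ = ⟶-trans (⟶-image t) (finishB (full-image t full) start)
  where
  t = singleT autId p q
  start : ∀ {x} → x ∈ startB → x ∈ map (apply t) C
  start (here refl) = subst (_∈ map (apply t) C) (cong₂ (λ a b → (0F , 0F) ∷ [] , a ∷ b ∷ []) p₀ q₀) (∈-map⁺ (apply t) w₀∈)
  start (there (here refl)) = subst (_∈ map (apply t) C) (cong₂ (λ a b → (0F , 1F) ∷ [] , a ∷ b ∷ []) p₁ q₁) (∈-map⁺ (apply t) w₁∈)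
  start (there (there (here refl))) = subst (_∈ map (apply t) C) (cong₂ (λ a b → (1F , 1F) ∷ [] , a ∷ b ∷ []) p₂ q₂) (∈-map⁺ (apply t) w₂∈)

-- Extending a code by one K₄ coordinate

module _ {d : ℕ} (b : Base m n) {C : Code m (suc n)} where

  open Base b

  -- Words with equal tails are at distance at most 1, so dropping the colour is injective; the base
  -- has no more words than the code.
  colour-total : Full (2 + d) (length code) C → (∀ {x} → x ∈ C → tailK x ∈ code) →
                 ∀ {u} → u ∈ code → ∃[ c ] (consK c u ∈ C)
  colour-total (u , s , l) tails {v} v∈ with key-total code _≟V_ tailK C u tail-inj tails (≤-reflexive (sym l)) v∈
    where
    tail-inj : ∀ {x y} → x ∈ C → y ∈ C → tailK x ≡ tailK y → x ≡ y
    tail-inj {x} {y} x∈ y∈ e = sep-injective s x∈ y∈ (≤-<-trans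
      (≤-trans (≤-reflexive (trans (δ-splitK x y) (cong (kD (headK x) (headK y) +_) (trans (cong (δ (tailK x)) (sym e)) (δ-refl (tailK x))))))
               (≤-trans (≤-reflexive (+-identityʳ _)) (kD≤1 (headK x) (headK y))))
      (s≤s (s≤s z≤n)))
  ... | x@(_ , c ∷ _) , x∈ , refl = c , x∈

  same-colour : Full (2 + d) (length code) C → ∀ {u c e} → consK c u ∈ C → consK e u ∈ C → c ≡ e
  same-colour (_ , s , _) {u} {c} {e} cu∈ eu∈ = cong headK (sep-injective s cu∈ eu∈ (s≤s (≤-trans
    (≤-reflexive (trans (δ-consK c e u u) (trans (cong (kD c e +_) (δ-refl u)) (+-identityʳ _))))
    (≤-trans (kD≤1 c e) (s≤s z≤n)))))

  colours-differ : Full (2 + d) (length code) C → ∀ {u v c e} → T ((1 ≤ᵇ δ u v) ∧ (suc (δ u v) ≤ᵇ 2 + d)) →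
                   consK c u ∈ C → consK e v ∈ C → c ≢ e
  colours-differ (_ , s , _) {u} {v} {c} t cu∈ cv∈ refl with Equivalence.to (T-∧ {1 ≤ᵇ δ u v}) t
  ... | t₁ , t₂ = contradiction (≤-trans (s cu∈ cv∈ apart) (≤-reflexive (trans (δ-consK c c u v) (cong (_+ δ u v) (kD-refl c)))))
                                (<⇒≱ (≤ᵇ⇒≤ (suc (δ u v)) (2 + d) t₂))
    where
    apart : consK c u ≢ consK c v
    apart e = contradiction (≤ᵇ⇒≤ 1 (δ u v) t₁)
                (<⇒≱ (subst (_< 1) (sym (trans (cong (δ u) (sym (cong tailK {consK c u} {consK c v} e))) (δ-refl u))) ≤-refl))

  Prepared : Code m (suc n) → Set
  Prepared C′ = C ⟶ C′ × Full (2 + d) (length code) C′ × (∀ {x} → x ∈ start → x ∈ C′) × (∀ {row} → row ∈ rows → Meets C′ row)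

  -- Removes the symmetry of the colours: the clique receives four different ones, which a
  -- permutation names 0, 1, 2, 3.
  prepare : Full (2 + d) (length code) C → (∀ {x} → x ∈ C → tailK x ∈ code) → T (clique (2 + d)) →
            (∀ {u c} → u ∈ F → consK c u ∈ C → consK c q₀ ∈ C) → ∃[ C′ ] Prepared C′
  prepare full tails cl sameF = recolour (colour (here refl)) (colour (there (here refl)))
      (colour (there (there (here refl)))) (colour (there (there (there (here refl)))))
    where
    colour : ∀ {u} → u ∈ code → ∃[ c ] (consK c u ∈ C)
    colour = colour-total full tails
    recolour : ∃[ c ] (consK c q₀ ∈ C) → ∃[ c ] (consK c q₁ ∈ C) → ∃[ c ] (consK c q₂ ∈ C) → ∃[ c ] (consK c q₃ ∈ C) →
               ∃[ C′ ] Prepared C′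
    recolour (c₀ , in₀) (c₁ , in₁) (c₂ , in₂) (c₃ , in₃)
      with Equivalence.to T-∧ cl
    ... | cl₁ , cl₂ with Equivalence.to T-∧ cl₁ | Equivalence.to T-∧ cl₂
    ... | cl₃ , k₀₃ | cl₄ , k₂₃ with Equivalence.to T-∧ cl₃ | Equivalence.to T-∧ cl₄
    ... | k₀₁ , k₀₂ | k₁₂ , k₁₃ = image (ordering c₀≢c₁ (differ k₀₂ in₀ in₂) (differ k₁₂ in₁ in₂))
      where
      differ : ∀ {u v c e} → T ((1 ≤ᵇ δ u v) ∧ (suc (δ u v) ≤ᵇ 2 + d)) → consK c u ∈ C → consK e v ∈ C → c ≢ e
      differ = colours-differ full
      c₀≢c₁ = differ k₀₁ in₀ in₁
      image : Σ[ p ∈ Permutation′ 4 ] (p ⟨$⟩ʳ c₀ ≡ 0F × p ⟨$⟩ʳ c₁ ≡ 1F × p ⟨$⟩ʳ c₂ ≡ 2F) → ∃[ C′ ] Prepared C′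
      image (p , p₀ , p₁ , p₂) = C′ , ⟶-image t , full-image t full , start⊆ , met
        where
        t = liftK p idT
        C′ = map (apply t) C
        moved : ∀ {c e u} → consK c u ∈ C → p ⟨$⟩ʳ c ≡ e → consK e u ∈ C′
        moved {c} {u = u} x∈ refl = subst (_∈ C′) (trans (apply-liftK p idT c u) (cong (consK (p ⟨$⟩ʳ c)) (apply-idT u))) (∈-map⁺ (apply t) x∈)
        -- `ordering` fixes only three images; the last is forced because `c₃` differs from the
        -- other colours.
        p₃ : p ⟨$⟩ʳ c₃ ≡ 3F
        p₃ = fourth _ (λ e → differ k₀₃ in₀ in₃ (perm-injective p (trans p₀ (sym e))))
                      (λ e → differ k₁₃ in₁ in₃ (perm-injective p (trans p₁ (sym e))))
                      (λ e → differ k₂₃ in₂ in₃ (perm-injective p (trans p₂ (sym e))))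
        startF : ∀ {x} → x ∈ map (consK 0F) F → x ∈ C′
        startF x∈ with ∈-map⁻ (consK 0F) x∈
        ... | u , u∈ , refl with colour (there (there (there (there (∈-++⁺ˡ u∈)))))
        ... | c , cu∈ = moved cu∈ (trans (cong (p ⟨$⟩ʳ_) (same-colour full (sameF u∈ cu∈) in₀)) p₀)
        start⊆ : ∀ {x} → x ∈ start → x ∈ C′
        start⊆ (here refl) = moved in₀ p₀
        start⊆ (there (here refl)) = moved in₁ p₁
        start⊆ (there (there (here refl))) = moved in₂ p₂
        start⊆ (there (there (there (here refl)))) = moved in₃ p₃
        start⊆ (there (there (there (there x∈)))) = startF x∈
        met : ∀ {row} → row ∈ rows → Meets C′ row
        met row∈ with ∈-map⁻ palette row∈
        ... | u , u∈ , refl with colour (∈-++⁺ʳ (q₀ ∷ q₁ ∷ q₂ ∷ q₃ ∷ F) u∈)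
        ... | c , cu∈ = consK (p ⟨$⟩ʳ c) u , ∈-map⁺ (λ c → consK c u) (∈-allFin (p ⟨$⟩ʳ c)) , moved cu∈ refl

-- Slices and puncturing of full codes

∑-tight : (ks : List A) (f : A → ℕ) (M : ℕ) → (∀ {x} → x ∈ ks → f x ≤ M) → length ks * M ≤ ∑ ks f →
          ∀ {x} → x ∈ ks → M ≤ f x
∑-tight (k ∷ ks) f M le tot (here refl) = +-cancelʳ-≤ (length ks * M) M (f k)
  (≤-trans tot (+-monoʳ-≤ (f k) (≤-trans (∑-mono ks (le ∘ there)) (≤-reflexive (∑-const ks M)))))
∑-tight (k ∷ ks) f M le tot (there x∈) =
  ∑-tight ks f M (le ∘ there) (+-cancelˡ-≤ M _ _ (≤-trans tot (+-monoˡ-≤ _ (le (here refl))))) x∈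

-- No fibre exceeds `M`, yet together they must account for `length ks * M` words, so none falls
-- short.
full-fibre : (ks : List A) (p : A → B → Bool) → (∀ b → 1 ≤ ∑ ks (λ a → bit (p a b))) → (C : List B) (M : ℕ) →
             (∀ a → length (filter (T? ∘ p a) C) ≤ M) → length ks * M ≤ length C →
             ∀ {a} → a ∈ ks → M ≤ length (filter (T? ∘ p a) C)
full-fibre ks p one C M le l {a} a∈ = subst (M ≤_) (∑-filter (p a) C)
  (∑-tight ks (λ a → ∑ C (bit ∘ p a)) M (λ {x} _ → subst (_≤ M) (sym (∑-filter (p x) C)) (le x)) (begin
    length ks * M                         ≤⟨ l ⟩
    length C                              ≡⟨ ∑-1 C ⟨
    ∑ C (λ _ → 1)                         ≤⟨ ∑-mono C (λ {b} _ → one b) ⟩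
    ∑ C (λ b → ∑ ks (λ a → bit (p a b)))  ≡⟨ ∑-swap C ks (λ b a → bit (p a b)) ⟩
    ∑ ks (λ a → ∑ C (bit ∘ p a))          ∎) a∈)
  where open ≤-Reasoning

once : ∀ b → 1 ≤ ∑ (allFin 4) (λ a → bit (eqZ4 a b))
once b = ≤ᵇ⇒≤ _ _ (∀Z4 (λ b → 1 ≤ᵇ ∑ (allFin 4) (λ a → bit (eqZ4 a b))) tt b)

slice : Z4 → Code m (suc n) → Code m n
slice a C = map tailK (filter (T? ∘ eqZ4 a ∘ headK) C)

∈-slice : ∀ {a} {C : Code m (suc n)} {x} → x ∈ slice a C → consK a x ∈ C
∈-slice {a = a} {C} p with ∈-map⁻ tailK p
... | y@(_ , c ∷ _) , y∈ , refl with ∈-filter⁻ (T? ∘ eqZ4 a ∘ headK) {xs = C} y∈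
... | y∈C , e with eqZ4⇒≡ {a} {c} e
... | refl = y∈C

slice-separated : ∀ a d {C : Code m (suc n)} → Unique C → Sep (suc d) C → Unique (slice a C) × Sep (suc d) (slice a C)
slice-separated a d {C} u s = contract tailK (filter P? C) 0 d le (UP.filter⁺ P? u)
    (sep-⊆ (λ {x} p → proj₁ (∈-filter⁻ P? {xs = C} p)) s)
  where
  P? = T? ∘ eqZ4 a ∘ headK
  le : ∀ {x y} → x ∈ filter P? C → y ∈ filter P? C → δ x y ≤ δ (tailK x) (tailK y)
  le {x} {y} x∈ y∈ = ≤-reflexive (trans (δ-splitK x y) (cong (_+ δ (tailK x) (tailK y))
    (trans (cong (λ z → kD z (headK y)) (trans (sym (eqZ4⇒≡ {a} {headK x} (proj₂ (∈-filter⁻ P? {xs = C} x∈)))) (eqZ4⇒≡ {a} {headK y} (proj₂ (∈-filter⁻ P? {xs = C} y∈))))) (kD-refl (headK y)))))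

-- Within a slice the Shrikhande coordinate determines the word, so each of the four slices has at
-- most 16 words, and they share 64.
slice-full : {C : Code (suc m) (suc n)} → 2 * m + n < 3 → Full 3 64 C → Full 3 16 (slice 0F C)
slice-full {C = C} lt (u , s , l) = proj₁ (sep 0F) , proj₂ (sep 0F) , ≤-antisym
    (bound 0F) (≤-trans (full-fibre (allFin 4) (λ a x → eqZ4 a (headK x)) (once ∘ headK) C 16
                          (λ a → ≤-trans (≤-reflexive (sym (length-map tailK (fibre a)))) (bound a)) (≤-reflexive (sym l)) (∈-allFin 0F))
                        (≤-reflexive (sym (length-map tailK (fibre 0F)))))
  where
  fibre : Z4 → Code _ _
  fibre a = filter (T? ∘ eqZ4 a ∘ headK) C
  sep : ∀ a → Unique (slice a C) × Sep 3 (slice a C)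
  sep a = slice-separated a 2 u s
  bound : ∀ a → length (slice a C) ≤ 16
  bound a = ≤-trans (≤-reflexive (sym (length-map headSh (slice a C))))
    (unique-⊆-length (unique-map (slice a C) (head-injective (proj₂ (sep a)) lt) (proj₁ (sep a))) (λ {v} _ → ∈-allSh v))

puncture-full : ∀ {d M} {C : Code m (suc n)} → Full (2 + d) M C → Full (1 + d) M (map tailK C)
puncture-full {d = d} {C = C} (u , s , l) = proj₁ both , proj₂ both , trans (length-map tailK C) l
  where
  both = contract tailK C 1 d (λ {x} {y} _ _ → ≤-trans (≤-reflexive (δ-splitK x y)) (+-monoˡ-≤ _ (kD≤1 (headK x) (headK y)))) u s

module _ {d : ℕ} (b : Base m n) {C : Code m (suc n)} where

  open Base b

  solution : Code m (suc n)
  solution = Base.code (extend (2 + d) b)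

  -- All solutions of the search agree up to the order of the words. The identity is enough as
  -- transform because `prepare` has already fixed the names of the colours.
  Rigid : Set
  Rigid = T (all (covered (λ (_ : ⊤) → solution) (λ _ → idT) (tt ∷ []) (2 + d) (length code)) (backtrack (2 + d) rows start))

  rigid : ∃[ C′ ] Prepared {d = d} b {C} C′ → Rigid → C ⟶ solution
  rigid (C′ , C⟶C′ , (u , s , l) , start⊆ , met) found = ⟶-trans C⟶C′ (proj₂
    (backtrack⇒⟶ (λ (_ : ⊤) → solution) (λ _ → idT) (tt ∷ []) {M = length code} s (≤-reflexive l) rows met start start⊆ found))

  impossible : ∃[ C′ ] Prepared {d = d} b {C} C′ → T (L.null (backtrack (2 + d) rows start)) → ⊥
  impossible (C′ , _ , (_ , s , _) , start⊆ , met) empty with backtrack (2 + d) rows start | backtrack-complete s rows met start start⊆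
  ... | [] | _ , () , _

  -- The transform that normalises the punctured code is lifted so as to leave the new coordinate
  -- alone; then all tails lie in `code` and the new coordinate is a colouring of it.
  prepare-punctured : Full (3 + d) (length code) C → F ≡ [] → T (clique (3 + d)) → map tailK C ⟶ code →
                      ∃[ C′ ] Prepared {d = suc d} b {C} C′
  prepare-punctured full F≡[] cl (t , f) = transport (prepare b (full-image t′ full) tails cl noF)
    where
    t′ = liftK Perm.id t
    C₁ = map (apply t′) C
    transport : ∃[ C′ ] Prepared {d = suc d} b {C₁} C′ → ∃[ C′ ] Prepared {d = suc d} b {C} C′
    transport (C′ , to , rest) = C′ , ⟶-trans (⟶-image t′) to , rest
    tails : ∀ {x} → x ∈ C₁ → tailK x ∈ code
    tails p with ∈-map⁻ (apply t′) p
    ... | (s , a ∷ h) , x∈ , refl = f (∈-map⁺ tailK x∈)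
    noF : ∀ {u c} → u ∈ F → consK c u ∈ C₁ → consK c q₀ ∈ C₁
    noF u∈ with subst (_ ∈_) F≡[] u∈
    ... | ()

-- For 16 words at distance 3 in D(2,0) or D(1,2) the balls of 1 + 12 vertices are disjoint, so 256
-- - 208 = 48 vertices are far.
far : Code m n → Vertex m n → Bool
far C v = all (λ u → 2 ≤ᵇ δ v u) C

-- In a perfect code the words off the layer of colour 0 project to vertices at
-- distance ≥ 2 from that layer, and there are only 48 of these.
layers : Base m n → Base m n
layers {m} {n} b = pick (L.filterᵇ (far code) (vertices m n))
  where
  open Base b
  pick : Code m n → Base m n
  pick (w₁ ∷ w₂ ∷ w₃ ∷ W) = base q₀ w₁ w₂ w₃ (q₁ ∷ q₂ ∷ q₃ ∷ F ++ G) W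
  -- With fewer than three far vertices this default of 16 words would fail the check for 64 in
  -- `prepare-layered`.
  pick _ = b

inLayers : Base m n → Base m n → Vertex m n → Bool
inLayers b c v = implies (v ∈ᵇ Base.code b ∨ far (Base.code b) v) (v ∈ᵇ Base.code c)

layered : Base m n → Base m n → Bool
layered {m} {n} b c = (Base.q₀ c ∈ᵇ Base.code b ∧ all (_∈ᵇ Base.code b) (Base.F c)) ∧ all (inLayers b c) (vertices m n)

module _ (b c : Base (suc m) n) {C : Code (suc m) (suc n)} where

  private
    R = Base.code b
    module c = Base c

  -- After the transform the layer of colour 0 is all of `R`. A tail outside `R` is at distance at
  -- least 2 from `R`, since the colour contributes at most 1 to the distance 3, so it is among the
  -- vertices listed by `layers`.
  prepare-layered : Full 3 64 C → 2 * m + n < 3 → slice 0F C ⟶ R → length R ≤ 16 → length c.code ≡ 64 →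
                    T (layered b c) → T (c.clique 3) → ∃[ C′ ] Prepared {d = 1} c {C} C′
  prepare-layered full lt (t , f) short len ok cl = transport (prepare c full₁ tails cl sameF)
    where
    t′ = liftK Perm.id t
    C₁ = map (apply t′) C
    full₁ : Full 3 (length c.code) C₁
    full₁ = subst (λ M → Full 3 M C₁) (sym len) (full-image t′ full)
    ok₁ = Equivalence.to (T-∧ {c.q₀ ∈ᵇ R ∧ all (_∈ᵇ R) c.F}) ok
    ok₂ = Equivalence.to (T-∧ {c.q₀ ∈ᵇ R}) (proj₁ ok₁)
    transport : ∃[ C′ ] Prepared {d = 1} c {C₁} C′ → ∃[ C′ ] Prepared {d = 1} c {C} C′
    transport (C′ , to , rest) = C′ , ⟶-trans (⟶-image t′) to , rest
    layer₀ : ∀ {u} → u ∈ R → consK 0F u ∈ C₁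
    layer₀ {u} u∈ = raise (onto t (slice-full lt full) short f u∈)
      where
      raise : ∃[ x ] (x ∈ slice 0F C × u ≡ apply t x) → consK 0F u ∈ C₁
      raise (x , x∈ , refl) = ∈-map⁺ (apply t′) (∈-slice {a = 0F} x∈)
    project : ∀ {v} → T (v ∈ᵇ R ∨ far R v) → v ∈ c.code
    project {v} h = ∈ᵇ⇒∈ v c.code (modus (all-T (inLayers b c) (vertices (suc m) n) (proj₂ ok₁) (∈-vertices v)) h)
    tails : ∀ {x} → x ∈ C₁ → tailK x ∈ c.code
    tails {x} x∈ with any? (tailK x ≟V_) R
    ... | yes p = project (Equivalence.from T-∨ (inj₁ (∈⇒∈ᵇ p)))
    ... | no ∉R = project (Equivalence.from (T-∨ {tailK x ∈ᵇ R}) (inj₂ (all⁻ (λ u → 2 ≤ᵇ δ (tailK x) u) (All.tabulate away))))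
      where
      away : ∀ {u} → u ∈ R → T (2 ≤ᵇ δ (tailK x) u)
      away {u} u∈ = ≤⇒≤ᵇ {2} (+-cancelˡ-≤ 1 _ _ (≤-trans (proj₁ (proj₂ full₁) x∈ (layer₀ u∈) λ { refl → ∉R u∈ })
        (≤-trans (≤-reflexive (δ-splitK x (consK 0F u))) (+-monoˡ-≤ (δ (tailK x) u) (kD≤1 (headK x) 0F)))))
    sameF : ∀ {u e} → u ∈ c.F → consK e u ∈ C₁ → consK e c.q₀ ∈ C₁
    sameF {u} {e} u∈F eu∈ = subst (λ e → consK e c.q₀ ∈ C₁)
      (same-colour c full₁ (layer₀ (∈ᵇ⇒∈ u R (all-T (_∈ᵇ R) c.F (proj₂ ok₂) u∈F))) eu∈) (layer₀ (∈ᵇ⇒∈ c.q₀ R (proj₁ ok₂)))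

-- Codes in D(2,1), D(1,3), D(2,2) and D(1,4)

baseC : Fin 2 → Base 2 1
baseC r = extend 3 (layers (baseA r))

baseD : Base 1 3
baseD = extend 3 (layers baseB)

baseE : Fin 2 → Base 2 1
baseE r = extend 4 (baseA r)

baseF : Base 1 3
baseF = extend 4 baseB

baseG : Base 2 2
baseG = extend 4 (baseC 1F)

abstract
  classifyC : {C : Code 2 1} → Full 3 64 C → ∃[ r ] (C ⟶ Base.code (baseC r))
  classifyC {C} full = finish (classifyA (slice-full ≤-refl full))
    where
    finish : ∃[ r ] (slice 0F C ⟶ codeA r) → ∃[ r ] (C ⟶ Base.code (baseC r))
    finish (0F , to) = 0F , rigid (layers (baseA 0F)) (prepare-layered (baseA 0F) (layers (baseA 0F)) full ≤-refl to ≤-refl refl tt tt) tt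
    finish (1F , to) = 1F , rigid (layers (baseA 1F)) (prepare-layered (baseA 1F) (layers (baseA 1F)) full ≤-refl to ≤-refl refl tt tt) tt

  classifyD : {C : Code 1 3} → Full 3 64 C → C ⟶ Base.code baseD
  classifyD full = rigid (layers baseB) (prepare-layered baseB (layers baseB) full ≤-refl (classifyB (slice-full ≤-refl full)) ≤-refl refl tt tt) tt

  classifyE : {C : Code 2 1} → Full 4 16 C → ∃[ r ] (C ⟶ Base.code (baseE r))
  classifyE {C} full = finish (classifyA (puncture-full full))
    where
    finish : ∃[ r ] (map tailK C ⟶ codeA r) → ∃[ r ] (C ⟶ Base.code (baseE r))
    finish (0F , to) = 0F , rigid (baseA 0F) (prepare-punctured (baseA 0F) full refl tt to) tt
    finish (1F , to) = 1F , rigid (baseA 1F) (prepare-punctured (baseA 1F) full refl tt to) tt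

  classifyF : {C : Code 1 3} → Full 4 16 C → C ⟶ Base.code baseF
  classifyF full = rigid baseB (prepare-punctured baseB full refl tt (classifyB (puncture-full full))) tt

  -- Only one of the two classes in D(2,1) admits a colouring, and that colouring is forced.
  classifyG : {C : Code 2 2} → Full 4 64 C → C ⟶ Base.code baseG
  classifyG {C} full = finish (classifyC (puncture-full full))
    where
    finish : ∃[ r ] (map tailK C ⟶ Base.code (baseC r)) → C ⟶ Base.code baseG
    finish (0F , to) = ⊥-elim (impossible (baseC 0F) (prepare-punctured (baseC 0F) full refl tt to) tt)
    finish (1F , to) = rigid (baseC 1F) (prepare-punctured (baseC 1F) full refl tt to) tt

  -- Puncturing would give the unique class in D(1,3), and the search for its colouring comes out
  -- empty.
  excludeH : {C : Code 1 4} → ¬ Full 4 64 C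
  excludeH full = impossible baseD (prepare-punctured baseD full refl tt (classifyD (puncture-full full))) tt

-- Labelled cocliques of size 4 in the Shrikhande graph.  Pattern 0 has all pairs
-- special; in pattern i = 1, 2, 3 the special pairs are {0,i} and its complement.

std : Z4 → Z4 → ShV
std p k = lookup (lookup table p) k
  where
  table : Vec (Vec ShV 4) 4
  table = ((0F , 0F) ∷ (0F , 2F) ∷ (2F , 0F) ∷ (2F , 2F) ∷ [])
        ∷ ((0F , 0F) ∷ (2F , 0F) ∷ (1F , 2F) ∷ (3F , 2F) ∷ [])
        ∷ ((0F , 0F) ∷ (1F , 2F) ∷ (2F , 0F) ∷ (3F , 2F) ∷ [])
        ∷ ((0F , 0F) ∷ (1F , 2F) ∷ (3F , 2F) ∷ (2F , 0F) ∷ []) ∷ []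

aligned : ShV → ShV → ShV → ShV → ShAut × Z4 → Bool
aligned t₀ t₁ t₂ t₃ (g , p) = (eqSh (f t₀) (std p 0F) ∧ eqSh (f t₁) (std p 1F)) ∧ (eqSh (f t₂) (std p 2F) ∧ eqSh (f t₃) (std p 3F))
  where f = ShAut.fun (g ∘A translation t₀)

alignments : List (ShAut × Z4)
alignments = cartesianProduct stabilizer (allFin 4)

remote : ShV → ShV → Bool
remote x y = 2 ≤ᵇ shD x y

module _ (q : ShV → ShV → ShV → ShV → Bool) where

  -- Nesting the conditions closes a branch as soon as two vertices are too close, so only a small
  -- part of the 16⁴ quadruples is evaluated.
  check₃ : ShV → ShV → ShV → ShV → Bool
  check₃ t₀ t₁ t₂ t₃ = implies (remote t₀ t₃ ∧ (remote t₁ t₃ ∧ remote t₂ t₃)) (q t₀ t₁ t₂ t₃)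

  check₂ : ShV → ShV → ShV → Bool
  check₂ t₀ t₁ t₂ = implies (remote t₀ t₂ ∧ remote t₁ t₂) (all (check₃ t₀ t₁ t₂) allSh)

  check₁ : ShV → ShV → Bool
  check₁ t₀ t₁ = implies (remote t₀ t₁) (all (check₂ t₀ t₁) allSh)

  ∀cocliques : T (all (λ t₀ → all (check₁ t₀) allSh) allSh) → (t : Z4 → ShV) →
               (∀ k l → k ≢ l → 2 ≤ shD (t k) (t l)) → T (q (t 0F) (t 1F) (t 2F) (t 3F))
  ∀cocliques ok t far = modus {remote t₀ t₃ ∧ (remote t₁ t₃ ∧ remote t₂ t₃)} {q t₀ t₁ t₂ t₃}
      (∀Sh (check₃ t₀ t₁ t₂) (modus {remote t₀ t₂ ∧ remote t₁ t₂} {all (check₃ t₀ t₁ t₂) allSh}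
        (∀Sh (check₂ t₀ t₁) (modus {remote t₀ t₁} {all (check₂ t₀ t₁) allSh} (∀Sh² check₁ ok t₀ t₁) (≥2 0F 1F (λ ()))) t₂)
        (≥2 0F 2F (λ ()) & ≥2 1F 2F (λ ()))) t₃)
      (≥2 0F 3F (λ ()) & (≥2 1F 3F (λ ()) & ≥2 2F 3F (λ ())))
    where
    t₀ = t 0F
    t₁ = t 1F
    t₂ = t 2F
    t₃ = t 3F
    ≥2 : ∀ k l → k ≢ l → T (remote (t k) (t l))
    ≥2 k l ne = ≤⇒≤ᵇ (far k l ne)

alignable : ShV → ShV → ShV → ShV → Bool
alignable t₀ t₁ t₂ t₃ = any (aligned t₀ t₁ t₂ t₃) alignments

abstract
  all-alignable : (t : Z4 → ShV) → (∀ k l → k ≢ l → 2 ≤ shD (t k) (t l)) → T (alignable (t 0F) (t 1F) (t 2F) (t 3F))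
  all-alignable = ∀cocliques alignable tt

  coclique : (t : Z4 → ShV) → (∀ k l → k ≢ l → 2 ≤ shD (t k) (t l)) →
             Σ[ g ∈ ShAut ] Σ[ p ∈ Z4 ] (∀ k → ShAut.fun g (t k) ≡ std p k)
  coclique t far = conclude (any-T (aligned t₀ t₁ t₂ t₃) alignments (all-alignable t far))
    where
    t₀ t₁ t₂ t₃ : ShV
    t₀ = t 0F
    t₁ = t 1F
    t₂ = t 2F
    t₃ = t 3F
    conclude : ∃[ a ] (a ∈ alignments × T (aligned t₀ t₁ t₂ t₃ a)) →
               Σ[ g ∈ ShAut ] Σ[ p ∈ Z4 ] (∀ k → ShAut.fun g (t k) ≡ std p k)
    conclude ((g , p) , _ , ok) = g ∘A translation t₀ , p , agree
      where
      f : ShV → ShV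
      f = ShAut.fun (g ∘A translation t₀)
      halves : T (eqSh (f t₀) (std p 0F) ∧ eqSh (f t₁) (std p 1F)) × T (eqSh (f t₂) (std p 2F) ∧ eqSh (f t₃) (std p 3F))
      halves = Equivalence.to T-∧ ok
      half₁ : T (eqSh (f t₀) (std p 0F)) × T (eqSh (f t₁) (std p 1F))
      half₁ = Equivalence.to T-∧ (proj₁ halves)
      half₂ : T (eqSh (f t₂) (std p 2F)) × T (eqSh (f t₃) (std p 3F))
      half₂ = Equivalence.to T-∧ (proj₂ halves)
      agree : ∀ k → f (t k) ≡ std p k
      agree 0F = eqSh⇒≡ _ _ (proj₁ half₁)
      agree 1F = eqSh⇒≡ _ _ (proj₂ half₁)
      agree 2F = eqSh⇒≡ _ _ (proj₁ half₂)
      agree 3F = eqSh⇒≡ _ _ (proj₂ half₂)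

-- Words at distance `2 * m + n` differ in every K₄ coordinate, so after permuting its values each
-- such coordinate is the label itself.
word : Vec Z4 m → (n : ℕ) → Z4 → Vertex m n
word P n k = V.map (λ p → std p k) P , V.replicate n k

codeOfPatterns : Vec Z4 m → (n : ℕ) → Code m n
codeOfPatterns P n = map (word P n) (allFin 4)

∀Z4³-apart : (f g : Z4 → Z4 → Z4 → ℕ) →
             T (all (λ p → all (λ k → all (λ l → eqZ4 k l ∨ (f p k l ≡ᵇ g p k l)) (allFin 4)) (allFin 4)) (allFin 4)) →
             ∀ p k l → k ≢ l → f p k l ≡ g p k l
∀Z4³-apart f g t p k l k≢l = conclude (Equivalence.to (T-∨ {eqZ4 k l}) (∀Z4² (λ k l → eqZ4 k l ∨ (f p k l ≡ᵇ g p k l))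
    (∀Z4 (λ p → all (λ k → all (λ l → eqZ4 k l ∨ (f p k l ≡ᵇ g p k l)) (allFin 4)) (allFin 4)) t p) k l))
  where
  conclude : T (eqZ4 k l) ⊎ T (f p k l ≡ᵇ g p k l) → f p k l ≡ g p k l
  conclude (inj₁ e) = contradiction (eqZ4⇒≡ e) k≢l
  conclude (inj₂ e) = ≡ᵇ⇒≡ (f p k l) (g p k l) e

std-δ : Z4 → Z4 → Z4 → ℕ
std-δ p k l = shD (std p k) (std p l)

std-far : ∀ p k l → k ≢ l → std-δ p k l ≡ 2
std-far = ∀Z4³-apart std-δ (λ _ _ _ → 2) tt

word-δ : (P : Vec Z4 m) (n : ℕ) (k l : Z4) → k ≢ l → δ (word P n k) (word P n l) ≡ 2 * m + n
word-δ {m} P n k l k≢l = cong₂ _+_ (trans (shPart P) (*-comm m 2)) (kPart n)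
  where
  shPart : ∀ {m} (P : Vec Z4 m) → vD shD (V.map (λ p → std p k) P) (V.map (λ p → std p l) P) ≡ m * 2
  shPart [] = refl
  shPart (p ∷ P) = cong₂ _+_ (std-far p k l k≢l) (shPart P)
  kPart : ∀ n → vD kD (V.replicate n k) (V.replicate n l) ≡ n
  kPart zero = refl
  kPart (suc n) = cong₂ _+_ (kD-≢ k l k≢l) (kPart n)

word-injective : 1 ≤ m + n → (P : Vec Z4 m) {k l : Z4} → word P n k ≡ word P n l → k ≡ l
word-injective {m} {n} pos P {k} {l} e with k F.≟ l
... | yes p = p
... | no k≢l = contradiction (≤-trans pos (+-monoˡ-≤ n (m≤m+n m (m + 0))))
  (<⇒≱ (subst (_< 1) (trans (sym (δ-refl (word P n k))) (trans (cong (δ (word P n k)) e) (word-δ P n k l k≢l))) (s≤s z≤n)))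

-- MDS codes and systems of representatives

MDS-intro : ∀ {m n k d} {C : Code m n} → 1 ≤ k → d ≡ 2 * m + n + 1 ∸ k → Full d (4 ^ k) C →
            ∀ {x y} → x ∈ C → y ∈ C → x ≢ y → δ x y ≡ d → IsMDS m n k C
MDS-intro 1≤k refl (u , s , l) {x} {y} x∈ y∈ x≢y e =
  1≤k , u , l , (λ {v} {w} v∈ w∈ ne → ≤-trans (s v∈ w∈ ne) (≤-reflexive (sym (dist≡δ v w)))) , x , y , x∈ , y∈ , x≢y , trans (dist≡δ x y) e

MDS-elim : ∀ {m n k d} {C : Code m n} → d ≡ 2 * m + n + 1 ∸ k → IsMDS m n k C → Full d (4 ^ k) C
MDS-elim refl (_ , u , l , s , _) = u , (λ {v} {w} v∈ w∈ ne → ≤-trans (s v∈ w∈ ne) (≤-reflexive (dist≡δ v w))) , l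

classification : ∀ {k d N} → d ≡ 2 * m + n + 1 ∸ k → (code : Fin N → Code m n) → (∀ i → IsMDS m n k (code i)) →
                 (∀ i j → i ≢ j → ¬ Equivalent (code i) (code j)) →
                 (∀ C → Full d (4 ^ k) C → ∃[ i ] (C ⟶ code i)) → NumClasses m n k N
classification {m} {n} {k} {d} {N} e code mds ineq complete =
  tabulate code , (λ i → subst (IsMDS m n k) (sym (at i)) (mds i)) ,
  (λ i j i≢j eq → ineq i j i≢j (subst (Equivalent (code i)) (at j) (subst (λ C → Equivalent C (lookup (tabulate code) j)) (at i) eq))) ,
  λ C h → conclude C (MDS-elim e h) (complete C (MDS-elim e h))
  where
  at : ∀ i → lookup (tabulate code) i ≡ code i
  at = lookup∘tabulate code
  conclude : ∀ C → Full d (4 ^ k) C → ∃[ i ] (C ⟶ code i) → ∃[ i ] Equivalent C (lookup (tabulate code) i)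
  conclude C (u , _ , l) (i , to) = i , subst (Equivalent C) (sym (at i))
    (⟶⇒Equivalent u (≤-reflexive (trans (proj₁ (proj₂ (proj₂ (mds i)))) (sym l))) to)

patterns-full : 1 ≤ m + n → (P : Vec Z4 m) → Full (2 * m + n) 4 (codeOfPatterns P n)
patterns-full {m} {n} pos P = UP.map⁺ (word-injective pos P) (UP.allFin⁺ 4) , sep , refl
  where
  sep : Sep (2 * m + n) (codeOfPatterns P n)
  sep p q ne with ∈-map⁻ (word P n) p | ∈-map⁻ (word P n) q
  ... | k , _ , refl | l , _ , refl = ≤-reflexive (sym (word-δ P n k l (λ { refl → ne refl })))

patterns-MDS : 1 ≤ m + n → (P : Vec Z4 m) → IsMDS m n 1 (codeOfPatterns P n)
patterns-MDS {m} {n} pos P = MDS-intro (s≤s z≤n) (sym (m+n∸n≡m (2 * m + n) 1)) (patterns-full pos P)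
  (∈-map⁺ (word P n) (∈-allFin 0F)) (∈-map⁺ (word P n) (∈-allFin 1F)) distinct (word-δ P n 0F 1F (λ ()))
  where
  distinct : word P n 0F ≢ word P n 1F
  distinct e with word-injective {n = n} pos P {0F} {1F} e
  ... | ()

-- Special coordinates of pattern codes

cnt : (A → ℕ) → Vec A n → ℕ
cnt f [] = 0
cnt f (x ∷ xs) = f x + cnt f xs

cnt-cong : {f g : A → ℕ} → (∀ x → f x ≡ g x) → (xs : Vec A n) → cnt f xs ≡ cnt g xs
cnt-cong e [] = refl
cnt-cong e (x ∷ xs) = cong₂ _+_ (e x) (cnt-cong e xs)

cnt-+ : (f g : A → ℕ) (xs : Vec A n) → cnt (λ x → f x + g x) xs ≡ cnt f xs + cnt g xs
cnt-+ f g [] = refl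
cnt-+ f g (x ∷ xs) = trans (cong (f x + g x +_) (cnt-+ f g xs)) (+-interchange (f x) (g x) _ _)

cnt-1 : (xs : Vec A n) → cnt (λ _ → 1) xs ≡ n
cnt-1 [] = refl
cnt-1 (x ∷ xs) = cong suc (cnt-1 xs)

occurrences : Z4 → Vec Z4 m → ℕ
occurrences q = cnt (λ p → bit (eqZ4 q p))

-- Two labels paired in matching `i` are special in the coordinates of pattern 0, which is special
-- throughout, and in those of pattern `i`.
specials : Z4 → Vec Z4 m → ℕ
specials i P = occurrences 0F P + occurrences i P

-- Numbers the three perfect matchings of the labels; the diagonal is junk.
pairing : Z4 → Z4 → Z4
pairing k l = lookup (lookup ((0F ∷ 1F ∷ 2F ∷ 3F ∷ []) ∷ (1F ∷ 0F ∷ 3F ∷ 2F ∷ []) ∷ (2F ∷ 3F ∷ 0F ∷ 1F ∷ []) ∷ (3F ∷ 2F ∷ 1F ∷ 0F ∷ []) ∷ []) k) l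

std-special pairing-special : Z4 → Z4 → Z4 → ℕ
std-special p k l = special (std p k) (std p l)
pairing-special p k l = bit (eqZ4 0F p) + bit (eqZ4 (pairing k l) p)

special-std : ∀ p k l → k ≢ l → std-special p k l ≡ pairing-special p k l
special-std = ∀Z4³-apart std-special pairing-special tt

β-word : (P : Vec Z4 m) (k l : Z4) → k ≢ l → β (word P n k) (word P n l) ≡ specials (pairing k l) P
β-word P k l k≢l = trans (unfold P) (trans (cnt-cong (λ p → special-std p k l k≢l) P) (cnt-+ _ _ P))
  where
  unfold : ∀ {m} (P : Vec Z4 m) → vD special (V.map (λ p → std p k) P) (V.map (λ p → std p l) P) ≡ cnt (λ p → special (std p k) (std p l)) P
  unfold [] = refl
  unfold (p ∷ P) = cong (special (std p k) (std p l) +_) (unfold P)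

β-refl : (x : Vertex m n) → β x x ≡ 0
β-refl (s , _) = vD-refl special (λ v → ≡ᵇ⇒≡ _ _ (∀Sh (λ v → special v v ≡ᵇ 0) tt v)) s

-- Each of the three matchings accounts for four ordered pairs of labels, and the diagonal for four
-- more.
profile-patterns : (g : ℕ → ℕ) (P : Vec Z4 m) → profile g (codeOfPatterns P n) ≡
                   4 * (g 0 + (g (specials 1F P) + (g (specials 2F P) + g (specials 3F P))))
profile-patterns {n = n} g P = trans (cong₂ _+_ (row 0F) (cong₂ _+_ (row 1F) (cong₂ _+_ (row 2F) (cong₂ _+_ (row 3F) refl))))
    (+-*-Solver.solve 4 (λ o x y z → (o :+ (x :+ (y :+ (z :+ con 0)))) :+ ((x :+ (o :+ (z :+ (y :+ con 0)))) :+ ((y :+ (z :+ (o :+ (x :+ con 0)))) :+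
                          ((z :+ (y :+ (x :+ (o :+ con 0)))) :+ con 0))) := con 4 :* (o :+ (x :+ (y :+ z)))) refl
             (g 0) (g (specials 1F P)) (g (specials 2F P)) (g (specials 3F P)))
  where
  open +-*-Solver using (_:+_; _:*_; _:=_; con)
  value : Z4 → Z4 → ℕ
  value k l = if eqZ4 k l then 0 else specials (pairing k l) P
  entry : ∀ k l → β (word P n k) (word P n l) ≡ value k l
  entry k l with k F.≟ l
  ... | yes refl = β-refl (word P n k)
  ... | no k≢l = β-word {n = n} P k l k≢l
  row : ∀ k → ∑ (codeOfPatterns P n) (λ y → g (β (word P n k) y)) ≡ g (value k 0F) + (g (value k 1F) + (g (value k 2F) + (g (value k 3F) + 0)))
  row k = cong₂ _+_ (cong g (entry k 0F)) (cong₂ _+_ (cong g (entry k 1F)) (cong₂ _+_ (cong g (entry k 2F)) (cong₂ _+_ (cong g (entry k 3F)) refl)))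

-- Sorted vectors of patterns

canon : ℕ → ℕ → ℕ → (m : ℕ) → Vec Z4 m
canon a b c zero = []
canon (suc a) b c (suc m) = 0F ∷ canon a b c m
canon zero (suc b) c (suc m) = 1F ∷ canon zero b c m
canon zero zero (suc c) (suc m) = 2F ∷ canon zero zero c m
canon zero zero zero (suc m) = 3F ∷ canon zero zero zero m

record _≋_ {n : ℕ} {A : Set} (P Q : Vec A n) : Set where
  constructor rearrange
  field
    order  : Permutation′ n
    agrees : ∀ i → lookup Q i ≡ lookup P (order ⟨$⟩ʳ i)

≋-refl : (P : Vec A n) → P ≋ P
≋-refl P = rearrange Perm.id λ i → refl

≋-trans : {P Q R : Vec A n} → P ≋ Q → Q ≋ R → P ≋ R
≋-trans (rearrange π e) (rearrange ρ f) = rearrange (ρ ∘ₚ π) λ i → trans (f i) (e (ρ ⟨$⟩ʳ i))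

≋-cons : (p : A) {P Q : Vec A n} → P ≋ Q → (p ∷ P) ≋ (p ∷ Q)
≋-cons p (rearrange π e) = rearrange (lift₀ π) λ { zero → refl ; (suc i) → e i }

≋-exchange : (p q : A) (P : Vec A n) → (p ∷ q ∷ P) ≋ (q ∷ p ∷ P)
≋-exchange p q P = rearrange (Perm.swap Perm.id) λ { zero → refl ; (suc zero) → refl ; (suc (suc i)) → refl }

-- The new entry moves past the smaller ones; the bound ensures that `canon` is not cut off at
-- length `m` before its place is reached.
insert₁ : ∀ a b c {m} → a ≤ m → (1F ∷ canon a b c m) ≋ canon a (suc b) c (suc m)
insert₁ zero b c _ = ≋-refl _
insert₁ (suc a) b c (s≤s a≤m) = ≋-trans (≋-exchange 1F 0F _) (≋-cons 0F (insert₁ a b c a≤m))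

insert₂ : ∀ a b c {m} → a + b ≤ m → (2F ∷ canon a b c m) ≋ canon a b (suc c) (suc m)
insert₂ zero zero c _ = ≋-refl _
insert₂ zero (suc b) c (s≤s b≤m) = ≋-trans (≋-exchange 2F 1F _) (≋-cons 1F (insert₂ zero b c b≤m))
insert₂ (suc a) b c (s≤s ab≤m) = ≋-trans (≋-exchange 2F 0F _) (≋-cons 0F (insert₂ a b c ab≤m))

insert₃ : ∀ a b c {m} → a + b + c ≤ m → (3F ∷ canon a b c m) ≋ canon a b c (suc m)
insert₃ zero zero zero _ = ≋-refl _
insert₃ zero zero (suc c) (s≤s c≤m) = ≋-trans (≋-exchange 3F 2F _) (≋-cons 2F (insert₃ zero zero c c≤m))
insert₃ zero (suc b) c (s≤s bc≤m) = ≋-trans (≋-exchange 3F 1F _) (≋-cons 1F (insert₃ zero b c bc≤m))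
insert₃ (suc a) b c (s≤s abc≤m) = ≋-trans (≋-exchange 3F 0F _) (≋-cons 0F (insert₃ a b c abc≤m))

occurrences-total : (P : Vec Z4 m) →
  occurrences 0F P + occurrences 1F P + occurrences 2F P + occurrences 3F P ≡ m
occurrences-total P = begin
  o 0F + o 1F + o 2F + o 3F                                                            ≡⟨ cong (λ z → z + o 2F + o 3F) (cnt-+ (i 0F) (i 1F) P) ⟨
  cnt (λ p → i 0F p + i 1F p) P + o 2F + o 3F                                         ≡⟨ cong (_+ o 3F) (cnt-+ (λ p → i 0F p + i 1F p) (i 2F) P) ⟨
  cnt (λ p → i 0F p + i 1F p + i 2F p) P + o 3F                                       ≡⟨ cnt-+ (λ p → i 0F p + i 1F p + i 2F p) (i 3F) P ⟨
  cnt (λ p → i 0F p + i 1F p + i 2F p + i 3F p) P                                     ≡⟨ cnt-cong one P ⟩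
  cnt (λ _ → 1) P                                                                     ≡⟨ cnt-1 P ⟩
  _ ∎
  where
  open ≡-Reasoning
  o = λ q → occurrences q P
  i : Z4 → Z4 → ℕ
  i q p = bit (eqZ4 q p)
  one : ∀ p → i 0F p + i 1F p + i 2F p + i 3F p ≡ 1
  one 0F = refl
  one 1F = refl
  one 2F = refl
  one 3F = refl

sorting : (P : Vec Z4 m) → P ≋ canon (occurrences 0F P) (occurrences 1F P) (occurrences 2F P) m
sorting [] = ≋-refl []
sorting (p ∷ P) = insert p (≋-cons p (sorting P))
  where
  o = λ q → occurrences q P
  bound : o 0F + o 1F + o 2F ≤ _
  bound = ≤-trans (m≤m+n _ (o 3F)) (≤-reflexive (occurrences-total P))
  bound₁ = ≤-trans (m≤m+n _ (o 2F)) bound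
  insert : ∀ p → (p ∷ P) ≋ (p ∷ canon (o 0F) (o 1F) (o 2F) _) →
           (p ∷ P) ≋ canon (occurrences 0F (p ∷ P)) (occurrences 1F (p ∷ P)) (occurrences 2F (p ∷ P)) _
  insert 0F e = e
  insert 1F e = ≋-trans e (insert₁ (o 0F) (o 1F) (o 2F) (≤-trans (m≤m+n _ (o 1F)) bound₁))
  insert 2F e = ≋-trans e (insert₂ (o 0F) (o 1F) (o 2F) bound₁)
  insert 3F e = ≋-trans e (insert₃ (o 0F) (o 1F) (o 2F) bound)

canon-occurrences : ∀ a b c e {m} → a + (b + (c + e)) ≡ m → ∀ (f : Z4 → ℕ) →
                    cnt f (canon a b c m) ≡ a * f 0F + (b * f 1F + (c * f 2F + e * f 3F))
canon-occurrences zero zero zero zero refl f = refl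
canon-occurrences zero zero zero (suc e) refl f = cong (f 3F +_) (canon-occurrences 0 0 0 e refl f)
canon-occurrences zero zero (suc c) e refl f = trans (cong (f 2F +_) (canon-occurrences 0 0 c e refl f)) (sym (+-assoc (f 2F) _ _))
canon-occurrences zero (suc b) c e refl f = trans (cong (f 1F +_) (canon-occurrences 0 b c e refl f)) (sym (+-assoc (f 1F) _ _))
canon-occurrences (suc a) b c e refl f = trans (cong (f 0F +_) (canon-occurrences a b c e refl f)) (sym (+-assoc (f 0F) _ _))

-- Multisets of patterns up to relabelling

bump : ℕ × A → ℕ × A
bump (k , x) = suc k , x

level₀ : A → ℕ × A
level₀ x = 0 , x

stack : List A → List (ℕ × A) → List (ℕ × A)
stack xs ys = map level₀ xs ++ map bump ys

stack-length : (xs : List A) (ys : List (ℕ × A)) → length (stack xs ys) ≡ length xs + length ys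
stack-length xs ys = trans (length-++ (map level₀ xs) {map bump ys}) (cong₂ _+_ (length-map level₀ xs) (length-map bump ys))

stack-unique : {xs : List A} {ys : List (ℕ × A)} → Unique xs → Unique ys → Unique (stack xs ys)
stack-unique u v = UP.++⁺ (UP.map⁺ (λ { refl → refl }) u) (UP.map⁺ (λ { refl → refl }) v) λ (p , q) → disjoint p q
  where
  disjoint : ∀ {z xs ys} → z ∈ map level₀ xs → z ∈ map bump ys → ⊥
  disjoint p q with ∈-map⁻ _ p | ∈-map⁻ _ q
  ... | _ , _ , refl | _ , _ , ()

stack-sound : (P : ℕ → A → Set) {xs : List A} {ys : List (ℕ × A)} → (∀ {x} → x ∈ xs → P 0 x) → (∀ {k x} → (k , x) ∈ ys → P (suc k) x) →
              ∀ {k x} → (k , x) ∈ stack xs ys → P k x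
stack-sound P {xs} f g p with ∈-++⁻ (map level₀ xs) p
... | inj₁ q with ∈-map⁻ _ q
...   | _ , x∈ , refl = f x∈
stack-sound P f g p | inj₂ q with ∈-map⁻ _ q
...   | _ , y∈ , refl = g y∈

stack-zero : {xs : List A} {ys : List (ℕ × A)} {x : A} → x ∈ xs → (0 , x) ∈ stack xs ys
stack-zero x∈ = ∈-++⁺ˡ (∈-map⁺ level₀ x∈)

stack-suc : {xs : List A} {ys : List (ℕ × A)} {k : ℕ} {x : A} → (k , x) ∈ ys → (suc k , x) ∈ stack xs ys
stack-suc {xs = xs} y∈ = ∈-++⁺ʳ (map level₀ xs) (∈-map⁺ bump y∈)

-- Relabelling sorts the multiplicities of patterns 1, 2, 3; their successive differences `u`, `v`,
-- `w` satisfy 3w + 2v + u + a = m. The lists enumerate the solutions, one part size at a time, so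
-- the class numbers are the coefficients of 1/((1-x)²(1-x²)(1-x³)).
parts₁ : ℕ → List (ℕ × ℕ)
parts₁ zero = stack (0 ∷ []) []
parts₁ (suc m) = stack (suc m ∷ []) (parts₁ m)

parts₂ : ℕ → List (ℕ × ℕ × ℕ)
parts₂ 0 = stack (parts₁ 0) []
parts₂ 1 = stack (parts₁ 1) []
parts₂ (suc (suc m)) = stack (parts₁ (2 + m)) (parts₂ m)

parts₃ : ℕ → List (ℕ × ℕ × ℕ × ℕ)
parts₃ 0 = stack (parts₂ 0) []
parts₃ 1 = stack (parts₂ 1) []
parts₃ 2 = stack (parts₂ 2) []
parts₃ (suc (suc (suc m))) = stack (parts₂ (3 + m)) (parts₃ m)

parts₁-unique : ∀ m → Unique (parts₁ m)
parts₁-unique zero = stack-unique ([] ∷ []) []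
parts₁-unique (suc m) = stack-unique ([] ∷ []) (parts₁-unique m)

parts₂-unique : ∀ m → Unique (parts₂ m)
parts₂-unique 0 = stack-unique (parts₁-unique 0) []
parts₂-unique 1 = stack-unique (parts₁-unique 1) []
parts₂-unique (suc (suc m)) = stack-unique (parts₁-unique (2 + m)) (parts₂-unique m)

parts₃-unique : ∀ m → Unique (parts₃ m)
parts₃-unique 0 = stack-unique (parts₂-unique 0) []
parts₃-unique 1 = stack-unique (parts₂-unique 1) []
parts₃-unique 2 = stack-unique (parts₂-unique 2) []
parts₃-unique (suc (suc (suc m))) = stack-unique (parts₂-unique (3 + m)) (parts₃-unique m)

weight₁ : ℕ × ℕ → ℕ
weight₁ (u , a) = u + a

weight₂ : ℕ × ℕ × ℕ → ℕ
weight₂ (v , x) = v * 2 + weight₁ x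

weight₃ : ℕ × ℕ × ℕ × ℕ → ℕ
weight₃ (w , x) = w * 3 + weight₂ x

parts₁-sound : ∀ m {x} → x ∈ parts₁ m → weight₁ x ≡ m
parts₁-sound zero = stack-sound (λ u a → weight₁ (u , a) ≡ 0) {0 ∷ []} {[]} (λ { (here refl) → refl }) λ ()
parts₁-sound (suc m) = stack-sound (λ u a → weight₁ (u , a) ≡ suc m) {suc m ∷ []} {parts₁ m} (λ { (here refl) → refl }) (λ p → cong suc (parts₁-sound m p))

parts₂-sound : ∀ m {x} → x ∈ parts₂ m → weight₂ x ≡ m
parts₂-sound 0 = stack-sound (λ v x → weight₂ (v , x) ≡ 0) (parts₁-sound 0) λ ()
parts₂-sound 1 = stack-sound (λ v x → weight₂ (v , x) ≡ 1) (parts₁-sound 1) λ ()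
parts₂-sound (suc (suc m)) = stack-sound (λ v x → weight₂ (v , x) ≡ 2 + m) (parts₁-sound (2 + m)) (λ p → cong (2 +_) (parts₂-sound m p))

parts₃-sound : ∀ m {x} → x ∈ parts₃ m → weight₃ x ≡ m
parts₃-sound 0 = stack-sound (λ w x → weight₃ (w , x) ≡ 0) (parts₂-sound 0) λ ()
parts₃-sound 1 = stack-sound (λ w x → weight₃ (w , x) ≡ 1) (parts₂-sound 1) λ ()
parts₃-sound 2 = stack-sound (λ w x → weight₃ (w , x) ≡ 2) (parts₂-sound 2) λ ()
parts₃-sound (suc (suc (suc m))) = stack-sound (λ w x → weight₃ (w , x) ≡ 3 + m) (parts₂-sound (3 + m)) (λ p → cong (3 +_) (parts₃-sound m p))

parts₁-complete : ∀ m x → weight₁ x ≡ m → x ∈ parts₁ m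
parts₁-complete zero (zero , a) refl = stack-zero {xs = 0 ∷ []} {[]} (here refl)
parts₁-complete (suc m) (zero , a) refl = stack-zero {xs = suc m ∷ []} {parts₁ m} (here refl)
parts₁-complete (suc m) (suc u , a) e = stack-suc {xs = suc m ∷ []} (parts₁-complete m (u , a) (suc-injective e))

parts₂-complete : ∀ m x → weight₂ x ≡ m → x ∈ parts₂ m
parts₂-complete 0 (zero , x) e = stack-zero (parts₁-complete 0 x e)
parts₂-complete 1 (zero , x) e = stack-zero (parts₁-complete 1 x e)
parts₂-complete (suc (suc m)) (zero , x) e = stack-zero (parts₁-complete (2 + m) x e)
parts₂-complete (suc (suc m)) (suc v , x) e = stack-suc (parts₂-complete m (v , x) (+-cancelˡ-≡ 2 _ _ e))

parts₃-complete : ∀ m x → weight₃ x ≡ m → x ∈ parts₃ m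
parts₃-complete 0 (zero , x) e = stack-zero (parts₂-complete 0 x e)
parts₃-complete 1 (zero , x) e = stack-zero (parts₂-complete 1 x e)
parts₃-complete 2 (zero , x) e = stack-zero (parts₂-complete 2 x e)
parts₃-complete (suc (suc (suc m))) (zero , x) e = stack-zero (parts₂-complete (3 + m) x e)
parts₃-complete (suc (suc (suc m))) (suc w , x) e = stack-suc (parts₃-complete m (w , x) (+-cancelˡ-≡ 3 _ _ e))

-- Pattern 0 has multiplicity a, the others have multiplicities w ≤ v + w ≤ u + v + w.
patterns : (m : ℕ) → ℕ × ℕ × ℕ × ℕ → Vec Z4 m
patterns m (w , v , u , a) = canon a (u + (v + w)) (v + w) m

module _ {m : ℕ} {w v u a : ℕ} (wt : weight₃ (w , v , u , a) ≡ m) where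

  open +-*-Solver

  private
    counts : ∀ f → cnt f (patterns m (w , v , u , a)) ≡ a * f 0F + ((u + (v + w)) * f 1F + ((v + w) * f 2F + w * f 3F))
    counts = canon-occurrences a (u + (v + w)) (v + w) w (trans
      (solve 4 (λ w v u a → a :+ ((u :+ (v :+ w)) :+ ((v :+ w) :+ w)) := w :* con 3 :+ (v :* con 2 :+ (u :+ a))) refl w v u a) wt)

    specials-count : ∀ i → specials i (patterns m (w , v , u , a)) ≡ cnt (λ p → bit (eqZ4 0F p) + bit (eqZ4 i p)) (patterns m (w , v , u , a))
    specials-count i = sym (cnt-+ (λ p → bit (eqZ4 0F p)) (λ p → bit (eqZ4 i p)) (patterns m (w , v , u , a)))

  specials₁ : specials 1F (patterns m (w , v , u , a)) ≡ u + (v + (w + a))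
  specials₁ = trans (specials-count 1F) (trans (counts _)
    (solve 4 (λ w v u a → a :* con 1 :+ ((u :+ (v :+ w)) :* con 1 :+ ((v :+ w) :* con 0 :+ w :* con 0)) := u :+ (v :+ (w :+ a))) refl w v u a))

  specials₂ : specials 2F (patterns m (w , v , u , a)) ≡ v + (w + a)
  specials₂ = trans (specials-count 2F) (trans (counts _)
    (solve 4 (λ w v u a → a :* con 1 :+ ((u :+ (v :+ w)) :* con 0 :+ ((v :+ w) :* con 1 :+ w :* con 0)) := v :+ (w :+ a)) refl w v u a))

  specials₃ : specials 3F (patterns m (w , v , u , a)) ≡ w + a
  specials₃ = trans (specials-count 3F) (trans (counts _)
    (solve 4 (λ w v u a → a :* con 1 :+ ((u :+ (v :+ w)) :* con 0 :+ ((v :+ w) :* con 0 :+ w :* con 1)) := w :+ a) refl w v u a))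

module _ {x₁ x₂ x₃ y₁ y₂ y₃ : ℕ} (same : ∀ (g : ℕ → ℕ) → g x₁ + (g x₂ + g x₃) ≡ g y₁ + (g y₂ + g y₃)) where

  occurs : (g : ℕ → ℕ) → 1 ≤ g x₁ + (g x₂ + g x₃) → g y₁ ≡ 0 → g y₂ ≡ 0 → g y₃ ≡ 0 → ⊥
  occurs g pos e₁ e₂ e₃ = contradiction (subst (1 ≤_) (trans (same g) (cong₂ _+_ e₁ (cong₂ _+_ e₂ e₃))) pos) λ ()

  top-≤ : y₂ ≤ y₁ → y₃ ≤ y₂ → x₁ ≤ y₁
  top-≤ y₂≤y₁ y₃≤y₂ = ≮⇒≥ λ y₁<x₁ → occurs (λ z → bit (x₁ ≤ᵇ z))
    (≤-trans (≤-reflexive (cong bit (sym (Equivalence.to T-≡ (≤⇒≤ᵇ (≤-refl {x₁})))))) (m≤m+n _ _))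
    (none y₁<x₁) (none (≤-<-trans y₂≤y₁ y₁<x₁)) (none (≤-<-trans y₃≤y₂ (≤-<-trans y₂≤y₁ y₁<x₁)))
    where
    none : ∀ {z} → z < x₁ → bit (x₁ ≤ᵇ z) ≡ 0
    none {z} lt = cong bit (T-ext {x₁ ≤ᵇ z} {false} (λ t → <⇒≱ lt (≤ᵇ⇒≤ x₁ z t)) λ ())

  bottom-≤ : y₂ ≤ y₁ → y₃ ≤ y₂ → y₃ ≤ x₃
  bottom-≤ y₂≤y₁ y₃≤y₂ = ≮⇒≥ λ x₃<y₃ → occurs (λ z → bit (z ≤ᵇ x₃))
    (≤-trans (≤-trans (≤-reflexive (cong bit (sym (Equivalence.to T-≡ (≤⇒≤ᵇ (≤-refl {x₃})))))) (m≤n+m _ (bit (x₂ ≤ᵇ x₃)))) (m≤n+m _ (bit (x₁ ≤ᵇ x₃))))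
    (none (<-≤-trans x₃<y₃ (≤-trans y₃≤y₂ y₂≤y₁))) (none (<-≤-trans x₃<y₃ y₃≤y₂)) (none x₃<y₃)
    where
    none : ∀ {z} → x₃ < z → bit (z ≤ᵇ x₃) ≡ 0
    none {z} lt = cong bit (T-ext {z ≤ᵇ x₃} {false} (λ t → <⇒≱ lt (≤ᵇ⇒≤ z x₃ t)) λ ())

-- The last hypothesis says that the two multisets agree. Threshold indicators compare the extremes,
-- and `g = id` then gives the middle.
decreasing-≡ : ∀ {x₁ x₂ x₃ y₁ y₂ y₃} → x₂ ≤ x₁ → x₃ ≤ x₂ → y₂ ≤ y₁ → y₃ ≤ y₂ →
               (∀ (g : ℕ → ℕ) → g x₁ + (g x₂ + g x₃) ≡ g y₁ + (g y₂ + g y₃)) → x₁ ≡ y₁ × x₂ ≡ y₂ × x₃ ≡ y₃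
decreasing-≡ {x₁} {x₂} {x₃} {y₁} {y₂} {y₃} p q r s same = top , middle , bottom
  where
  back : ∀ (g : ℕ → ℕ) → g y₁ + (g y₂ + g y₃) ≡ g x₁ + (g x₂ + g x₃)
  back g = sym (same g)
  top : x₁ ≡ y₁
  top = ≤-antisym (top-≤ same r s) (top-≤ back p q)
  bottom : x₃ ≡ y₃
  bottom = ≤-antisym (bottom-≤ back p q) (bottom-≤ same r s)
  middle : x₂ ≡ y₂
  middle = +-cancelʳ-≡ x₃ x₂ y₂ (trans (+-cancelˡ-≡ x₁ _ _ (trans (same id) (cong (_+ (y₂ + y₃)) (sym top)))) (cong (y₂ +_) (sym bottom)))

-- The three special counts in decreasing order determine `u`, `v` and `w + a`; the common weight
-- `m` then separates `w` from `a`.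
patterns-inequivalent : 1 ≤ m + n → ∀ t t′ → weight₃ t ≡ m → weight₃ t′ ≡ m →
                        Equivalent (codeOfPatterns (patterns m t) n) (codeOfPatterns (patterns m t′) n) → t ≡ t′
patterns-inequivalent {m} {n} pos (w , v , u , a) (w′ , v′ , u′ , a′) wt wt′ eq = conclude (decreasing-≡
    (m≤n+m _ u) (m≤n+m _ v) (m≤n+m _ u′) (m≤n+m _ v′) same)
  where
  P = patterns m (w , v , u , a)
  P′ = patterns m (w′ , v′ , u′ , a′)
  same : ∀ (g : ℕ → ℕ) → g (u + (v + (w + a))) + (g (v + (w + a)) + g (w + a)) ≡
                         g (u′ + (v′ + (w′ + a′))) + (g (v′ + (w′ + a′)) + g (w′ + a′))
  same g = trans (sym (triple {w} {v} {u} {a} wt)) (trans (+-cancelˡ-≡ (g 0) _ _ (*-cancelˡ-≡ _ _ 4 (trans (sym (profile-patterns {n = n} g P))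
      (trans (profile-equivalent g (proj₁ (patterns-full pos P)) (proj₁ (patterns-full pos P′)) eq) (profile-patterns {n = n} g P′))))) (triple {w′} {v′} {u′} {a′} wt′))
    where
    triple : ∀ {w v u a} → weight₃ (w , v , u , a) ≡ m → let Q = patterns m (w , v , u , a) in
             g (specials 1F Q) + (g (specials 2F Q) + g (specials 3F Q)) ≡ g (u + (v + (w + a))) + (g (v + (w + a)) + g (w + a))
    triple {w} {v} {u} {a} wt = cong₂ _+_ (cong g (specials₁ {w = w} {v} {u} {a} wt))
      (cong₂ _+_ (cong g (specials₂ {w = w} {v} {u} {a} wt)) (cong g (specials₃ {w = w} {v} {u} {a} wt)))
  conclude : u + (v + (w + a)) ≡ u′ + (v′ + (w′ + a′)) × v + (w + a) ≡ v′ + (w′ + a′) × w + a ≡ w′ + a′ →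
             (w , v , u , a) ≡ (w′ , v′ , u′ , a′)
  conclude (e₁ , e₂ , e₃) with +-cancelʳ-≡ (v + (w + a)) u u′ (trans e₁ (cong (u′ +_) (sym e₂)))
                             | +-cancelʳ-≡ (w + a) v v′ (trans e₂ (cong (v′ +_) (sym e₃)))
  ... | refl | refl with *-cancelʳ-≡ w w′ 2 (+-cancelʳ-≡ (v * 2 + (u + (w + a))) (w * 2) (w′ * 2) (trans (regroup w v u a)
                           (trans (trans wt (sym wt′)) (trans (sym (regroup w′ v u a′)) (cong (λ z → w′ * 2 + (v * 2 + (u + z))) (sym e₃))))))
    where
    open +-*-Solver
    regroup : ∀ w v u a → w * 2 + (v * 2 + (u + (w + a))) ≡ weight₃ (w , v , u , a)
    regroup = solve 4 (λ w v u a → w :* con 2 :+ (v :* con 2 :+ (u :+ (w :+ a))) := w :* con 3 :+ (v :* con 2 :+ (u :+ a))) refl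
  ... | refl with +-cancelˡ-≡ w a a′ e₃
  ... | refl = refl

-- Reduction of codes of distance 2m+n to patterns

vD-saturated : (d : A → A → ℕ) (c : ℕ) → (∀ x y → d x y ≤ c) → (xs ys : Vec A n) → n * c ≤ vD d xs ys →
               ∀ i → c ≤ d (lookup xs i) (lookup ys i)
vD-saturated {n = suc n} d c le (x ∷ xs) (y ∷ ys) tot zero = +-cancelʳ-≤ (n * c) c (d x y) (≤-trans tot (+-monoʳ-≤ (d x y) (vD-≤ d c le xs ys)))
vD-saturated d c le (x ∷ xs) (y ∷ ys) tot (suc i) =
  vD-saturated d c le xs ys (+-cancelˡ-≤ c _ _ (≤-trans tot (+-monoˡ-≤ _ (le x y)))) i

Distant : (Z4 → Vertex m n) → Set
Distant {m} {n} w = ∀ k l → k ≢ l → 2 * m + n ≤ δ (w k) (w l)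

module _ {m n : ℕ} (w : Z4 → Vertex m n) (far : Distant w) where

  private
    shParts : ∀ k l → k ≢ l → m * 2 ≤ vD shD (proj₁ (w k)) (proj₁ (w l))
    shParts k l ne = +-cancelʳ-≤ n _ _ (≤-trans (≤-reflexive (cong (_+ n) (*-comm m 2))) (≤-trans (far k l ne)
      (+-monoʳ-≤ (vD shD (proj₁ (w k)) (proj₁ (w l))) (≤-trans (vD-≤ kD 1 kD≤1 (proj₂ (w k)) (proj₂ (w l))) (≤-reflexive (*-identityʳ n))))))

    kParts : ∀ k l → k ≢ l → n * 1 ≤ vD kD (proj₂ (w k)) (proj₂ (w l))
    kParts k l ne = +-cancelˡ-≤ (m * 2) _ _ (≤-trans (≤-reflexive (cong₂ _+_ (*-comm m 2) (*-identityʳ n))) (≤-trans (far k l ne)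
      (+-monoˡ-≤ (vD kD (proj₂ (w k)) (proj₂ (w l))) (vD-≤ shD 2 shD≤2 (proj₁ (w k)) (proj₁ (w l))))))

    shAlign : ∀ i → Σ[ g ∈ ShAut ] Σ[ p ∈ Z4 ] (∀ k → ShAut.fun g (lookup (proj₁ (w k)) i) ≡ std p k)
    shAlign i = coclique (λ k → lookup (proj₁ (w k)) i)
      (λ k l ne → vD-saturated shD 2 shD≤2 (proj₁ (w k)) (proj₁ (w l)) (shParts k l ne) i)

    kAlign : ∀ j → Σ[ p ∈ Permutation′ 4 ] (∀ k → p ⟨$⟩ʳ lookup (proj₂ (w k)) j ≡ k)
    kAlign j = finish (ordering (apart 0F 1F (λ ())) (apart 0F 2F (λ ())) (apart 1F 2F (λ ())))
      where
      h : Z4 → Z4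
      h k = lookup (proj₂ (w k)) j
      apart : ∀ k l → k ≢ l → h k ≢ h l
      apart k l ne e = contradiction (≤-trans (vD-saturated kD 1 kD≤1 (proj₂ (w k)) (proj₂ (w l)) (kParts k l ne) j)
        (≤-reflexive (trans (cong (kD (h k)) (sym e)) (kD-refl (h k))))) λ ()
      finish : Σ[ p ∈ Permutation′ 4 ] (p ⟨$⟩ʳ h 0F ≡ 0F × p ⟨$⟩ʳ h 1F ≡ 1F × p ⟨$⟩ʳ h 2F ≡ 2F) →
               Σ[ p ∈ Permutation′ 4 ] (∀ k → p ⟨$⟩ʳ h k ≡ k)
      finish (p , p₀ , p₁ , p₂) = p , λ { 0F → p₀ ; 1F → p₁ ; 2F → p₂ ; 3F → fourth _
        (λ e → apart 3F 0F (λ ()) (perm-injective p (trans e (sym p₀))))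
        (λ e → apart 3F 1F (λ ()) (perm-injective p (trans e (sym p₁))))
        (λ e → apart 3F 2F (λ ()) (perm-injective p (trans e (sym p₂)))) }

  alignedPatterns : Vec Z4 m
  alignedPatterns = tabulate (λ i → proj₁ (proj₂ (shAlign i)))

  alignment : Transform m n
  alignment = record { θ = λ i → proj₁ (shAlign i) ; σ = λ j → proj₁ (kAlign j) ; π = Perm.id ; ρ = Perm.id }

  alignment-word : ∀ k → apply alignment (w k) ≡ word alignedPatterns n k
  alignment-word k = cong₂ _,_
    (trans (tabulate-cong (λ i → proj₂ (proj₂ (shAlign i)) k)) (VP.tabulate-∘ (λ p → std p k) (λ i → proj₁ (proj₂ (shAlign i)))))
    (trans (tabulate-cong (λ j → proj₂ (kAlign j) k)) (constant n))
    where
    constant : ∀ n → tabulate (λ _ → k) ≡ V.replicate n k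
    constant zero = refl
    constant (suc n) = cong (k ∷_) (constant n)

  -- Invariance of `β` reveals the special counts on the original words, so the labels can be sorted
  -- before anything is aligned.
  alignment-specials : ∀ i → 0F ≢ i → specials (pairing 0F i) alignedPatterns ≡ β (w 0F) (w i)
  alignment-specials i ne = trans (sym (β-word {n = n} alignedPatterns 0F i ne))
    (trans (sym (cong₂ β (alignment-word 0F) (alignment-word i))) (β-apply alignment (w 0F) (w i)))

rearranged : {P Q : Vec Z4 m} → P ≋ Q → codeOfPatterns P n ⟶ codeOfPatterns Q n
rearranged {m} {n} {P} {Q} (rearrange π agrees) = t , into
  where
  t : Transform m n
  t = record { θ = λ _ → autId ; σ = λ _ → Perm.id ; π = π ; ρ = Perm.id }
  image : ∀ k → apply t (word P n k) ≡ word Q n k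
  image k = cong₂ _,_
    (begin
      tabulate (λ i → lookup (V.map (λ p → std p k) P) (π ⟨$⟩ʳ i)) ≡⟨ tabulate-cong (λ i → trans (VP.lookup-map (π ⟨$⟩ʳ i) (λ p → std p k) P) (cong (λ p → std p k) (sym (agrees i)))) ⟩
      tabulate (λ i → std (lookup Q i) k)                          ≡⟨ VP.tabulate-∘ (λ p → std p k) (lookup Q) ⟩
      V.map (λ p → std p k) (tabulate (lookup Q))                  ≡⟨ cong (V.map (λ p → std p k)) (tabulate∘lookup Q) ⟩
      V.map (λ p → std p k) Q                                      ∎)
    (tabulate∘lookup (V.replicate n k))
    where open ≡-Reasoning
  into : ∀ {x} → x ∈ codeOfPatterns P n → apply t x ∈ codeOfPatterns Q n
  into x∈ with ∈-map⁻ (word P n) x∈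
  ... | k , k∈ , refl = subst (_∈ codeOfPatterns Q n) (sym (image k)) (∈-map⁺ (word Q n) k∈)

-- Label 0 may stay fixed: the permutations of the labels 1, 2, 3 already induce all permutations of
-- the three matchings.
decreasing : (s : Z4 → ℕ) → Σ[ τ ∈ Permutation′ 4 ] (τ ⟨$⟩ʳ 0F ≡ 0F × s (τ ⟨$⟩ʳ 2F) ≤ s (τ ⟨$⟩ʳ 1F) × s (τ ⟨$⟩ʳ 3F) ≤ s (τ ⟨$⟩ʳ 2F))
decreasing s with ≤-total (s 2F) (s 1F) | ≤-total (s 3F) (s 2F) | ≤-total (s 3F) (s 1F)
... | inj₁ yx | inj₁ zy | _ = Perm.id , refl , yx , zy
... | inj₁ yx | inj₂ yz | inj₁ zx = Perm.transpose 2F 3F , refl , zx , yz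
... | inj₁ yx | inj₂ yz | inj₂ xz = Perm.transpose 2F 3F ∘ₚ Perm.transpose 1F 3F , refl , xz , yx
... | inj₂ xy | inj₁ zy | inj₁ zx = Perm.transpose 1F 2F , refl , xy , zx
... | inj₂ xy | inj₁ zy | inj₂ xz = Perm.transpose 2F 3F ∘ₚ Perm.transpose 1F 2F , refl , zy , xz
... | inj₂ xy | inj₂ yz | _ = Perm.transpose 1F 3F , refl , yz , xy

unique-lookup : {xs : List A} → Unique xs → ∀ i j → L.lookup xs i ≡ L.lookup xs j → i ≡ j
unique-lookup (x∉ ∷ u) zero zero e = refl
unique-lookup (x∉ ∷ u) zero (suc j) e = contradiction e (All.lookup x∉ (∈-lookup j))
unique-lookup (x∉ ∷ u) (suc i) zero e = contradiction (sym e) (All.lookup x∉ (∈-lookup i))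
unique-lookup (x∉ ∷ u) (suc i) (suc j) e = cong suc (unique-lookup u i j e)

patterns-complete : (C : Code m n) → Full (2 * m + n) 4 C → ∃[ t ] (t ∈ parts₃ m × C ⟶ codeOfPatterns (patterns m t) n)
patterns-complete {m} {n} C@(_ ∷ _ ∷ _ ∷ _ ∷ []) (u , s , refl) = conclude (decreasing (λ i → β (w 0F) (w i)))
  where
  w : Z4 → Vertex m n
  w = L.lookup C
  far-w : Distant w
  far-w k l k≢l = s (∈-lookup k) (∈-lookup l) (k≢l ∘ unique-lookup u k l)
  conclude : Σ[ τ ∈ Permutation′ 4 ] (τ ⟨$⟩ʳ 0F ≡ 0F × β (w 0F) (w (τ ⟨$⟩ʳ 2F)) ≤ β (w 0F) (w (τ ⟨$⟩ʳ 1F)) ×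
                                       β (w 0F) (w (τ ⟨$⟩ʳ 3F)) ≤ β (w 0F) (w (τ ⟨$⟩ʳ 2F))) →
             ∃[ t ] (t ∈ parts₃ m × C ⟶ codeOfPatterns (patterns m t) n)
  conclude (τ , τ₀ , le₁ , le₂) = t , parts₃-complete m t weight , ⟶-trans {C′ = codeOfPatterns P n} (alignment w′ far′ , into)
      (subst (λ Q → codeOfPatterns P n ⟶ codeOfPatterns Q n) canonical (rearranged (sorting P)))
    where
    w′ : Z4 → Vertex m n
    w′ k = w (τ ⟨$⟩ʳ k)
    far′ : Distant w′
    far′ k l k≢l = far-w _ _ (k≢l ∘ perm-injective τ)
    P = alignedPatterns w′ far′
    o : Z4 → ℕ
    o q = occurrences q P
    special-count : ∀ i → 0F ≢ i → specials (pairing 0F i) P ≡ β (w 0F) (w (τ ⟨$⟩ʳ i))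
    special-count i ne = trans (alignment-specials w′ far′ i ne) (cong (λ k → β (w k) (w′ i)) τ₀)
    -- The special counts exceed the multiplicities by the same amount `o 0F`, so both are in the
    -- same order.
    o₂≤o₁ : o 2F ≤ o 1F
    o₂≤o₁ = +-cancelˡ-≤ (o 0F) _ _ (≤-trans (≤-reflexive (special-count 2F (λ ()))) (≤-trans le₁ (≤-reflexive (sym (special-count 1F (λ ()))))))
    o₃≤o₂ : o 3F ≤ o 2F
    o₃≤o₂ = +-cancelˡ-≤ (o 0F) _ _ (≤-trans (≤-reflexive (special-count 3F (λ ()))) (≤-trans le₂ (≤-reflexive (sym (special-count 2F (λ ()))))))
    t : ℕ × ℕ × ℕ × ℕ
    t = o 3F , o 2F ∸ o 3F , o 1F ∸ o 2F , o 0F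
    v+w : o 2F ∸ o 3F + o 3F ≡ o 2F
    v+w = m∸n+n≡m o₃≤o₂
    u+v+w : o 1F ∸ o 2F + (o 2F ∸ o 3F + o 3F) ≡ o 1F
    u+v+w = trans (cong (o 1F ∸ o 2F +_) v+w) (m∸n+n≡m o₂≤o₁)
    canonical : canon (o 0F) (o 1F) (o 2F) m ≡ patterns m t
    canonical = sym (cong₂ (λ b c → canon (o 0F) b c m) u+v+w v+w)
    weight : weight₃ t ≡ m
    weight = begin
      weight₃ t                               ≡⟨ regroup (o 3F) (o 2F ∸ o 3F) (o 1F ∸ o 2F) (o 0F) ⟩
      o 0F + (o 1F ∸ o 2F + (o 2F ∸ o 3F + o 3F)) + (o 2F ∸ o 3F + o 3F) + o 3F ≡⟨ cong₂ (λ b c → o 0F + b + c + o 3F) u+v+w v+w ⟩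
      o 0F + o 1F + o 2F + o 3F               ≡⟨ occurrences-total P ⟩
      m                                       ∎
      where
      open ≡-Reasoning
      open +-*-Solver
      regroup : ∀ w v u a → weight₃ (w , v , u , a) ≡ a + (u + (v + w)) + (v + w) + w
      regroup = solve 4 (λ w v u a → w :* con 3 :+ (v :* con 2 :+ (u :+ a)) := a :+ (u :+ (v :+ w)) :+ (v :+ w) :+ w) refl
    into : ∀ {x} → x ∈ C → apply (alignment w′ far′) x ∈ codeOfPatterns P n
    into {x} x∈ = subst (λ y → apply (alignment w′ far′) y ∈ codeOfPatterns P n)
      (trans (cong w (Perm.inverseʳ τ)) (sym (AnyP.lookup-index x∈)))
      (subst (_∈ codeOfPatterns P n) (sym (alignment-word w′ far′ (τ ⟨$⟩ˡ Any.index x∈))) (∈-map⁺ (word P n) (∈-allFin _)))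

classes₁ : 1 ≤ m + n → NumClasses m n 1 (length (parts₃ m))
classes₁ {m} {n} pos = classification (sym (m+n∸n≡m (2 * m + n) 1)) code (λ i → patterns-MDS pos (patterns m (tuple i)))
    inequivalent complete
  where
  tuple : Fin (length (parts₃ m)) → ℕ × ℕ × ℕ × ℕ
  tuple = L.lookup (parts₃ m)
  code : Fin (length (parts₃ m)) → Code m n
  code i = codeOfPatterns (patterns m (tuple i)) n
  sound : ∀ i → weight₃ (tuple i) ≡ m
  sound i = parts₃-sound m (∈-lookup i)
  inequivalent : ∀ i j → i ≢ j → ¬ Equivalent (code i) (code j)
  inequivalent i j i≢j eq = i≢j (unique-lookup (parts₃-unique m) i j (patterns-inequivalent pos _ _ (sound i) (sound j) eq))
  complete : ∀ C → Full (2 * m + n) 4 C → ∃[ i ] (C ⟶ code i)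
  complete C full = conclude (patterns-complete C full)
    where
    conclude : ∃[ t ] (t ∈ parts₃ m × C ⟶ codeOfPatterns (patterns m t) n) → ∃[ i ] (C ⟶ code i)
    conclude (t , t∈ , to) = Any.index t∈ , subst (λ t → C ⟶ codeOfPatterns (patterns m t) n) (AnyP.lookup-index t∈) to

-- The number of classes for distance 2m+n

parts₁-length : ∀ m → length (parts₁ m) ≡ suc m
parts₁-length zero = refl
parts₁-length (suc m) = trans (stack-length (suc m ∷ []) (parts₁ m)) (cong suc (parts₁-length m))

-- These are the quarter squares: passing from `m` to `2 + m` adds `3 + m` and leaves the residue
-- unchanged.
parts₂-length : ∀ m → 4 * length (parts₂ m) + m % 2 ≡ (2 + m) * (2 + m)
parts₂-length 0 = refl
parts₂-length 1 = refl
parts₂-length (suc (suc m)) = begin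
  4 * length (parts₂ (2 + m)) + m % 2                            ≡⟨ cong (λ l → 4 * l + m % 2) (stack-length (parts₁ (2 + m)) (parts₂ m)) ⟩
  4 * (length (parts₁ (2 + m)) + length (parts₂ m)) + m % 2      ≡⟨ cong (λ l → 4 * (l + length (parts₂ m)) + m % 2) (parts₁-length (2 + m)) ⟩
  4 * (3 + m + length (parts₂ m)) + m % 2                        ≡⟨ solve 3 (λ m l r → con 4 :* (con 3 :+ m :+ l) :+ r := con 4 :* (con 3 :+ m) :+ (con 4 :* l :+ r)) refl m (length (parts₂ m)) (m % 2) ⟩
  4 * (3 + m) + (4 * length (parts₂ m) + m % 2)                  ≡⟨ cong (4 * (3 + m) +_) (parts₂-length m) ⟩
  4 * (3 + m) + (2 + m) * (2 + m)                                ≡⟨ solve 1 (λ m → con 4 :* (con 3 :+ m) :+ (con 2 :+ m) :* (con 2 :+ m) := (con 4 :+ m) :* (con 4 :+ m)) refl m ⟩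
  (4 + m) * (4 + m)                                              ∎
  where
  open ≡-Reasoning
  open +-*-Solver

parity : ∀ m → m % 2 + (3 + m) % 2 ≡ 1
parity 0 = refl
parity 1 = refl
parity (suc (suc m)) = parity m

-- 72 times the claimed value of L, without the two residues.
cubic : ℕ → ℕ
cubic m = 2 * m ^ 3 + (3 * (7 * m ^ 2) + (6 * (11 * m) + 72))

-- A step of 3 keeps `m % 3` but flips the parity. The 9 added on both sides is 9(p + q), with the
-- parities before and after the step, which avoids subtraction.
parts₃-length : ∀ m → 72 * length (parts₃ m) + (9 * (m % 2) + 8 * (m % 3)) ≡ cubic m
parts₃-length 0 = refl
parts₃-length 1 = refl
parts₃-length 2 = refl
parts₃-length (suc (suc (suc m))) = +-cancelʳ-≡ 9 _ _ (begin
  72 * length (parts₃ (3 + m)) + (9 * q + 8 * r) + 9     ≡⟨ cong₂ (λ l k → 72 * l + (9 * q + 8 * r) + 9 * k) (stack-length (parts₂ (3 + m)) (parts₃ m)) (sym (parity m)) ⟩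
  72 * (Q + L) + (9 * q + 8 * r) + 9 * (p + q)           ≡⟨ solve 5 (λ Q L p q r → con 72 :* (Q :+ L) :+ (con 9 :* q :+ con 8 :* r) :+ con 9 :* (p :+ q) :=
                                                              con 18 :* (con 4 :* Q :+ q) :+ (con 72 :* L :+ (con 9 :* p :+ con 8 :* r))) refl Q L p q r ⟩
  18 * (4 * Q + q) + (72 * L + (9 * p + 8 * r))          ≡⟨ cong₂ (λ a b → 18 * a + b) (parts₂-length (3 + m)) (parts₃-length m) ⟩
  18 * ((5 + m) * (5 + m)) + cubic m                     ≡⟨ solve 1 (λ m → con 18 :* ((con 5 :+ m) :* (con 5 :+ m)) :+ cubicₛ m := cubicₛ (con 3 :+ m) :+ con 9) refl m ⟩
  cubic (3 + m) + 9                                      ∎)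
  where
  open ≡-Reasoning
  open +-*-Solver
  Q = length (parts₂ (3 + m))
  L = length (parts₃ m)
  p = m % 2
  q = (3 + m) % 2
  r = m % 3
  cubicₛ : Polynomial 1 → Polynomial 1
  cubicₛ m = con 2 :* (m :* (m :* (m :* con 1))) :+ (con 3 :* (con 7 :* (m :* (m :* con 1))) :+ (con 6 :* (con 11 :* m) :+ con 72))

module _ where

  open import Data.Integer using (+_)
  open import Data.Rational using (_/_)
  open ℚᵘ using (mkℚᵘ; *≡*)

  rational : ∀ L M₃ M₂ M₁ P R → 72 * L + (9 * P + 8 * R) ≡ 2 * M₃ + (3 * M₂ + (6 * M₁ + 72)) →
             + L / 1 ≡ ((((+ M₃ / 36 Q.+ + M₂ / 24) Q.+ + M₁ / 12) Q.+ Q.1ℚ) Q.- + P / 8) Q.- + R / 9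
  rational L M₃ M₂ M₁ P R e = QP.toℚᵘ-injective (begin
    Q.toℚᵘ (+ L / 1) ≈⟨ frac L 0 ⟩
    mkℚᵘ (+ L) 0     ≈⟨ *≡* integral ⟩
    ((((mkℚᵘ (+ M₃) 35 ℚᵘ.+ mkℚᵘ (+ M₂) 23) ℚᵘ.+ mkℚᵘ (+ M₁) 11) ℚᵘ.+ mkℚᵘ (+ 1) 0) ℚᵘ.+ ℚᵘ.- mkℚᵘ (+ P) 7) ℚᵘ.+ ℚᵘ.- mkℚᵘ (+ R) 8
      ≈⟨ minus-step (minus-step (plus-step (plus-step (plus-step (frac M₃ 35) (frac M₂ 23)) (frac M₁ 11)) ℚᵘP.≃-refl) (frac P 7)) (frac R 8) ⟨
    Q.toℚᵘ (((((+ M₃ / 36 Q.+ + M₂ / 24) Q.+ + M₁ / 12) Q.+ Q.1ℚ) Q.- + P / 8) Q.- + R / 9) ∎)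
    where
    open ℚᵘP.≃-Reasoning
    frac : ∀ n d → Q.toℚᵘ (+ n / suc d) ℚᵘ.≃ mkℚᵘ (+ n) d
    frac n d = QP.toℚᵘ-fromℚᵘ (mkℚᵘ (+ n) d)
    plus-step : ∀ {p q p′ q′} → Q.toℚᵘ p ℚᵘ.≃ p′ → Q.toℚᵘ q ℚᵘ.≃ q′ → Q.toℚᵘ (p Q.+ q) ℚᵘ.≃ p′ ℚᵘ.+ q′
    plus-step {p} {q} f g = ℚᵘP.≃-trans (QP.toℚᵘ-homo-+ p q) (ℚᵘP.+-cong f g)
    minus-step : ∀ {p q p′ q′} → Q.toℚᵘ p ℚᵘ.≃ p′ → Q.toℚᵘ q ℚᵘ.≃ q′ → Q.toℚᵘ (p Q.- q) ℚᵘ.≃ p′ ℚᵘ.+ ℚᵘ.- q′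
    minus-step {p} {q} f g = plus-step {p} {Q.- q} f (ℚᵘP.≃-trans (QP.toℚᵘ-homo‿- q) (ℚᵘP.-‿cong g))
    lift : ∀ a b → + (a * b) ≡ + a ℤ.* + b
    lift = ℤP.pos-*
    eℤ : + 72 ℤ.* + L ℤ.+ (+ 9 ℤ.* + P ℤ.+ + 8 ℤ.* + R) ≡ + 2 ℤ.* + M₃ ℤ.+ (+ 3 ℤ.* + M₂ ℤ.+ (+ 6 ℤ.* + M₁ ℤ.+ + 72))
    eℤ = trans (sym (cong₂ ℤ._+_ (lift 72 L) (cong₂ ℤ._+_ (lift 9 P) (lift 8 R))))
      (trans (cong +_ e) (cong₂ ℤ._+_ (lift 2 M₃) (cong₂ ℤ._+_ (lift 3 M₂) (cong (ℤ._+ + 72) (lift 6 M₁)))))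
    open ℤSolver.+-*-Solver
    -- 746496 = 36 · 24 · 12 · 8 · 9 is the denominator produced by unnormalised addition, and 10368
    -- = 746496 / 72.
    integral : + L ℤ.* + 746496 ≡
      ((((((+ M₃ ℤ.* + 24 ℤ.+ + M₂ ℤ.* + 36) ℤ.* + 12 ℤ.+ + M₁ ℤ.* + 864) ℤ.* + 1 ℤ.+ + 1 ℤ.* + 10368) ℤ.* + 8 ℤ.+ (ℤ.- + P) ℤ.* + 10368) ℤ.* + 9)
        ℤ.+ (ℤ.- + R) ℤ.* + 82944) ℤ.* + 1
    integral = trans
      (solve 3 (λ l p r → l :* con (+ 746496) := con (+ 10368) :* (con (+ 72) :* l :+ (con (+ 9) :* p :+ con (+ 8) :* r)) :- con (+ 10368) :* (con (+ 9) :* p :+ con (+ 8) :* r)) refl (+ L) (+ P) (+ R))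
      (trans (cong (λ z → + 10368 ℤ.* z ℤ.- + 10368 ℤ.* (+ 9 ℤ.* + P ℤ.+ + 8 ℤ.* + R)) eℤ)
      (solve 5 (λ a b c p r → con (+ 10368) :* (con (+ 2) :* a :+ (con (+ 3) :* b :+ (con (+ 6) :* c :+ con (+ 72)))) :- con (+ 10368) :* (con (+ 9) :* p :+ con (+ 8) :* r) :=
        ((((((a :* con (+ 24) :+ b :* con (+ 36)) :* con (+ 12) :+ c :* con (+ 864)) :* con (+ 1) :+ con (+ 1) :* con (+ 10368)) :* con (+ 8) :+ (:- p) :* con (+ 10368)) :* con (+ 9))
          :+ (:- r) :* con (+ 82944)) :* con (+ 1)) refl (+ M₃) (+ M₂) (+ M₁) (+ P) (+ R)))

-- The Plotkin bound

module ℤSum = Sum ℤP.+-*-commutativeSemiring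

∑ℤ-embed : (xs : List A) (f : A → ℕ) → ℤSum.∑ xs (λ x → ℤ.+ f x) ≡ ℤ.+ ∑ xs f
∑ℤ-embed [] f = refl
∑ℤ-embed (x ∷ xs) f = cong (ℤ._+_ (ℤ.+ f x)) (∑ℤ-embed xs f)

∑ℤ-nonneg : (xs : List A) (f : A → ℤ) → (∀ x → ℤ.+ 0 ℤ.≤ f x) → ℤ.+ 0 ℤ.≤ ℤSum.∑ xs f
∑ℤ-nonneg [] f p = ℤP.≤-refl
∑ℤ-nonneg (x ∷ xs) f p = ℤP.+-mono-≤ (p x) (∑ℤ-nonneg xs f p)

square-nonneg : ∀ i → ℤ.+ 0 ℤ.≤ i ℤ.* i
square-nonneg (ℤ.+ n) = subst (ℤ.+ 0 ℤ.≤_) (ℤP.pos-* n n) (ℤ.+≤+ z≤n)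
square-nonneg ℤ.-[1+ n ] = ℤ.+≤+ z≤n

-- The kernel w - 4 d is positive semidefinite: four times it is the Gram matrix of the functions f v.
module Kernel (d : A → A → ℕ) (w : ℕ) (vs : List A) (f : A → A → ℤ)
              (gram : ∀ x y → ℤSum.∑ vs (λ v → f v x ℤ.* f v y) ℤ.+ ℤ.+ (16 * d x y) ≡ ℤ.+ (4 * w)) where

  -- Summed over all pairs of words, the Gram part turns into a sum of squares over `vs`, which is
  -- nonnegative.
  average : (C : List B) (g : B → A) → 4 * ∑ C (λ x → ∑ C (λ y → d (g x) (g y))) ≤ w * (length C * length C)
  average C g = *-cancelˡ-≤ 4 (≤-trans (≤-reflexive lower) (≤-trans (ℤP.drop‿+≤+ bound) (≤-reflexive upper)))
    where
    S = ℤSum.∑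
    s : A → ℤ
    s v = S C (λ x → f v (g x))
    total : S vs (λ v → s v ℤ.* s v) ℤ.+ ℤ.+ ∑ C (λ x → ∑ C (λ y → 16 * d (g x) (g y))) ≡ ℤ.+ ∑ C (λ x → ∑ C (λ y → 4 * w))
    total = begin
      S vs (λ v → s v ℤ.* s v) ℤ.+ ℤ.+ ∑ C (λ x → ∑ C (λ y → 16 * d (g x) (g y)))
        ≡⟨ cong₂ ℤ._+_ gram-sum (trans (sym (∑ℤ-embed C _)) (ℤSum.∑-cong C (λ x → sym (∑ℤ-embed C _)))) ⟩
      S C (λ x → S C (λ y → S vs (λ v → f v (g x) ℤ.* f v (g y)))) ℤ.+ S C (λ x → S C (λ y → ℤ.+ (16 * d (g x) (g y))))
        ≡⟨ ℤSum.∑-⊕ C _ _ ⟨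
      S C (λ x → S C (λ y → S vs (λ v → f v (g x) ℤ.* f v (g y))) ℤ.+ S C (λ y → ℤ.+ (16 * d (g x) (g y))))
        ≡⟨ ℤSum.∑-cong C (λ x → trans (sym (ℤSum.∑-⊕ C _ _)) (ℤSum.∑-cong C (λ y → gram (g x) (g y)))) ⟩
      S C (λ x → S C (λ y → ℤ.+ (4 * w)))
        ≡⟨ trans (ℤSum.∑-cong C (λ x → ∑ℤ-embed C _)) (∑ℤ-embed C _) ⟩
      ℤ.+ ∑ C (λ x → ∑ C (λ y → 4 * w)) ∎
      where
      open ≡-Reasoning
      gram-sum : S vs (λ v → s v ℤ.* s v) ≡ S C (λ x → S C (λ y → S vs (λ v → f v (g x) ℤ.* f v (g y))))
      gram-sum = begin
        S vs (λ v → s v ℤ.* s v)                                        ≡⟨ ℤSum.∑-cong vs (λ v → ℤSum.∑-product C C (λ x → f v (g x)) (λ y → f v (g y))) ⟨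
        S vs (λ v → S C (λ x → S C (λ y → f v (g x) ℤ.* f v (g y))))    ≡⟨ ℤSum.∑-swap vs C _ ⟩
        S C (λ x → S vs (λ v → S C (λ y → f v (g x) ℤ.* f v (g y))))    ≡⟨ ℤSum.∑-cong C (λ x → ℤSum.∑-swap vs C _) ⟩
        S C (λ x → S C (λ y → S vs (λ v → f v (g x) ℤ.* f v (g y))))    ∎
    bound : ℤ.+ ∑ C (λ x → ∑ C (λ y → 16 * d (g x) (g y))) ℤ.≤ ℤ.+ ∑ C (λ x → ∑ C (λ y → 4 * w))
    bound = ℤP.≤-trans (ℤP.≤-reflexive (sym (ℤP.+-identityˡ _)))
      (ℤP.≤-trans (ℤP.+-monoˡ-≤ _ (∑ℤ-nonneg vs (λ v → s v ℤ.* s v) (λ v → square-nonneg (s v)))) (ℤP.≤-reflexive total))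
    lower : 4 * (4 * ∑ C (λ x → ∑ C (λ y → d (g x) (g y)))) ≡ ∑ C (λ x → ∑ C (λ y → 16 * d (g x) (g y)))
    lower = trans (sym (*-assoc 4 4 (∑ C (λ x → ∑ C (λ y → d (g x) (g y)))))) (trans (sym (∑-⊗ˡ C 16 (λ x → ∑ C (λ y → d (g x) (g y)))))
      (∑-cong C (λ x → sym (∑-⊗ˡ C 16 (λ y → d (g x) (g y))))))
    upper : ∑ C (λ x → ∑ C (λ y → 4 * w)) ≡ 4 * (w * (length C * length C))
    upper = trans (∑-cong C (λ x → ∑-const C (4 * w))) (trans (∑-const C _)
      (solve 2 (λ l w → l :* (l :* (con 4 :* w)) := con 4 :* (w :* (l :* l))) refl (length C) w))
      where open +-*-Solver

  average-vec : (C : List B) (g : B → Vec A n) → 4 * ∑ C (λ x → ∑ C (λ y → vD d (g x) (g y))) ≤ n * w * (length C * length C)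
  average-vec {n = zero} C g = ≤-reflexive (cong (4 *_) (trans (∑-cong C (λ x → trans (∑-cong C (λ y → empty (g x) (g y))) (∑-0 C))) (∑-0 C)))
    where
    empty : (xs ys : Vec A 0) → vD d xs ys ≡ 0
    empty [] [] = refl
  average-vec {n = suc n} C g = begin
    4 * ∑ C (λ x → ∑ C (λ y → vD d (g x) (g y)))
      ≡⟨ cong (4 *_) (trans (∑-cong C (λ x → trans (∑-cong C (λ y → split (g x) (g y))) (∑-⊕ C _ _))) (∑-⊕ C _ _)) ⟩
    4 * (∑ C (λ x → ∑ C (λ y → d (head (g x)) (head (g y)))) + ∑ C (λ x → ∑ C (λ y → vD d (tail (g x)) (tail (g y)))))
      ≡⟨ *-distribˡ-+ 4 (∑ C (λ x → ∑ C (λ y → d (head (g x)) (head (g y))))) _ ⟩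
    4 * ∑ C (λ x → ∑ C (λ y → d (head (g x)) (head (g y)))) + 4 * ∑ C (λ x → ∑ C (λ y → vD d (tail (g x)) (tail (g y))))
      ≤⟨ +-mono-≤ (average C (head ∘ g)) (average-vec C (tail ∘ g)) ⟩
    w * (length C * length C) + n * w * (length C * length C)
      ≡⟨ *-distribʳ-+ (length C * length C) w (n * w) ⟨
    suc n * w * (length C * length C) ∎
    where
    open ≤-Reasoning
    split : ∀ {n} (xs ys : Vec A (suc n)) → vD d xs ys ≡ d (head xs) (head ys) + vD d (tail xs) (tail ys)
    split (_ ∷ _) (_ ∷ _) = refl

-- The values 3, 1, -1 at distances 0, 1, 2 are a multiple of the projection onto the eigenspace of
-- eigenvalue 2, so as a matrix it has square 8 times itself: 24 - 16d = 8(3 - 2d). Likewise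
-- `kKernel` belongs to eigenvalue -1 of K₄, with factor 4.
shKernel : ShV → ShV → ℤ
shKernel x y = ℤ.+ 3 ℤ.- ℤ.+ (2 * shD x y)

kKernel : Z4 → Z4 → ℤ
kKernel x y = ℤ.+ 3 ℤ.- ℤ.+ (4 * kD x y)

does⇒≡ : {i j : ℤ} → T (Dec.does (i ℤ.≟ j)) → i ≡ j
does⇒≡ {i} {j} t with i ℤ.≟ j
... | yes p = p

abstract
  sh-gram : ∀ x y → ℤSum.∑ allSh (λ v → shKernel v x ℤ.* shKernel v y) ℤ.+ ℤ.+ (16 * shD x y) ≡ ℤ.+ 24
  sh-gram x y = does⇒≡ (∀Sh² (λ x y → Dec.does (ℤSum.∑ allSh (λ v → shKernel v x ℤ.* shKernel v y) ℤ.+ ℤ.+ (16 * shD x y) ℤ.≟ ℤ.+ 24)) tt x y)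

  k-gram : ∀ x y → ℤSum.∑ (allFin 4) (λ v → kKernel v x ℤ.* kKernel v y) ℤ.+ ℤ.+ (16 * kD x y) ≡ ℤ.+ 12
  k-gram x y = does⇒≡ (∀Z4² (λ x y → Dec.does (ℤSum.∑ (allFin 4) (λ v → kKernel v x ℤ.* kKernel v y) ℤ.+ ℤ.+ (16 * kD x y) ℤ.≟ ℤ.+ 12)) tt x y)

module ShKernel = Kernel shD 6 allSh shKernel sh-gram
module KKernel = Kernel kD 3 (allFin 4) kKernel k-gram

-- Only an entry equal to `x` may contribute less than `d`, and there is at most one.
∑-apart : (d : ℕ) (f : A → ℕ) (x : A) (ys : List A) → Unique ys → DecidableEquality A → (∀ {y} → y ∈ ys → x ≢ y → d ≤ f y) →
          length ys * d ≤ ∑ ys f + d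
∑-apart d f x [] u _≟_ far = z≤n
∑-apart d f x (y ∷ ys) (y∉ ∷ u) _≟_ far with x ≟ y
... | no x≢y = ≤-trans (+-mono-≤ (far (here refl) x≢y) (∑-apart d f x ys u _≟_ (far ∘ there))) (≤-reflexive (sym (+-assoc (f y) _ _)))
... | yes refl = ≤-trans (≤-reflexive (+-comm d _)) (+-monoˡ-≤ d (≤-trans (all-far ys y∉ (far ∘ there)) (m≤n+m _ (f y))))
  where
  all-far : ∀ zs → All (y ≢_) zs → (∀ {z} → z ∈ zs → x ≢ z → d ≤ f z) → length zs * d ≤ ∑ zs f
  all-far [] [] far = z≤n
  all-far (z ∷ zs) (y≢z ∷ y∉) far = +-mono-≤ (far (here refl) y≢z) (all-far zs y∉ (far ∘ there))

-- Compares two estimates of the sum of all distances, the lower one from the separation and the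
-- upper one from the kernels, where a Shrikhande coordinate weighs as much as two K₄ coordinates.
plotkin : ∀ {d M} {C : Code m n} → Full d M C → 4 * (M * (M * d)) ≤ 3 * (2 * m + n) * (M * M) + 4 * (M * d)
plotkin {m} {n} {d} {C = C} (u , s , refl) = begin
  4 * (M * (M * d))                                          ≡⟨ cong (4 *_) (∑-const C (M * d)) ⟨
  4 * ∑ C (λ x → M * d)                                      ≤⟨ *-monoʳ-≤ 4 (∑-mono C (λ {x} x∈ → ∑-apart d (δ x) x C u _≟V_ (s x∈))) ⟩
  4 * ∑ C (λ x → ∑ C (δ x) + d)                              ≡⟨ cong (4 *_) (trans (∑-⊕ C _ _) (cong₂ _+_ refl (∑-const C d))) ⟩
  4 * (∑ C (λ x → ∑ C (δ x)) + M * d)                        ≡⟨ *-distribˡ-+ 4 (∑ C (λ x → ∑ C (δ x))) (M * d) ⟩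
  4 * ∑ C (λ x → ∑ C (δ x)) + 4 * (M * d)                    ≡⟨ cong (λ z → 4 * z + 4 * (M * d)) (trans (∑-cong C (λ x → ∑-⊕ C _ _)) (∑-⊕ C _ _)) ⟩
  4 * (∑ C (λ x → ∑ C (λ y → vD shD (proj₁ x) (proj₁ y))) + ∑ C (λ x → ∑ C (λ y → vD kD (proj₂ x) (proj₂ y)))) + 4 * (M * d)
                                                             ≡⟨ cong (_+ 4 * (M * d)) (*-distribˡ-+ 4 (∑ C (λ x → ∑ C (λ y → vD shD (proj₁ x) (proj₁ y)))) _) ⟩
  4 * ∑ C (λ x → ∑ C (λ y → vD shD (proj₁ x) (proj₁ y))) + 4 * ∑ C (λ x → ∑ C (λ y → vD kD (proj₂ x) (proj₂ y))) + 4 * (M * d)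
                                                             ≤⟨ +-monoˡ-≤ _ (+-mono-≤ (ShKernel.average-vec C proj₁) (KKernel.average-vec C proj₂)) ⟩
  m * 6 * (M * M) + n * 3 * (M * M) + 4 * (M * d)            ≡⟨ cong (_+ 4 * (M * d)) (solve 3 (λ m n q → m :* con 6 :* q :+ n :* con 3 :* q := con 3 :* (con 2 :* m :+ n) :* q) refl m n (M * M)) ⟩
  3 * (2 * m + n) * (M * M) + 4 * (M * d)                    ∎
  where
  open ≤-Reasoning
  open +-*-Solver
  M = length C

-- Sphere packing

-- Coefficients of degree 0 and 1 of a distance enumerator. By `e₀-+` and `e₁-+` they multiply like
-- polynomials modulo degree 2, so sphere sizes in a product follow from its factors.
e₀ e₁ : ℕ → ℕ
e₀ t = bit (t ≡ᵇ 0)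
e₁ t = bit (t ≡ᵇ 1)

e₀-+ : ∀ a b → e₀ (a + b) ≡ e₀ a * e₀ b
e₀-+ zero b = sym (+-identityʳ _)
e₀-+ (suc a) b = refl

e₁-+ : ∀ a b → e₁ (a + b) ≡ e₁ a * e₀ b + e₀ a * e₁ b
e₁-+ zero b = sym (+-identityʳ _)
e₁-+ (suc zero) zero = refl
e₁-+ (suc zero) (suc b) = refl
e₁-+ (suc (suc a)) b = refl

module _ (d : A → A → ℕ) (r : ℕ) (xs : List A)
         (self : ∀ x → ∑ xs (λ a → e₀ (d x a)) ≡ 1) (nbrs : ∀ x → ∑ xs (λ a → e₁ (d x a)) ≡ r) where

  ∑-words : (f : Vec A (suc n) → ℕ) → ∑ (words xs (suc n)) f ≡ ∑ xs (λ a → ∑ (words xs n) (λ v → f (a ∷ v)))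
  ∑-words {n} f = trans (∑-concatMap (λ x → map (x ∷_) (words xs n)) xs f) (∑-cong xs (λ a → ∑-map (a ∷_) (words xs n) f))

  words-self : (v : Vec A n) → ∑ (words xs n) (e₀ ∘ vD d v) ≡ 1
  words-self [] = refl
  words-self {n = suc n} (x ∷ v) = begin
    ∑ (words xs (suc n)) (e₀ ∘ vD d (x ∷ v))                                ≡⟨ ∑-words _ ⟩
    ∑ xs (λ a → ∑ (words xs n) (λ u → e₀ (d x a + vD d v u)))               ≡⟨ ∑-cong xs (λ a → ∑-cong (words xs n) (λ u → e₀-+ (d x a) _)) ⟩
    ∑ xs (λ a → ∑ (words xs n) (λ u → e₀ (d x a) * e₀ (vD d v u)))          ≡⟨ ∑-product xs (words xs n) _ _ ⟩
    ∑ xs (λ a → e₀ (d x a)) * ∑ (words xs n) (e₀ ∘ vD d v)                  ≡⟨ cong₂ _*_ (self x) (words-self v) ⟩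
    1                                                                       ∎
    where open ≡-Reasoning

  words-nbrs : (v : Vec A n) → ∑ (words xs n) (e₁ ∘ vD d v) ≡ n * r
  words-nbrs [] = refl
  words-nbrs {n = suc n} (x ∷ v) = begin
    ∑ (words xs (suc n)) (e₁ ∘ vD d (x ∷ v))                                ≡⟨ ∑-words _ ⟩
    ∑ xs (λ a → ∑ (words xs n) (λ u → e₁ (d x a + vD d v u)))               ≡⟨ ∑-cong xs (λ a → trans (∑-cong (words xs n) (λ u → e₁-+ (d x a) _)) (∑-⊕ (words xs n) _ _)) ⟩
    ∑ xs (λ a → ∑ (words xs n) (λ u → e₁ (d x a) * e₀ (vD d v u)) + ∑ (words xs n) (λ u → e₀ (d x a) * e₁ (vD d v u)))
                                                                            ≡⟨ trans (∑-⊕ xs _ _) (cong₂ _+_ (∑-product xs (words xs n) _ _) (∑-product xs (words xs n) _ _)) ⟩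
    ∑ xs (λ a → e₁ (d x a)) * ∑ (words xs n) (e₀ ∘ vD d v) + ∑ xs (λ a → e₀ (d x a)) * ∑ (words xs n) (e₁ ∘ vD d v)
                                                                            ≡⟨ cong₂ _+_ (cong₂ _*_ (nbrs x) (words-self v)) (cong₂ _*_ (self x) (words-nbrs v)) ⟩
    r * 1 + 1 * (n * r)                                                     ≡⟨ cong₂ _+_ (*-identityʳ r) (*-identityˡ (n * r)) ⟩
    suc n * r                                                               ∎
    where open ≡-Reasoning

words-length : (xs : List A) (n : ℕ) → length (words xs n) ≡ length xs ^ n
words-length xs zero = refl
words-length xs (suc n) = begin
  length (words xs (suc n))                                 ≡⟨ ∑-1 (words xs (suc n)) ⟨
  ∑ (words xs (suc n)) (λ _ → 1)                            ≡⟨ ∑-concatMap (λ x → map (x ∷_) (words xs n)) xs (λ _ → 1) ⟩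
  ∑ xs (λ x → ∑ (map (x ∷_) (words xs n)) (λ _ → 1))        ≡⟨ ∑-cong xs (λ x → trans (∑-1 (map (x ∷_) (words xs n))) (trans (length-map (x ∷_) (words xs n)) (words-length xs n))) ⟩
  ∑ xs (λ _ → length xs ^ n)                                ≡⟨ ∑-const xs _ ⟩
  length xs ^ suc n                                         ∎
  where open ≡-Reasoning

∑-cartesian : (xs : List A) (ys : List B) (f : A × B → ℕ) → ∑ (cartesianProduct xs ys) f ≡ ∑ xs (λ x → ∑ ys (λ y → f (x , y)))
∑-cartesian [] ys f = refl
∑-cartesian (x ∷ xs) ys f = trans (∑-++ (map (x ,_) ys) _ f) (cong₂ _+_ (∑-map (x ,_) ys f) (∑-cartesian xs ys f))

vertices-length : ∀ m n → length (vertices m n) ≡ 16 ^ m * 4 ^ n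
vertices-length m n = begin
  length (vertices m n)                                                     ≡⟨ ∑-1 (vertices m n) ⟨
  ∑ (vertices m n) (λ _ → 1)                                                ≡⟨ ∑-cartesian (words allSh m) (words (allFin 4) n) _ ⟩
  ∑ (words allSh m) (λ _ → ∑ (words (allFin 4) n) (λ _ → 1))                ≡⟨ ∑-cong (words allSh m) (λ _ → trans (∑-1 (words (allFin 4) n)) (words-length (allFin 4) n)) ⟩
  ∑ (words allSh m) (λ _ → 4 ^ n)                                           ≡⟨ ∑-const (words allSh m) (4 ^ n) ⟩
  length (words allSh m) * 4 ^ n                                            ≡⟨ cong (_* 4 ^ n) (words-length allSh m) ⟩
  16 ^ m * 4 ^ n                                                            ∎
  where open ≡-Reasoning

abstract
  sh-self : ∀ x → ∑ allSh (λ a → e₀ (shD x a)) ≡ 1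
  sh-self x = ≡ᵇ⇒≡ _ _ (∀Sh (λ x → ∑ allSh (λ a → e₀ (shD x a)) ≡ᵇ 1) tt x)
  sh-nbrs : ∀ x → ∑ allSh (λ a → e₁ (shD x a)) ≡ 6
  sh-nbrs x = ≡ᵇ⇒≡ _ _ (∀Sh (λ x → ∑ allSh (λ a → e₁ (shD x a)) ≡ᵇ 6) tt x)
  k-self : ∀ x → ∑ (allFin 4) (λ a → e₀ (kD x a)) ≡ 1
  k-self x = ≡ᵇ⇒≡ _ _ (∀Z4 (λ x → ∑ (allFin 4) (λ a → e₀ (kD x a)) ≡ᵇ 1) tt x)
  k-nbrs : ∀ x → ∑ (allFin 4) (λ a → e₁ (kD x a)) ≡ 3
  k-nbrs x = ≡ᵇ⇒≡ _ _ (∀Z4 (λ x → ∑ (allFin 4) (λ a → e₁ (kD x a)) ≡ᵇ 3) tt x)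

ball : Vertex m n → Vertex m n → ℕ
ball x v = e₀ (δ x v) + e₁ (δ x v)

ball-size : (x : Vertex m n) → ∑ (vertices m n) (ball x) ≡ 1 + 3 * (2 * m + n)
ball-size {m} {n} (s , h) = begin
  ∑ (vertices m n) (ball (s , h))                    ≡⟨ ∑-⊕ (vertices m n) _ _ ⟩
  ∑ (vertices m n) (e₀ ∘ δ (s , h)) + ∑ (vertices m n) (e₁ ∘ δ (s , h))
    ≡⟨ cong₂ _+_ (∑-cartesian X Y _) (∑-cartesian X Y _) ⟩
  ∑ X (λ a → ∑ Y (λ b → e₀ (vD shD s a + vD kD h b))) + ∑ X (λ a → ∑ Y (λ b → e₁ (vD shD s a + vD kD h b)))
    ≡⟨ cong₂ _+_ (∑-cong X (λ a → ∑-cong Y (λ b → e₀-+ (vD shD s a) _)))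
                 (trans (∑-cong X (λ a → trans (∑-cong Y (λ b → e₁-+ (vD shD s a) _)) (∑-⊕ Y _ _))) (∑-⊕ X _ _)) ⟩
  ∑ X (λ a → ∑ Y (λ b → e₀ (vD shD s a) * e₀ (vD kD h b))) +
    (∑ X (λ a → ∑ Y (λ b → e₁ (vD shD s a) * e₀ (vD kD h b))) + ∑ X (λ a → ∑ Y (λ b → e₀ (vD shD s a) * e₁ (vD kD h b))))
    ≡⟨ cong₂ _+_ (∑-product X Y _ _) (cong₂ _+_ (∑-product X Y _ _) (∑-product X Y _ _)) ⟩
  x₀ * y₀ + (x₁ * y₀ + x₀ * y₁)
    ≡⟨ cong₂ _+_ (cong₂ _*_ x₀≡ y₀≡) (cong₂ _+_ (cong₂ _*_ x₁≡ y₀≡) (cong₂ _*_ x₀≡ y₁≡)) ⟩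
  1 * 1 + (m * 6 * 1 + 1 * (n * 3))
    ≡⟨ solve 2 (λ m n → con 1 :* con 1 :+ (m :* con 6 :* con 1 :+ con 1 :* (n :* con 3)) := con 1 :+ con 3 :* (con 2 :* m :+ n)) refl m n ⟩
  1 + 3 * (2 * m + n) ∎
  where
  open ≡-Reasoning
  open +-*-Solver
  X = words allSh m
  Y = words (allFin 4) n
  x₀ = ∑ X (e₀ ∘ vD shD s)
  x₁ = ∑ X (e₁ ∘ vD shD s)
  y₀ = ∑ Y (e₀ ∘ vD kD h)
  y₁ = ∑ Y (e₁ ∘ vD kD h)
  x₀≡ : x₀ ≡ 1
  x₀≡ = words-self shD 6 allSh sh-self sh-nbrs s
  x₁≡ : x₁ ≡ m * 6
  x₁≡ = words-nbrs shD 6 allSh sh-self sh-nbrs s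
  y₀≡ : y₀ ≡ 1
  y₀≡ = words-self kD 3 (allFin 4) k-self k-nbrs h
  y₁≡ : y₁ ≡ n * 3
  y₁≡ = words-nbrs kD 3 (allFin 4) k-self k-nbrs h

ball-≤1 : (x v : Vertex m n) → ball x v ≤ 1
ball-≤1 x v with δ x v
... | zero = ≤-refl
... | suc zero = ≤-refl
... | suc (suc _) = z≤n

ball-near : (x v : Vertex m n) → 1 ≤ ball x v → δ x v ≤ 1
ball-near x v p with δ x v
... | zero = z≤n
... | suc zero = ≤-refl

∑-≤1 : (f : A → ℕ) (xs : List A) → Unique xs → (∀ x → f x ≤ 1) → (∀ {x y} → x ∈ xs → y ∈ xs → 1 ≤ f x → 1 ≤ f y → x ≡ y) → ∑ xs f ≤ 1
∑-≤1 f [] u le one = z≤n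
∑-≤1 f (x ∷ xs) (x∉ ∷ u) le one with f x in eq | le x
... | zero | _ = ∑-≤1 f xs u le (λ p q → one (there p) (there q))
... | suc zero | _ = s≤s (≤-trans (∑-mono xs vanish) (≤-reflexive (∑-0 xs)))
  where
  vanish : ∀ {y} → y ∈ xs → f y ≤ 0
  vanish {y} y∈ with f y in eq′
  ... | zero = z≤n
  ... | suc _ = contradiction (one (here refl) (there y∈) (≤-reflexive (sym eq)) (subst (1 ≤_) (sym eq′) (s≤s z≤n))) (All.lookup x∉ y∈)
... | suc (suc _) | s≤s ()

sphere-packing : {C : Code m n} → Unique C → Sep 3 C → length C * (1 + 3 * (2 * m + n)) ≤ 16 ^ m * 4 ^ n
sphere-packing {m} {n} {C} u s = begin
  length C * (1 + 3 * (2 * m + n))                ≡⟨ ∑-const C _ ⟨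
  ∑ C (λ _ → 1 + 3 * (2 * m + n))                 ≡⟨ ∑-cong C ball-size ⟨
  ∑ C (λ x → ∑ (vertices m n) (ball x))           ≡⟨ ∑-swap C (vertices m n) ball ⟩
  ∑ (vertices m n) (λ v → ∑ C (λ x → ball x v))   ≤⟨ ∑-mono (vertices m n) (λ {v} _ → ∑-≤1 (λ x → ball x v) C u (λ x → ball-≤1 x v) (disjoint v)) ⟩
  ∑ (vertices m n) (λ _ → 1)                      ≡⟨ ∑-1 (vertices m n) ⟩
  length (vertices m n)                           ≡⟨ vertices-length m n ⟩
  16 ^ m * 4 ^ n                                  ∎
  where
  open ≤-Reasoning
  disjoint : ∀ v {x y} → x ∈ C → y ∈ C → 1 ≤ ball x v → 1 ≤ ball y v → x ≡ y
  disjoint v {x} {y} x∈ y∈ p q = sep-injective s x∈ y∈ (s≤s (≤-trans (δ-tri x v y)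
    (+-mono-≤ (ball-near x v p) (subst (_≤ 1) (δ-sym y v) (ball-near y v q)))))

∈-take : (k : ℕ) (xs : List A) {x : A} → x ∈ take k xs → x ∈ xs
∈-take (suc k) (y ∷ xs) (here refl) = here refl
∈-take (suc k) (y ∷ xs) (there p) = there (∈-take k xs p)

truncate : ∀ {d M} (C : Code m n) → Unique C → Sep d C → M ≤ length C → Full d M (take M C)
truncate {d = d} {M} C u s l = UP.take⁺ M u , sep-⊆ {d = d} (∈-take M C) s , trans (length-take M C) (m≤n⇒m⊓n≡m l)

coclique-bound : (C : Code 2 0) → Unique C → Sep 4 C → length C ≤ 4
-- Five words would give 4 · 5 · 5 · 4 = 400 on the left of `plotkin` and 3 · 4 · 25 + 4 · 5 · 4 =
-- 380 on the right.
coclique-bound C u s = ≮⇒≥ λ 4<l → from-no (400 ≤? 380) (plotkin {d = 4} (truncate {d = 4} C u s 4<l))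

fibre : ShV → Code (suc m) n → Code m n
fibre v C = map tailSh (filter (T? ∘ eqSh v ∘ headSh) C)

∈-fibre : ∀ {v} {C : Code (suc m) n} {x} → x ∈ fibre v C → consSh v x ∈ C
∈-fibre {v = v} {C} p with ∈-map⁻ tailSh p
... | y@(w ∷ _ , _) , y∈ , refl with ∈-filter⁻ (T? ∘ eqSh v ∘ headSh) {xs = C} y∈
... | y∈C , e with eqSh⇒≡ v w e
... | refl = y∈C

fibre-separated : ∀ v d {C : Code (suc m) n} → Unique C → Sep (suc d) C → Unique (fibre v C) × Sep (suc d) (fibre v C)
fibre-separated v d {C} u s = contract tailSh (filter P? C) 0 d le (UP.filter⁺ P? u)
    (sep-⊆ (λ {x} p → proj₁ (∈-filter⁻ P? {xs = C} p)) s)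
  where
  P? = T? ∘ eqSh v ∘ headSh
  le : ∀ {x y} → x ∈ filter P? C → y ∈ filter P? C → δ x y ≤ δ (tailSh x) (tailSh y)
  le {x} {y} x∈ y∈ = ≤-reflexive (trans (δ-splitSh x y) (cong (_+ δ (tailSh x) (tailSh y)) (begin
    shD (headSh x) (headSh y) ≡⟨ cong (λ z → shD z (headSh y)) (eqSh⇒≡ v (headSh x) (proj₂ (∈-filter⁻ P? {xs = C} x∈))) ⟨
    shD v (headSh y)          ≡⟨ cong (λ z → shD z (headSh y)) (eqSh⇒≡ v (headSh y) (proj₂ (∈-filter⁻ P? {xs = C} y∈))) ⟩
    shD (headSh y) (headSh y) ≡⟨ shD-refl (headSh y) ⟩
    0                         ∎)))
    where open ≡-Reasoning

once-Sh : ∀ v → 1 ≤ ∑ allSh (λ a → bit (eqSh a v))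
once-Sh v = ≤ᵇ⇒≤ _ _ (∀Sh (λ v → 1 ≤ᵇ ∑ allSh (λ a → bit (eqSh a v))) tt v)

-- Codes in D(3,0) with 64 words and distance 4

fibre-full : {C : Code 3 0} → Unique C → Sep 4 C → 64 ≤ length C → ∀ v → Full 4 4 (fibre v C)
fibre-full {C} u s l v = proj₁ (sep v) , proj₂ (sep v) , ≤-antisym (bound v)
    (≤-trans (full-fibre allSh (λ a x → eqSh a (headSh x)) (once-Sh ∘ headSh) C 4
                (λ a → ≤-trans (≤-reflexive (sym (length-map tailSh (part a)))) (bound a)) l (∈-allSh v))
             (≤-reflexive (sym (length-map tailSh (part v)))))
  where
  part : ShV → Code 3 0
  part a = filter (T? ∘ eqSh a ∘ headSh) C
  sep : ∀ a → Unique (fibre a C) × Sep 4 (fibre a C)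
  sep a = fibre-separated a 3 u s
  bound : ∀ a → length (fibre a C) ≤ 4
  bound a = coclique-bound (fibre a C) (proj₁ (sep a)) (proj₂ (sep a))

-- The cosets of the four subgroups of order 4 that avoid the connection set. The last subgroup
-- contains 31 = 01 - 10, so `corner` is not a transversal for it.
cocliques : List (List ShV)
cocliques = cosets ((0F , 0F) ∷ (0F , 2F) ∷ (2F , 0F) ∷ (2F , 2F) ∷ []) corner
         ++ cosets ((0F , 0F) ∷ (1F , 2F) ∷ (2F , 0F) ∷ (3F , 2F) ∷ []) corner
         ++ cosets ((0F , 0F) ∷ (2F , 1F) ∷ (0F , 2F) ∷ (2F , 3F) ∷ []) corner
         ++ cosets ((0F , 0F) ∷ (1F , 3F) ∷ (2F , 2F) ∷ (3F , 1F) ∷ []) (L.take 4 allSh)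
  where
  corner : List ShV
  corner = (0F , 0F) ∷ (0F , 1F) ∷ (1F , 0F) ∷ (1F , 1F) ∷ []
  cosets : List ShV → List ShV → List (List ShV)
  cosets H vs = map (λ v → map (plus v) H) vs

within : List ShV → List ShV → Bool
within ts A = all (λ a → any (eqSh a) ts) A

contains-coclique : ShV → ShV → ShV → ShV → Bool
contains-coclique t₀ t₁ t₂ t₃ = any (within (t₀ ∷ t₁ ∷ t₂ ∷ t₃ ∷ [])) cocliques

abstract
  cocliques-complete : (t : Z4 → ShV) → (∀ k l → k ≢ l → 2 ≤ shD (t k) (t l)) →
                       T (contains-coclique (t 0F) (t 1F) (t 2F) (t 3F))
  cocliques-complete = ∀cocliques contains-coclique tt

Fan : List (List ShV) → Code 3 0 → ShV → Set
Fan As C v = ∃[ A ] (A ∈ As × (∀ {u} → u ∈ A → ∃[ w ] ((v ∷ u ∷ w ∷ [] , []) ∈ C)))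

-- In the fibre, distance 4 is the diameter of D(2,0), so any two of its four words are at distance
-- 2 already in the first remaining coordinate.
fans : {C : Code 3 0} → (∀ v → Full 4 4 (fibre v C)) → ∀ v → Fan cocliques C v
fans {C} full v = go (fibre v C) (full v) (∈-fibre {v = v} {C})
  where
  go : (D : Code 2 0) → Full 4 4 D → (∀ {x} → x ∈ D → consSh v x ∈ C) → Fan cocliques C v
  go D@((t₀ ∷ w₀ ∷ [] , []) ∷ (t₁ ∷ w₁ ∷ [] , []) ∷ (t₂ ∷ w₂ ∷ [] , []) ∷ (t₃ ∷ w₃ ∷ [] , []) ∷ []) (u , s , refl) into =
    conclude (any-T (within ts) cocliques (cocliques-complete (headSh ∘ L.lookup D) ≥2))
    where
    ts = t₀ ∷ t₁ ∷ t₂ ∷ t₃ ∷ []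
    ≥2 : ∀ k l → k ≢ l → 2 ≤ shD (headSh (L.lookup D k)) (headSh (L.lookup D l))
    ≥2 k l k≢l = +-cancelʳ-≤ 2 2 _ (≤-trans (s (∈-lookup k) (∈-lookup l) (k≢l ∘ unique-lookup u k l))
      (≤-trans (≤-reflexive (δ-splitSh (L.lookup D k) (L.lookup D l)))
               (+-monoʳ-≤ (shD (headSh (L.lookup D k)) (headSh (L.lookup D l))) (δ-≤ (tailSh (L.lookup D k)) (tailSh (L.lookup D l))))))
    occurs-in : ∀ {a} → a ∈ ts → ∃[ w ] ((v ∷ a ∷ w ∷ [] , []) ∈ C)
    occurs-in (here refl) = w₀ , into (here refl)
    occurs-in (there (here refl)) = w₁ , into (there (here refl))
    occurs-in (there (there (here refl))) = w₂ , into (there (there (here refl)))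
    occurs-in (there (there (there (here refl)))) = w₃ , into (there (there (there (here refl))))
    conclude : ∃[ A ] (A ∈ cocliques × T (within ts A)) → Fan cocliques C v
    conclude (A , A∈ , t) = A , A∈ , λ {a} a∈ → found a (any-T (eqSh a) ts (all-T (λ a → any (eqSh a) ts) A t a∈))
      where
      found : ∀ a → ∃[ b ] (b ∈ ts × T (eqSh a b)) → ∃[ w ] ((v ∷ a ∷ w ∷ [] , []) ∈ C)
      found a (b , b∈ , e) = subst (λ z → ∃[ w ] ((v ∷ z ∷ w ∷ [] , []) ∈ C)) (sym (eqSh⇒≡ a b e)) (occurs-in b∈)

line : ShV → ShV → Code 3 0
line v u = map (λ w → v ∷ u ∷ w ∷ [] , []) allSh

prefix : Vertex 3 0 → Vertex 2 0
prefix (v ∷ u ∷ _ ∷ [] , []) = v ∷ u ∷ [] , []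

prefix-δ : (x y : Vertex 3 0) → δ x y ≤ δ (prefix x) (prefix y) + 2
prefix-δ (v ∷ u ∷ w ∷ [] , []) (v′ ∷ u′ ∷ w′ ∷ [] , []) = ≤-trans
  (≤-reflexive (solve 3 (λ p q r → p :+ (q :+ (r :+ con 0)) :+ con 0 := p :+ (q :+ con 0) :+ con 0 :+ r) refl (shD v v′) (shD u u′) (shD w w′)))
  (+-monoʳ-≤ (shD v v′ + (shD u u′ + 0) + 0) (shD≤2 w w′))
  where open +-*-Solver

prefix-compatible : {C : Code 3 0} → Sep 4 C → ∀ {x y} → x ∈ C → y ∈ C → T (compatible 2 (prefix x) (prefix y))
prefix-compatible s {x} {y} x∈ y∈ = compatible-intro (prefix x) (prefix y) λ ne →
  +-cancelʳ-≤ 2 2 _ (≤-trans (s x∈ y∈ (ne ∘ cong prefix)) (prefix-δ x y))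

-- Necessary for a word (v,u,w) to be compatible with all of acc, whatever w is;
-- testing this first prunes most of the search.
room : ShV → Code 3 0 → ShV → Bool
room v acc u = all (λ x → compatible 2 (v ∷ u ∷ [] , []) (prefix x)) acc

refuted : List (List ShV) → List ShV → Code 3 0 → Bool
-- A partial code that survives all listed vertices has not been refuted.
refuted As [] acc = false
refuted As (v ∷ vs) acc = all (λ A → implies (all (room v acc) A) (all (refuted As vs) (backtrack 4 (map (line v) A) acc))) As

refuted-sound : (As : List (List ShV)) {C : Code 3 0} → Sep 4 C → (∀ v → Fan As C v) → (vs : List ShV) (acc : Code 3 0) →
                (∀ {x} → x ∈ acc → x ∈ C) → T (refuted As vs acc) → ⊥
refuted-sound As {C} s sup (v ∷ vs) acc acc⊆ t = step (sup v)
  where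
  step : Fan As C v → ⊥
  step (A , A∈ , pts) = next (backtrack-complete s (map (line v) A) meets acc acc⊆)
    where
    meets : ∀ {row} → row ∈ map (line v) A → Meets C row
    meets row∈ with ∈-map⁻ (line v) row∈
    ... | u , u∈ , refl with pts u∈
    ... | w , w∈ = (v ∷ u ∷ w ∷ [] , []) , ∈-map⁺ (λ w → v ∷ u ∷ w ∷ [] , []) (∈-allSh w) , w∈
    roomy : ∀ {u} → u ∈ A → T (room v acc u)
    roomy {u} u∈ = all⁻ (λ x → compatible 2 (v ∷ u ∷ [] , []) (prefix x)) (All.tabulate (λ x∈ → prefix-compatible s (proj₂ (pts u∈)) (acc⊆ x∈)))
    next : ∃[ sol ] (sol ∈ backtrack 4 (map (line v) A) acc × (∀ {x} → x ∈ sol → x ∈ C)) → ⊥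
    next (sol , sol∈ , sol⊆) = refuted-sound As s sup vs sol sol⊆
      (all-T (refuted As vs) (backtrack 4 (map (line v) A) acc) (modus {all (room v acc) A} (all-T
        (λ A → implies (all (room v acc) A) (all (refuted As vs) (backtrack 4 (map (line v) A) acc))) As t A∈)
        (all⁻ (room v acc) (All.tabulate roomy))) sol∈)

origin : ℕ × ℕ × ℕ × ℕ → Code 3 0
origin t = map (consSh (0F , 0F)) (codeOfPatterns (patterns 2 t) 0)

-- Four consecutive vertices of the hexagon around 00. Words over adjacent vertices must be 3 apart
-- in the other two coordinates, which prunes the search.
neighbours : List ShV
neighbours = (0F , 1F) ∷ (1F , 1F) ∷ (1F , 0F) ∷ (0F , 3F) ∷ []

abstract
  origin-refuted : ∀ {t} → t ∈ parts₃ 2 → T (refuted cocliques neighbours (origin t))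
  origin-refuted = all-T (λ t → refuted cocliques neighbours (origin t)) (parts₃ 2) tt

-- The fibre over 00 has distance 4 in D(2,0), hence lies in one of four classes; a transform of the
-- last two coordinates makes it one of the `origin` codes.
exclude-D30 : {C : Code 3 0} → Unique C → Sep 4 C → 64 ≤ length C → ⊥
exclude-D30 {C} u s l = conclude (patterns-complete (fibre (0F , 0F) C) (fibre-full u s l (0F , 0F)))
  where
  conclude : ∃[ t ] (t ∈ parts₃ 2 × fibre (0F , 0F) C ⟶ codeOfPatterns (patterns 2 t) 0) → ⊥
  conclude (t , t∈ , (f , into)) = refuted-sound cocliques s′ (fans (fibre-full u′ s′ l′)) neighbours (origin t) start (origin-refuted t∈)
    where
    f′ = liftSh autId f
    C′ = map (apply f′) C
    u′ = unique-image f′ u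
    s′ : Sep 4 C′
    s′ = sep-image f′ {d = 4} s
    l′ = ≤-trans l (≤-reflexive (sym (length-map (apply f′) C)))
    start : ∀ {x} → x ∈ origin t → x ∈ C′
    start x∈ with ∈-map⁻ (consSh (0F , 0F)) x∈
    ... | y , y∈ , refl = raise (onto {d = 4} f (fibre-full u s l (0F , 0F)) ≤-refl into y∈)
      where
      raise : ∃[ z ] (z ∈ fibre (0F , 0F) C × y ≡ apply f z) → consSh (0F , 0F) y ∈ C′
      raise (z , z∈ , refl) = ∈-map⁺ (apply f′) (∈-fibre {v = 0F , 0F} z∈)

-- Shortening

shortenK : ∀ {d M} → 1 ≤ M → Packing m (suc n) (suc d) (4 * M) → Packing m n (suc d) M
shortenK {d = d} {suc M} _ (C , u , s , l) = conclude (fair-share (allFin 4) (λ a x → eqZ4 a (headK x)) 1 (once ∘ headK) C M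
    (<-≤-trans (*-monoʳ-< 4 (n<1+n M)) (≤-trans l (≤-reflexive (sym (*-identityʳ _))))))
  where
  conclude : ∃[ a ] (M < length (filter (T? ∘ eqZ4 a ∘ headK) C)) → Packing _ _ (suc d) (suc M)
  conclude (a , lt) = slice a C , proj₁ sep , proj₂ sep , ≤-trans lt (≤-reflexive (sym (length-map tailK (filter (T? ∘ eqZ4 a ∘ headK) C))))
    where sep = slice-separated a d u s

shortenSh : ∀ {d M} → 1 ≤ M → Packing (suc m) n (suc d) (16 * M) → Packing m n (suc d) M
shortenSh {d = d} {suc M} _ (C , u , s , l) = conclude (fair-share allSh (λ a x → eqSh a (headSh x)) 1 (once-Sh ∘ headSh) C M
    (<-≤-trans (*-monoʳ-< 16 (n<1+n M)) (≤-trans l (≤-reflexive (sym (*-identityʳ _))))))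
  where
  conclude : ∃[ a ] (M < length (filter (T? ∘ eqSh a ∘ headSh) C)) → Packing _ _ (suc d) (suc M)
  conclude (a , lt) = fibre a C , proj₁ sep , proj₂ sep , ≤-trans lt (≤-reflexive (sym (length-map tailSh (filter (T? ∘ eqSh a ∘ headSh) C))))
    where sep = fibre-separated a d u s

triangle : ShV → ShV → Bool
triangle v x = eqSh v x ∨ (eqSh (plus (0F , 1F) v) x ∨ eqSh (plus (1F , 1F) v) x)

abstract
  triangle-thrice : ∀ x → 3 ≤ ∑ allSh (λ v → bit (triangle v x))
  triangle-thrice x = ≤ᵇ⇒≤ _ _ (∀Sh (λ x → 3 ≤ᵇ ∑ allSh (λ v → bit (triangle v x))) tt x)

  triangle-diameter : ∀ v x y → T (triangle v x) → T (triangle v y) → shD x y ≤ 1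
  triangle-diameter v x y p q = ≤ᵇ⇒≤ _ _ (modus {triangle v x ∧ triangle v y} {shD x y ≤ᵇ 1}
    (∀Sh³ (λ v x y → implies (triangle v x ∧ triangle v y) (shD x y ≤ᵇ 1)) tt v x y) (Equivalence.from T-∧ (p , q)))

-- Replaces shortening when there is no K₄ coordinate: fixing a triangle instead of a
-- vertex keeps three times as many words and loses only 1 in the distance.
restrict-triangle : ∀ {d} → Packing (suc m) n (2 + d) 64 → Packing m n (1 + d) 12
restrict-triangle {d = d} (C , u , s , l) = conclude (fair-share allSh (λ v x → triangle v (headSh x)) 3 (triangle-thrice ∘ headSh) C 11
    -- 16 · 11 = 176 < 192 = 64 · 3, so some triangle carries at least 12 words.
    (≤-trans (≤ᵇ⇒≤ 177 192 tt) (*-monoˡ-≤ 3 l)))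
  where
  conclude : ∃[ v ] (11 < length (filter (T? ∘ triangle v ∘ headSh) C)) → Packing _ _ (1 + d) 12
  conclude (v , lt) = map tailSh D , proj₁ sep , proj₂ sep , ≤-trans lt (≤-reflexive (sym (length-map tailSh D)))
    where
    P? = T? ∘ triangle v ∘ headSh
    D = filter P? C
    le : ∀ {x y} → x ∈ D → y ∈ D → δ x y ≤ 1 + δ (tailSh x) (tailSh y)
    le {x} {y} x∈ y∈ = ≤-trans (≤-reflexive (δ-splitSh x y)) (+-monoˡ-≤ _
      (triangle-diameter v (headSh x) (headSh y) (proj₂ (∈-filter⁻ P? {xs = C} x∈)) (proj₂ (∈-filter⁻ P? {xs = C} y∈))))
    sep = contract tailSh D 1 d le (UP.filter⁺ P? u) (sep-⊆ {d = 2 + d} (λ p → proj₁ (∈-filter⁻ P? {xs = C} p)) s)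

puncture : ∀ {d M} → Packing m (suc n) (2 + d) M → Packing m n (1 + d) M
puncture {d = d} (C , u , s , l) = map tailK C , proj₁ (proj₂ both′) , proj₂ (proj₂ both′) , ≤-trans l (≤-reflexive (sym (length-map tailK C)))
  where
  both′ : length C ≡ length C × Unique (map tailK C) × Sep (1 + d) (map tailK C)
  both′ = refl , proj₁ full , proj₁ (proj₂ full)
    where full = puncture-full {d = d} {M = length C} {C = C} (u , s , refl)

-- Nonexistence by shortening and counting

exclude-plotkin : ∀ {d} → 5 ≤ d → 2 * m + n ≤ suc d → ¬ Packing m n d 12
-- For 12 words the Plotkin bound reads 576d ≤ 432(d + 1) + 48d, that is 96d ≤ 432, which fails from
-- d = 5 on.
exclude-plotkin {m} {n} {d} 5≤d N≤ (C , u , s , l) = from-no (480 ≤? 432) (≤-trans (*-monoʳ-≤ 96 5≤d) (+-cancelʳ-≤ (480 * d) _ _ (begin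
  96 * d + 480 * d                          ≡⟨ solve 1 (λ d → con 96 :* d :+ con 480 :* d := con 4 :* (con 12 :* (con 12 :* d))) refl d ⟩
  4 * (12 * (12 * d))                       ≤⟨ plotkin (truncate {d = d} C u s l) ⟩
  3 * (2 * m + n) * (12 * 12) + 4 * (12 * d) ≤⟨ +-monoˡ-≤ (4 * (12 * d)) (*-monoˡ-≤ (12 * 12) (*-monoʳ-≤ 3 N≤)) ⟩
  3 * suc d * (12 * 12) + 4 * (12 * d)      ≡⟨ solve 1 (λ d → con 3 :* (con 1 :+ d) :* con 144 :+ con 4 :* (con 12 :* d) := con 432 :+ con 480 :* d) refl d ⟩
  432 + 480 * d                             ∎)))
  where
  open ≤-Reasoning
  open +-*-Solver

-- After division by 4^k sphere packing says 1 + 3N ≤ 16, but N ≥ 6 makes the left side at least 19.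
-- Equality at N = 5 is the perfect case.
exclude-sphere : ∀ {k} → 2 * m + n ≡ k + 2 → 6 ≤ 2 * m + n → ¬ Packing m n 3 (4 ^ k)
exclude-sphere {m} {n} {k} e 6≤N (C , u , s , l) = contradiction (*-cancelˡ-≤ {1 + 3 * (2 * m + n)} {16} (4 ^ k) {{m^n≢0 4 k}} (begin
  4 ^ k * (1 + 3 * (2 * m + n))     ≤⟨ *-monoˡ-≤ (1 + 3 * (2 * m + n)) l ⟩
  length C * (1 + 3 * (2 * m + n))  ≤⟨ sphere-packing u s ⟩
  16 ^ m * 4 ^ n                    ≡⟨ cong (_* 4 ^ n) (^-*-assoc 4 2 m) ⟩
  4 ^ (2 * m) * 4 ^ n               ≡⟨ ^-distribˡ-+-* 4 (2 * m) n ⟨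
  4 ^ (2 * m + n)                   ≡⟨ cong (4 ^_) e ⟩
  4 ^ (k + 2)                       ≡⟨ ^-distribˡ-+-* 4 k 2 ⟩
  4 ^ k * 16                        ∎)) (<⇒≱ (≤-trans (≤ᵇ⇒≤ 17 19 tt) (s≤s (*-monoʳ-≤ 3 6≤N))))
  where open ≤-Reasoning

weaken : ∀ {d M M′} → M′ ≤ M → Packing m n d M → Packing m n d M′
weaken le (C , u , s , l) = C , u , s , ≤-trans le l

1≤4^ : ∀ k → 1 ≤ 4 ^ k
1≤4^ k = m^n>0 4 k

double : ∀ m n → 2 * suc m + n ≡ 2 + (2 * m + n)
double m n = cong (_+ n) (*-suc 2 m)

-- Shortening keeps the distance and lowers `j` by 1 or 2, down to the Plotkin case `j = 0`. Only
-- `j = 1` without a K₄ coordinate cannot be shortened to it and is restricted to a triangle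
-- instead.
exclude-far : ∀ e j → 2 * m + n ≡ 5 + e + suc j → ¬ Packing m n (5 + e) (4 ^ (2 + j))
exclude-far e zero N p = exclude-plotkin (m≤m+n 5 e) (≤-reflexive (trans N (+-comm _ 1))) (weaken (≤ᵇ⇒≤ 12 16 tt) p)
exclude-far {m} {suc n} e (suc zero) N p = exclude-far e zero
  (suc-injective (trans (sym (+-suc (2 * m) n)) (trans N (+-suc (5 + e) 1)))) (shortenK (s≤s z≤n) p)
exclude-far {suc m} {zero} e (suc zero) N p = exclude-plotkin (N.s≤s⁻¹ 6≤) (≤-reflexive N′) (restrict-triangle p)
  where
  N′ : 2 * m + 0 ≡ 5 + e
  N′ = +-cancelˡ-≡ 2 _ _ (trans (sym (double m 0)) (trans N (+-comm (5 + e) 2)))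
  -- The triangle costs 1 in the distance, yet 5 must remain: `5 + e` equals the even number
  -- `2 * m`, so it is not 5.
  6≤ : 6 ≤ 5 + e
  6≤ = subst (6 ≤_) (trans (sym (+-identityʳ (2 * m))) N′) (*-monoʳ-≤ 2 {3} {m} (≮⇒≥ λ m<3 →
    contradiction (≤-trans (≤-trans (m≤m+n 5 e) (≤-reflexive (trans (sym N′) (+-identityʳ (2 * m))))) (*-monoʳ-≤ 2 {m} {2} (N.s≤s⁻¹ m<3))) (from-no (5 ≤? 4))))
exclude-far {zero} {zero} e (suc zero) () p
exclude-far {suc m} {n} e (suc (suc j)) N p = exclude-far {m} {n} e j
  (+-cancelˡ-≡ 2 _ _ (trans (sym (double m n)) (trans N (solve 2 (λ e j → con 5 :+ e :+ (con 3 :+ j) := con 2 :+ (con 5 :+ e :+ (con 1 :+ j))) refl e j))))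
  (shortenSh (1≤4^ (2 + j)) (weaken (≤-reflexive (*-assoc 4 4 (4 ^ (2 + j)))) p))
  where open +-*-Solver
exclude-far {zero} {suc n} e (suc (suc j)) N p = exclude-far {zero} {n} e (suc j)
  (suc-injective (trans N (+-suc (5 + e) (2 + j)))) (shortenK (1≤4^ (3 + j)) p)
exclude-far {zero} {zero} e (suc (suc j)) () p

exclude-D0 : ∀ j → ¬ Packing (3 + j) 0 4 (4 ^ (3 + 2 * j))
exclude-D0 zero (C , u , s , l) = exclude-D30 u s l
exclude-D0 (suc j) p = exclude-D0 j (shortenSh (1≤4^ (3 + 2 * j))
  (weaken (≤-reflexive (trans (*-assoc 4 4 (4 ^ (3 + 2 * j))) (cong (4 ^_) (cong (3 +_) (sym (*-suc 2 j)))))) p))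

-- For d = 4 puncturing leads to d = 3 with length still at least 6. Without a K₄ coordinate there
-- is nothing to puncture, and shortening goes down to D(3,0).
exclude : ∀ d j → 6 < 2 * m + n → 2 < d → 2 * m + n ≡ d + suc j → ¬ Packing m n d (4 ^ (2 + j))
exclude {m} {n} 3 j lt _ N p = exclude-sphere {m} {n} {2 + j} (trans N (+-comm 2 (2 + j))) (<⇒≤ lt) p
exclude {m} {suc n} 4 j lt _ N p = exclude-sphere {m} {n} {2 + j} (trans N′ (+-comm 2 (2 + j))) (N.s≤s⁻¹ (≤-trans lt (≤-reflexive (+-suc (2 * m) n)))) (puncture p)
  where
  N′ : 2 * m + n ≡ 4 + j
  N′ = suc-injective (trans (sym (+-suc (2 * m) n)) N)
exclude {m} {zero} 4 j lt _ N p = even m lt N p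
  where
  even : ∀ m → 6 < 2 * m + 0 → 2 * m + 0 ≡ 5 + j → Packing m 0 4 (4 ^ (2 + j)) → ⊥
  even 0 ()
  even 1 lt = contradiction lt (from-no (7 ≤? 2))
  even 2 lt = contradiction lt (from-no (7 ≤? 4))
  even (suc (suc (suc i))) lt N p = exclude-D0 i (subst (λ k → Packing (3 + i) 0 4 (4 ^ k)) exponent p)
    where
    exponent : 2 + j ≡ 3 + 2 * i
    exponent = +-cancelˡ-≡ 3 _ _ (trans (sym N) (solve 1 (λ i → con 2 :* (con 3 :+ i) :+ con 0 := con 6 :+ con 2 :* i) refl i))
      where open +-*-Solver
exclude (suc (suc (suc (suc (suc e))))) j lt _ N p = exclude-far e j N p
exclude 1 j lt (s≤s ()) N p
exclude 2 j lt (s≤s (s≤s ())) N p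

-- Class numbers for the given parameters

no-classes : ∀ {k} → (∀ (C : Code m n) → ¬ IsMDS m n k C) → NumClasses m n k 0
no-classes none = [] , (λ ()) , (λ ()) , λ C h → ⊥-elim (none C h)

base-MDS : ∀ {k d} (b : Base m n) → 1 ≤ k → suc d ≡ 2 * m + n + 1 ∸ k → T (separated (suc d) (Base.code b)) →
           length (Base.code b) ≡ 4 ^ k → T (δ (Base.q₀ b) (Base.q₁ b) ≡ᵇ suc d) → IsMDS m n k (Base.code b)
base-MDS {d = d} b 1≤k e sep len t = MDS-intro 1≤k e (proj₁ full , proj₂ full , len) (here refl) (there (here refl)) apart eq
  where
  full = separated⇒sep d (Base.code b) sep
  eq : δ (Base.q₀ b) (Base.q₁ b) ≡ suc d
  eq = ≡ᵇ⇒≡ _ _ t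
  apart : Base.q₀ b ≢ Base.q₁ b
  apart q = contradiction (trans (sym eq) (trans (cong (δ (Base.q₀ b)) (sym q)) (δ-refl (Base.q₀ b)))) λ ()

profile-differs : {C C′ : Code m n} (g : ℕ → ℕ) → Unique C → Unique C′ → T (not (profile g C ≡ᵇ profile g C′)) → ¬ Equivalent C C′
profile-differs {C = C} {C′} g u u′ t eq = no-T (profile g C ≡ᵇ profile g C′) (≡⇒≡ᵇ _ _ (profile-equivalent g u u′ eq)) t
  where
  no-T : ∀ b → T b → T (not b) → ⊥
  no-T true _ ()

-- The number of ordered pairs of codewords with exactly one special coordinate separates the two classes.
single : ℕ → ℕ
single t = bit (t ≡ᵇ 1)

two-classes : ∀ {k} (b : Fin 2 → Base m n) → (∀ i → IsMDS m n k (Base.code (b i))) →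
              T (not (profile single (Base.code (b 0F)) ≡ᵇ profile single (Base.code (b 1F)))) →
              T (not (profile single (Base.code (b 1F)) ≡ᵇ profile single (Base.code (b 0F)))) →
              ∀ i j → i ≢ j → ¬ Equivalent (Base.code (b i)) (Base.code (b j))
two-classes b mds t t′ 0F 0F ne = contradiction refl ne
two-classes b mds t t′ 0F 1F ne = profile-differs single (proj₁ (proj₂ (mds 0F))) (proj₁ (proj₂ (mds 1F))) t
two-classes b mds t t′ 1F 0F ne = profile-differs single (proj₁ (proj₂ (mds 1F))) (proj₁ (proj₂ (mds 0F))) t′
two-classes b mds t t′ 1F 1F ne = contradiction refl ne

one-class : {code : Fin 1 → Code m n} → ∀ i j → i ≢ j → ¬ Equivalent (code i) (code j)
one-class 0F 0F ne = contradiction refl ne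

abstract
  mdsA : ∀ r → IsMDS 2 0 2 (Base.code (baseA r))
  mdsA 0F = base-MDS {k = 2} {2} (baseA 0F) (s≤s z≤n) refl tt refl tt
  mdsA 1F = base-MDS {k = 2} {2} (baseA 1F) (s≤s z≤n) refl tt refl tt

  classesA : NumClasses 2 0 2 2
  classesA = classification {k = 2} {3} refl codeA mdsA (two-classes {k = 2} baseA mdsA tt tt) (λ C → classifyA)

  classesB : NumClasses 1 2 2 1
  classesB = classification {k = 2} {3} refl (λ _ → codeB) (λ _ → base-MDS {k = 2} {2} baseB (s≤s z≤n) refl tt refl tt)
    one-class (λ C full → 0F , classifyB full)

  mdsC : ∀ r → IsMDS 2 1 3 (Base.code (baseC r))
  mdsC 0F = base-MDS {k = 3} {2} (baseC 0F) (s≤s z≤n) refl tt refl tt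
  mdsC 1F = base-MDS {k = 3} {2} (baseC 1F) (s≤s z≤n) refl tt refl tt

  classesC : NumClasses 2 1 3 2
  classesC = classification {k = 3} {3} refl (Base.code ∘ baseC) mdsC (two-classes {k = 3} baseC mdsC tt tt) (λ C → classifyC)

  classesD : NumClasses 1 3 3 1
  classesD = classification {k = 3} {3} refl (λ _ → Base.code baseD) (λ _ → base-MDS {k = 3} {2} baseD (s≤s z≤n) refl tt refl tt)
    one-class (λ C full → 0F , classifyD full)

  mdsE : ∀ r → IsMDS 2 1 2 (Base.code (baseE r))
  mdsE 0F = base-MDS {k = 2} {3} (baseE 0F) (s≤s z≤n) refl tt refl tt
  mdsE 1F = base-MDS {k = 2} {3} (baseE 1F) (s≤s z≤n) refl tt refl tt

  classesE : NumClasses 2 1 2 2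
  classesE = classification {k = 2} {4} refl (Base.code ∘ baseE) mdsE (two-classes {k = 2} baseE mdsE tt tt) (λ C → classifyE)

  classesF : NumClasses 1 3 2 1
  classesF = classification {k = 2} {4} refl (λ _ → Base.code baseF) (λ _ → base-MDS {k = 2} {3} baseF (s≤s z≤n) refl tt refl tt)
    one-class (λ C full → 0F , classifyF full)

  classesG : NumClasses 2 2 3 1
  classesG = classification {k = 3} {4} refl (λ _ → Base.code baseG) (λ _ → base-MDS {k = 3} {3} baseG (s≤s z≤n) refl tt refl tt)
    one-class (λ C full → 0F , classifyG full)

packed : ∀ {d M} {C : Code m n} → Full d M C → Packing m n d M
packed {C = C} (u , s , l) = C , u , s , ≤-reflexive (sym l)

no-perfect : ∀ m n → 2 * m + n ≡ 6 → NumClasses m n 4 0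
no-perfect m n e = no-classes λ C h → exclude-sphere {m} {n} {4} e (≤-reflexive (sym e)) (packed (MDS-elim {k = 4} (sym (cong (λ N → N + 1 ∸ 4) e)) h))

no-D14 : NumClasses 1 4 3 0
no-D14 = no-classes λ C h → excludeH (MDS-elim {k = 3} refl h)

no-D30 : NumClasses 3 0 3 0
no-D30 = no-classes λ C h → conclude (MDS-elim {k = 3} {d = 4} refl h)
  where
  conclude : {C : Code 3 0} → Full 4 64 C → ⊥
  conclude (u , s , l) = exclude-D30 u s (≤-reflexive (sym l))

no-two-dimensional : ∀ m n → 2 * m + n ≡ 6 → NumClasses m n 2 0
no-two-dimensional m n e = no-classes λ C h → exclude-far {m} {n} 0 0 e (packed (MDS-elim {k = 2} (sym (cong (λ N → N + 1 ∸ 2) e)) h))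

no-long : ∀ m n d → 6 < 2 * m + n → 2 < d → d < 2 * m + n → NumClasses m n (2 * m + n ∸ d + 1) 0
no-long m n d lt 2<d d<N = conclude (m≤n⇒∃[o]m+o≡n d<N)
  where
  conclude : ∃[ j ] (suc d + j ≡ 2 * m + n) → NumClasses m n (2 * m + n ∸ d + 1) 0
  conclude (j , e) = subst (λ k → NumClasses m n k 0) (sym k≡) (no-classes λ C h →
      exclude {m} {n} d j lt 2<d N≡ (packed (MDS-elim {k = 2 + j} d≡ h)))
    where
    N≡ : 2 * m + n ≡ d + suc j
    N≡ = trans (sym e) (sym (+-suc d j))
    k≡ : 2 * m + n ∸ d + 1 ≡ 2 + j
    k≡ = trans (cong (λ N → N ∸ d + 1) N≡) (trans (cong (_+ 1) (m+n∸m≡n d (suc j))) (+-comm (suc j) 1))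
    d≡ : d ≡ 2 * m + n + 1 ∸ (2 + j)
    d≡ = sym (trans (cong (λ N → N + 1 ∸ (2 + j)) N≡) (trans (cong (_∸ (2 + j)) (trans (+-assoc d (suc j) 1) (cong (d +_) (+-comm (suc j) 1)))) (m+n∸n≡m d (2 + j))))

count : ∀ m n → 1 ≤ m + n → Σ[ L ∈ ℕ ] (NumClasses m n 1 L × ℤ.+ L Q./ 1 ≡ ((((ℤ.+ (m ^ 3) Q./ 36 Q.+ ℤ.+ (7 * m ^ 2) Q./ 24) Q.+ ℤ.+ (11 * m) Q./ 12) Q.+ Q.1ℚ)
                       Q.- ℤ.+ (m % 2) Q./ 8) Q.- ℤ.+ (m % 3) Q./ 9)
count m n pos = length (parts₃ m) , classes₁ pos , rational (length (parts₃ m)) (m ^ 3) (7 * m ^ 2) (11 * m) (m % 2) (m % 3) (parts₃-length m)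

open import Data.Integer using (+_)
open import Data.Rational using (ℚ; _/_; _-_; 1ℚ)

theorem1 :
    -- (1) L_{m,n,1} = m³/36 + 7m²/24 + 11m/12 + 1 - (m mod 2)/8 - (m mod 3)/9
    (∀ m n → 1 ≤ m + n →
      Σ[ L ∈ ℕ ] (NumClasses m n 1 L
        × (+ L / 1 ≡ ((((+ (m ^ 3) / 36 Q.+ + (7 * m ^ 2) / 24) Q.+ + (11 * m) / 12) Q.+ 1ℚ)
                       - + (m % 2) / 8) - + (m % 3) / 9)))
    -- (2) d = 3 : k = 2m+n-2 ; d = 4 : k = 2m+n-3
    × (NumClasses 2 0 (2 * 2 + 0 ∸ 2) 2 × NumClasses 1 2 (2 * 1 + 2 ∸ 2) 1
       × NumClasses 2 1 (2 * 2 + 1 ∸ 2) 2 × NumClasses 1 3 (2 * 1 + 3 ∸ 2) 1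
       × NumClasses 2 2 (2 * 2 + 2 ∸ 2) 0 × NumClasses 1 4 (2 * 1 + 4 ∸ 2) 0
       × NumClasses 3 0 (2 * 3 + 0 ∸ 2) 0)
    × (NumClasses 2 0 (2 * 2 + 0 ∸ 3) 4 × NumClasses 1 2 (2 * 1 + 2 ∸ 3) 2
       × NumClasses 2 1 (2 * 2 + 1 ∸ 3) 2 × NumClasses 1 3 (2 * 1 + 3 ∸ 3) 1
       × NumClasses 2 2 (2 * 2 + 2 ∸ 3) 1 × NumClasses 1 4 (2 * 1 + 4 ∸ 3) 0
       × NumClasses 3 0 (2 * 3 + 0 ∸ 3) 0)
    -- (3) 2m+n = 6 ⇒ L_{m,n,2} = 0
    × (∀ m n → 2 * m + n ≡ 6 → NumClasses m n 2 0)
    -- (4) 2m+n > 6, 2 < d < 2m+n ⇒ L_{m,n,2m+n-d+1} = 0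
    × (∀ m n d → 6 < 2 * m + n → 2 < d → d < 2 * m + n →
         NumClasses m n (2 * m + n ∸ d + 1) 0)
theorem1 =
    count
  , (classesA , classesB , classesC , classesD , no-perfect 2 2 refl , no-perfect 1 4 refl , no-perfect 3 0 refl)
  , (classes₁ (s≤s z≤n) , classes₁ (s≤s z≤n) , classesE , classesF , classesG , no-D14 , no-D30)
  , no-two-dimensional
  , no-long
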